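{- Let $R$ be a commutative $\mathbb{Q}$-algebra with unity, let $\Delta=(V,\mathcal{A})$ be a finite digraph (multi-arcs and multi-loops allowed), and let $\tau,\upsilon:\mathcal{A}\to R$ be arbitrary maps. Define $\theta^{\rm G}:\mathcal{A}\times\mathcal{A}\to R$ by $$\theta^{\rm G}(a,a')=\tau(a')\,\delta_{\mathfrak{h}(a)\mathfrak{t}(a')}-\upsilon(a')\,\delta_{a'\in S(a)}.$$ Then, in $R[[t]]$, $$Z_{\Delta}(t;\theta^{\rm G})^{ -1}=f_{\Delta}(t)\,\det\!\left(I-tA_{\Delta}(\theta^{\rm G})+t^2D_{\Delta}(\theta^{\rm G})\right),$$ where $I$ is the identity matrix of size $|V|$ and $f_\Delta$, $A_\Delta(\theta^{\rm G})$, $D_\Delta(\theta^{\rm G})$ are as defined in the context.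
   Context: A finite digraph $\Delta=(V,\mathcal{A})$ consists of a finite vertex set $V$ and a finite multiset $\mathcal{A}$ of arcs; each arc $a$ has a tail $\mathfrak{t}(a)\in V$ and head $\mathfrak{h}(a)\in V$ (loops $\mathfrak{t}(a)=\mathfrak{h}(a)$ and parallel arcs are allowed). For $u,v\in V$ let $\mathcal{A}_{uv}=\{a\in\mathcal{A}:\mathfrak{t}(a)=u,\mathfrak{h}(a)=v\}$. For $a\in\mathcal{A}_{uv}$ put $S(a)=\mathcal{A}_{vu}$ (the set of inverse arcs of $a$; in particular every loop at $u$ is an inverse of every loop at $u$, including itself); $\delta_{a'\in S(a)}$ is $1$ if $a'\in S(a)$ and $0$ otherwise, and $\delta_{xy}$ is the Kronecker delta. Zeta function: for a map $\theta:\mathcal{A}\times\mathcal{A}\to R$ and $m\ge1$, let $N_m(\theta)=\sum \theta(a_1,a_2)\theta(a_2,a_3)\cdots\theta(a_{m-1},a_m)\theta(a_m,a_1)$, the sum running over all sequences $(a_1,\dots,a_m)\in\mathcal{A}^m$ with $\mathfrak{h}(a_i)=\mathfrak{t}(a_{i+1})$ for $1\le i\le m-1$ and $\mathfrak{h}(a_m)=\mathfrak{t}(a_1)$ (closed paths of length $m$). Then $Z_\Delta(t;\theta)=\exp\left(\sum_{m\ge1}\frac{N_m(\theta)}{m}t^m\right)\in R[[t]]$. Fix a total order $\le$ on $V$. Let $\mathcal{A}(u,v)=\mathcal{A}_{uv}\cup\mathcal{A}_{vu}$ and $\Phi_\Delta=\{(u,v)\in V\times V: u\le v,\ \mathcal{A}(u,v)\neq\emptyset\}$,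 and let $\Phi^{(3)}_\Delta=\{(u,v)\in\Phi_\Delta: u\ne v,\ \mathcal{A}_{uv}\ne\emptyset,\ \mathcal{A}_{vu}\neq\emptyset\}$. For $(u,v)\in V\times V$ define $$f_{(u,v)}(t)=\begin{cases}1+t\sum_{a\in\mathcal{A}_{uu}}\upsilon(a), & u=v,\\ 1-t^2\Big(\sum_{a\in\mathcal{A}_{uv}}\upsilon(a)\Big)\Big(\sum_{a\in\mathcal{A}_{vu}}\upsilon(a)\Big), & u\ne v,\end{cases}$$ which is invertible in $R[[t]]$, and $f_\Delta(t)=\prod_{(u,v)\in\Phi_\Delta}f_{(u,v)}(t)$. For $u,v\in V$ put $a_{uv}=\sum_{a\in\mathcal{A}_{uv}}\tau(a)$ and $d_{uv}=\sum_{a\in\mathcal{A}_{uv},\,a'\in\mathcal{A}_{vu}}\tau(a)\upsilon(a')$. Then $A_\Delta(\theta^{\rm G})$ and $D_\Delta(\theta^{\rm G})$ are the $V\times V$ matrices over $R[[t]]$ with entries $$A_\Delta(\theta^{\rm G})_{ww'}=f_{(w,w')}(t)^{ -1}a_{ww'},\qquad D_\Delta(\theta^{\rm G})_{ww'}=\delta_{ww'}\sum_{(u,v)\in\Phi^{(3)}_\Delta}f_{(u,v)}(t)^{ -1}\left(\delta_{wu}d_{uv}+\delta_{wv}d_{vu}\right).$$ -}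

module Defs where

open import Algebra.Bundles using (CommutativeRing)
open import Algebra.Bundles.Raw using (RawRing)
import Algebra.Definitions.RawSemiring as RawSemiringDefs
open import Algebra.Morphism.Structures using (module RingMorphisms)
import Algebra.Properties.Ring as RingProperties
import Algebra.Properties.Semiring.Sum as SemiringSum
open import Data.Bool.Base using (true; false; if_then_else_)
open import Data.Fin.Base using (Fin; zero; suc; toℕ; fromℕ; inject₁; punchIn)
open import Data.Fin.Properties using (_≟_; any?; all?)
import Data.Integer.Base as ℤ
open import Data.Nat.Base using (ℕ; zero; suc; _∸_; _≤_; _<_; z≤n; s≤s; _!)
import Data.Nat.Properties as ℕ
open import Data.Product.Base using (_×_; ∃)
open import Data.Rational.Base as ℚ using (ℚ)
open import Data.Vec.Functional using (Vector; []; _∷_)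
open import Level using (0ℓ) renaming (_⊔_ to _⊔ˡ_; suc to lsuc)
open import Relation.Binary.Core using (Rel)
open import Relation.Binary.Consequences using (total∧dec⇒dec)
import Relation.Binary.Definitions as B
import Relation.Binary.Reasoning.Setoid as SetoidReasoning
open import Relation.Binary.Structures using (IsTotalOrder)
open import Relation.Binary.PropositionalEquality.Core as ≡ using (_≡_; _≢_)
open import Relation.Nullary.Decidable.Core using (Dec; does; ¬?; _×-dec_; _⊎-dec_)
import Relation.Unary as U

record CommutativeℚAlgebra c ℓ : Set (lsuc (c ⊔ˡ ℓ)) where
  field
    commutativeRing : CommutativeRing c ℓ

  open CommutativeRing commutativeRing public

  field
    algebraMap     : ℚ → Carrier
    isHomomorphism : RingMorphisms.IsRingHomomorphism ℚ.+-*-rawRing rawRing algebraMap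

module FiniteAlgebra {c ℓ} (R : RawRing c ℓ) where
  open RawRing R
  open RawSemiringDefs rawSemiring public using (sum; product; _^_)

  δ⟨_⟩ : ∀ {p} {P : Set p} → Dec P → Carrier
  δ⟨ P? ⟩ = if does P? then 1# else 0#

  ∑[_] : ∀ {n p} {P : U.Pred (Fin n) p} → U.Decidable P → (Fin n → Carrier) → Carrier
  ∑[ P? ] f = sum λ i → if does (P? i) then f i else 0#

  ∏[_] : ∀ {n p} {P : U.Pred (Fin n) p} → U.Decidable P → (Fin n → Carrier) → Carrier
  ∏[ P? ] f = product λ i → if does (P? i) then f i else 1#

  -- Sum over all sequences in (Fin k)ᵐ.
  ∑Seq : ∀ {k} m → (Vector (Fin k) m → Carrier) → Carrier
  ∑Seq zero    F = F []
  ∑Seq (suc m) F = sum λ a → ∑Seq m λ w → F (a ∷ w)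

  Matrix : ℕ → Set c
  Matrix n = Fin n → Fin n → Carrier

  infixl 6 _+ᴹ_ _-ᴹ_
  infixr 7 _·ᴹ_

  _+ᴹ_ _-ᴹ_ : ∀ {n} → Matrix n → Matrix n → Matrix n
  (M +ᴹ N) i j = M i j + N i j
  (M -ᴹ N) i j = M i j + - N i j

  _·ᴹ_ : ∀ {n} → Carrier → Matrix n → Matrix n
  (x ·ᴹ M) i j = x * M i j

  I : ∀ {n} → Matrix n
  I i j = δ⟨ i ≟ j ⟩

  -- Laplace expansion along the first row.
  det : ∀ {n} → Matrix n → Carrier
  det {zero}  M = 1#
  det {suc n} M = sum λ j →
    (- 1#) ^ toℕ j * M zero j * det λ i k → M (suc i) (punchIn j k)

module PowerSeries {c ℓ} (R : CommutativeRing c ℓ) where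
  private module R = CommutativeRing R
  open R using (Carrier; 0#; 1#)
  private module F = FiniteAlgebra R.rawRing

  R⟦t⟧ : Set c
  R⟦t⟧ = ℕ → Carrier

  const : Carrier → R⟦t⟧
  const x zero    = x
  const x (suc n) = 0#

  t : R⟦t⟧
  t zero          = 0#
  t (suc zero)    = 1#
  t (suc (suc n)) = 0#

  rawRing : RawRing c ℓ
  rawRing = record
    { Carrier = R⟦t⟧
    ; _≈_     = λ f g → ∀ n → f n R.≈ g n
    ; _+_     = λ f g n → f n R.+ g n
    ; _*_     = λ f g n → F.sum {suc n} λ i → f (toℕ i) R.* g (n ∸ toℕ i)
    ; -_      = λ f n → R.- f n
    ; 0#      = const 0#
    ; 1#      = const 1#
    }

  open RawRing rawRing public using (_≈_; _+_; _*_; -_)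
  open RawRing rawRing public using () renaming (1# to 1ₛ)
  open FiniteAlgebra rawRing public

  infixl 6 _-_
  _-_ : R⟦t⟧ → R⟦t⟧ → R⟦t⟧
  f - g = f + - g

  -- The series ∑ₖ cₖ gᵏ, meant for g with zero constant term: then gᵏ has
  -- no terms below tᵏ, so the coefficient of tⁿ only involves k ≤ n.
  substitute : (ℕ → Carrier) → R⟦t⟧ → R⟦t⟧
  substitute c g n = F.sum {suc n} λ k → c (toℕ k) R.* (g ^ toℕ k) n

  -- Geometric series; this is the inverse of f when f 0 ≈ 1 (see PowerSeriesInverse.inverseʳ).
  infix 8 _⁻¹
  _⁻¹ : R⟦t⟧ → R⟦t⟧
  f ⁻¹ = substitute (λ _ → 1#) (1ₛ - f)

module Exponential {c ℓ} (R : CommutativeℚAlgebra c ℓ) where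
  open CommutativeℚAlgebra R using (commutativeRing; algebraMap)
  open PowerSeries commutativeRing

  -- Meant for series with zero constant term.
  exp : R⟦t⟧ → R⟦t⟧
  exp = substitute λ k → algebraMap (ℚ._/_ (ℤ.+ 1) (k !) {{k ℕ.!≢0}})

record Digraph : Set where
  field
    #V #𝒜 : ℕ

  V : Set
  V = Fin #V

  𝒜 : Set
  𝒜 = Fin #𝒜

  field
    𝔱 𝔥 : 𝒜 → V

  𝒜⟨_,_⟩ : V → V → U.Pred 𝒜 0ℓ
  𝒜⟨ u , v ⟩ a = 𝔱 a ≡ u × 𝔥 a ≡ v

  𝒜⟨_,_⟩? : ∀ u v → U.Decidable 𝒜⟨ u , v ⟩
  𝒜⟨ u , v ⟩? a = 𝔱 a ≟ u ×-dec 𝔥 a ≟ v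

  S : 𝒜 → U.Pred 𝒜 0ℓ
  S a = 𝒜⟨ 𝔥 a , 𝔱 a ⟩

  S? : ∀ a → U.Decidable (S a)
  S? a = 𝒜⟨ 𝔥 a , 𝔱 a ⟩?

  IsClosedPath : ∀ {k} → Vector 𝒜 (suc k) → Set
  IsClosedPath {k} a =
    (∀ (i : Fin k) → 𝔥 (a (inject₁ i)) ≡ 𝔱 (a (suc i))) × 𝔥 (a (fromℕ k)) ≡ 𝔱 (a zero)

  isClosedPath? : ∀ {k} → U.Decidable (IsClosedPath {k})
  isClosedPath? {k} a =
    all? (λ i → 𝔥 (a (inject₁ i)) ≟ 𝔱 (a (suc i))) ×-dec 𝔥 (a (fromℕ k)) ≟ 𝔱 (a zero)

module Zeta {c ℓ} (R : CommutativeℚAlgebra c ℓ) (Δ : Digraph) where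
  open Digraph Δ
  open CommutativeℚAlgebra R using (Carrier; _*_; 0#; rawRing; commutativeRing; algebraMap)
  open FiniteAlgebra rawRing
  open PowerSeries commutativeRing using (R⟦t⟧)
  open Exponential R using (exp)

  -- N θ k is N_{k+1}(θ).
  N : (𝒜 → 𝒜 → Carrier) → ℕ → Carrier
  N θ k = ∑Seq (suc k) λ a → if does (isClosedPath? a)
    then product (λ (i : Fin k) → θ (a (inject₁ i)) (a (suc i))) * θ (a (fromℕ k)) (a zero)
    else 0#

  logZ : (𝒜 → 𝒜 → Carrier) → R⟦t⟧
  logZ θ zero    = 0#
  logZ θ (suc k) = algebraMap ((ℤ.+ 1) ℚ./ suc k) * N θ k

  Z : (𝒜 → 𝒜 → Carrier) → R⟦t⟧
  Z θ = exp (logZ θ)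

module Weighted {c ℓ ℓ′} (R : CommutativeℚAlgebra c ℓ) (Δ : Digraph)
                {_≤_ : Rel (Digraph.V Δ) ℓ′} (≤-isTotalOrder : IsTotalOrder _≡_ _≤_)
                (τ υ : Digraph.𝒜 Δ → CommutativeℚAlgebra.Carrier R) where
  open Digraph Δ
  private
    module R = CommutativeℚAlgebra R
    module F = FiniteAlgebra R.rawRing
    module ≤ = IsTotalOrder ≤-isTotalOrder
  open R using (Carrier)
  open PowerSeries R.commutativeRing

  θᴳ : 𝒜 → 𝒜 → Carrier
  θᴳ a a′ = τ a′ R.* F.δ⟨ 𝔥 a ≟ 𝔱 a′ ⟩ R.- υ a′ R.* F.δ⟨ S? a a′ ⟩

  _≤?_ : B.Decidable _≤_
  _≤?_ = total∧dec⇒dec ≤.reflexive ≤.antisym ≤.total _≟_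

  Φ Φ⁽³⁾ : V → V → Set ℓ′
  Φ u v = u ≤ v × ∃ (𝒜⟨ u , v ⟩ U.∪ 𝒜⟨ v , u ⟩)
  Φ⁽³⁾ u v = Φ u v × u ≢ v × ∃ 𝒜⟨ u , v ⟩ × ∃ 𝒜⟨ v , u ⟩

  Φ? : B.Decidable Φ
  Φ? u v = u ≤? v ×-dec any? (λ a → 𝒜⟨ u , v ⟩? a ⊎-dec 𝒜⟨ v , u ⟩? a)

  Φ⁽³⁾? : B.Decidable Φ⁽³⁾
  Φ⁽³⁾? u v = Φ? u v ×-dec ¬? (u ≟ v) ×-dec any? 𝒜⟨ u , v ⟩? ×-dec any? 𝒜⟨ v , u ⟩?

  f : V → V → R⟦t⟧
  f u v = if does (u ≟ v)
    then 1ₛ + t * const (F.∑[ 𝒜⟨ u , u ⟩? ] υ)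
    else 1ₛ - t ^ 2 * const (F.∑[ 𝒜⟨ u , v ⟩? ] υ) * const (F.∑[ 𝒜⟨ v , u ⟩? ] υ)

  fΔ : R⟦t⟧
  fΔ = product λ u → ∏[ Φ? u ] λ v → f u v

  a⟨_,_⟩ d⟨_,_⟩ : V → V → Carrier
  a⟨ u , v ⟩ = F.∑[ 𝒜⟨ u , v ⟩? ] τ
  d⟨ u , v ⟩ = F.∑[ 𝒜⟨ u , v ⟩? ] λ a → F.∑[ 𝒜⟨ v , u ⟩? ] λ a′ → τ a R.* υ a′

  A D : Matrix #V
  A w w′ = f w w′ ⁻¹ * const a⟨ w , w′ ⟩
  D w w′ = δ⟨ w ≟ w′ ⟩ * sum λ u → ∑[ Φ⁽³⁾? u ] λ v →
    f u v ⁻¹ * (δ⟨ w ≟ u ⟩ * const d⟨ u , v ⟩ + δ⟨ w ≟ v ⟩ * const d⟨ v , u ⟩)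

module PowerSeriesInverse {c ℓ} (R : CommutativeRing c ℓ) where
  private
    module R = CommutativeRing R
    module F = FiniteAlgebra R.rawRing
  open R using (Carrier; 0#; 1#)
  open PowerSeries R

  private
    open SemiringSum R.semiring using (sum-cong-≋; ∑-distrib-+; ∑-comm;
      *-distribˡ-sum; sum-replicate-zero)
    open RingProperties R.ring using (-0#≈0#; -1*x≈-x; -‿distribˡ-*)
    open SetoidReasoning R.setoid

    sum-zero : ∀ {n} (f : Fin n → Carrier) → (∀ i → f i R.≈ 0#) → F.sum f R.≈ 0#
    sum-zero {n} f f≈0 = R.trans (sum-cong-≋ f≈0) (sum-replicate-zero n)

    ^-order : ∀ u → u 0 R.≈ 0# → ∀ k n → n < k → (u ^ k) n R.≈ 0#
    ^-order u u₀≈0 (suc k) n (s≤s n≤k) = sum-zero {suc n} _ term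
      where
      lower : ∀ {n k} (i : Fin n) → n ≤ k → n ∸ suc (toℕ i) < k
      lower {suc n} i n<k = ℕ.≤-<-trans (ℕ.m∸n≤m n (toℕ i)) n<k

      term : ∀ (i : Fin (suc n)) → u (toℕ i) R.* (u ^ k) (n ∸ toℕ i) R.≈ 0#
      term zero    = R.trans (R.*-congʳ u₀≈0) (R.zeroˡ _)
      term (suc i) = R.trans (R.*-congˡ (^-order u u₀≈0 k _ (lower i n≤k))) (R.zeroʳ _)

    sum-extend : ∀ {m n} (g : ℕ → Carrier) → m ≤ n → (∀ k → m ≤ k → g k R.≈ 0#) →
                 F.sum {m} (λ i → g (toℕ i)) R.≈ F.sum {n} (λ i → g (toℕ i))
    sum-extend {zero} {n} g z≤n      g≈0 = R.sym (sum-zero {n} _ λ i → g≈0 (toℕ i) z≤n)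
    sum-extend {suc m} g (s≤s m≤n) g≈0 =
      R.+-congˡ (sum-extend (λ k → g (suc k)) m≤n λ k m≤k → g≈0 (suc k) (s≤s m≤k))

    sum-telescope : ∀ n (g : ℕ → Carrier) →
      F.sum {n} (λ i → g (toℕ i) R.- g (suc (toℕ i))) R.≈ g 0 R.- g n
    sum-telescope zero    g = R.sym (R.-‿inverseʳ _)
    sum-telescope (suc n) g = begin
      (g 0 R.- g 1) R.+ F.sum {n} (λ i → g (suc (toℕ i)) R.- g (suc (suc (toℕ i))))
        ≈⟨ R.+-congˡ (sum-telescope n (λ k → g (suc k))) ⟩
      (g 0 R.- g 1) R.+ (g 1 R.- g (suc n))   ≈⟨ R.+-assoc _ _ _ ⟩
      g 0 R.+ (R.- g 1 R.+ (g 1 R.- g (suc n))) ≈⟨ R.+-congˡ (R.sym (R.+-assoc _ _ _)) ⟩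
      g 0 R.+ ((R.- g 1 R.+ g 1) R.- g (suc n)) ≈⟨ R.+-congˡ (R.+-congʳ (R.-‿inverseˡ _)) ⟩
      g 0 R.+ (0# R.- g (suc n))                ≈⟨ R.+-congˡ (R.+-identityˡ _) ⟩
      g 0 R.- g (suc n)                         ∎

    sum-neg : ∀ {n} (g : Fin n → Carrier) → F.sum (λ i → R.- g i) R.≈ R.- F.sum g
    sum-neg g = begin
      F.sum (λ i → R.- g i)          ≈⟨ sum-cong-≋ (λ i → R.sym (-1*x≈-x (g i))) ⟩
      F.sum (λ i → R.- 1# R.* g i)   ≈⟨ R.sym (*-distribˡ-sum (R.- 1#) g) ⟩
      R.- 1# R.* F.sum g             ≈⟨ -1*x≈-x _ ⟩
      R.- F.sum g                    ∎

    *ₛ-identityˡ : ∀ g → 1ₛ * g ≈ g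
    *ₛ-identityˡ g n = begin
      (1# R.* g n) R.+ F.sum {n} (λ i → 0# R.* g (n ∸ suc (toℕ i)))
        ≈⟨ R.+-cong (R.*-identityˡ _) (sum-zero {n} _ λ _ → R.zeroˡ _) ⟩
      g n R.+ 0#   ≈⟨ R.+-identityʳ _ ⟩
      g n          ∎

    f*g≈g-u*g : ∀ f g → f * g ≈ (g - (1ₛ - f) * g)
    f*g≈g-u*g f g n = begin
      (f * g) n                                     ≈⟨ sum-cong-≋ {suc n} step ⟩
      F.sum (λ i → x i R.+ R.- y i)                 ≈⟨ ∑-distrib-+ x (λ i → R.- y i) ⟩
      (1ₛ * g) n R.+ F.sum (λ i → R.- y i)          ≈⟨ R.+-cong (*ₛ-identityˡ g n) (sum-neg y) ⟩
      g n R.- ((1ₛ - f) * g) n                      ∎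
      where
      x y : Fin (suc n) → Carrier
      x i = 1ₛ (toℕ i) R.* g (n ∸ toℕ i)
      y i = (1ₛ - f) (toℕ i) R.* g (n ∸ toℕ i)

      cancel : ∀ a b → a R.≈ b R.- (b R.- a)
      cancel a b = R.sym (begin
        b R.+ R.- (b R.- a)            ≈⟨ R.+-congˡ (R.sym (RP.-‿+-comm b (R.- a))) ⟩
        b R.+ (R.- b R.+ R.- (R.- a))  ≈⟨ R.sym (R.+-assoc _ _ _) ⟩
        (b R.+ R.- b) R.+ R.- (R.- a)  ≈⟨ R.+-cong (R.-‿inverseʳ b) (RP.-‿involutive a) ⟩
        0# R.+ a                       ≈⟨ R.+-identityˡ a ⟩
        a                              ∎)
        where module RP = RingProperties R.ring

      step : ∀ i → f (toℕ i) R.* g (n ∸ toℕ i) R.≈ x i R.+ R.- y i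
      step i = begin
        f k R.* g′                                    ≈⟨ R.*-congʳ (cancel (f k) (1ₛ k)) ⟩
        (1ₛ k R.- (1ₛ k R.- f k)) R.* g′              ≈⟨ R.distribʳ _ _ _ ⟩
        x i R.+ (R.- (1ₛ k R.- f k)) R.* g′           ≈⟨ R.+-congˡ (R.sym (-‿distribˡ-* _ _)) ⟩
        x i R.+ R.- y i                               ∎
        where
        k = toℕ i
        g′ = g (n ∸ k)

  inverseʳ : ∀ f → f 0 R.≈ 1# → f * f ⁻¹ ≈ 1ₛ
  inverseʳ f f₀≈1 n = begin
    (f * f ⁻¹) n
      ≈⟨ sum-cong-≋ {suc n} (λ i → R.*-congˡ {f (toℕ i)} (extend (ℕ.m∸n≤m n (toℕ i)))) ⟩
    F.sum {suc n} (λ i → f (toℕ i) R.* F.sum {suc n} (λ k → (u ^ toℕ k) (n ∸ toℕ i)))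
      ≈⟨ sum-cong-≋ {suc n} (λ i → *-distribˡ-sum {suc n} (f (toℕ i)) (λ k → (u ^ toℕ k) (n ∸ toℕ i))) ⟩
    F.sum {suc n} (λ i → F.sum {suc n} (λ k → f (toℕ i) R.* (u ^ toℕ k) (n ∸ toℕ i)))
      ≈⟨ ∑-comm {suc n} {suc n} (λ i k → f (toℕ i) R.* (u ^ toℕ k) (n ∸ toℕ i)) ⟩
    F.sum {suc n} (λ k → (f * u ^ toℕ k) n)
      ≈⟨ sum-cong-≋ (λ (k : Fin (suc n)) → f*g≈g-u*g f (u ^ toℕ k) n) ⟩
    F.sum {suc n} (λ k → (u ^ toℕ k) n R.- (u ^ suc (toℕ k)) n)
      ≈⟨ sum-telescope (suc n) (λ k → (u ^ k) n) ⟩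
    1ₛ n R.- (u ^ suc n) n
      ≈⟨ R.+-congˡ (R.trans (R.-‿cong (^-order u u₀≈0 (suc n) n ℕ.≤-refl)) -0#≈0#) ⟩
    1ₛ n R.+ 0#
      ≈⟨ R.+-identityʳ _ ⟩
    1ₛ n ∎
    where
    u = 1ₛ - f

    u₀≈0 : u 0 R.≈ 0#
    u₀≈0 = R.trans (R.+-congˡ (R.-‿cong f₀≈1)) (R.-‿inverseʳ 1#)

    extend : ∀ {m} → m ≤ n → (f ⁻¹) m R.≈ F.sum {suc n} (λ k → (u ^ toℕ k) m)
    extend {m} m≤n = R.trans (sum-cong-≋ {suc m} λ k → R.*-identityˡ ((u ^ toℕ k) m))
      (sum-extend {suc m} {suc n} (λ k → (u ^ k) m) (s≤s m≤n) (λ k m<k → ^-order u u₀≈0 k m m<k))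

module ZetaInverse {c ℓ} (R : CommutativeℚAlgebra c ℓ) (Δ : Digraph) where
  open CommutativeℚAlgebra R
    using (Carrier; commutativeRing; isHomomorphism; trans; +-identityʳ; *-identityʳ)
  open PowerSeries commutativeRing
  open PowerSeriesInverse commutativeRing
  open Zeta R Δ

  Z-inverseʳ : ∀ (θ : Digraph.𝒜 Δ → Digraph.𝒜 Δ → Carrier) → Z θ * Z θ ⁻¹ ≈ 1ₛ
  Z-inverseʳ θ = inverseʳ (Z θ) (trans (+-identityʳ _) (trans (*-identityʳ _) 1#-homo))
    where open RingMorphisms.IsRingHomomorphism isHomomorphism using (1#-homo)

module WeightedInverse {c ℓ ℓ′} (R : CommutativeℚAlgebra c ℓ) (Δ : Digraph)
                       {_≤_ : Rel (Digraph.V Δ) ℓ′} (≤-isTotalOrder : IsTotalOrder _≡_ _≤_)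
                       (τ υ : Digraph.𝒜 Δ → CommutativeℚAlgebra.Carrier R) where
  private module R = CommutativeℚAlgebra R
  open PowerSeries R.commutativeRing
  open PowerSeriesInverse R.commutativeRing
  open Weighted R Δ ≤-isTotalOrder τ υ using (f)

  f-inverseʳ : ∀ u v → f u v * f u v ⁻¹ ≈ 1ₛ
  f-inverseʳ u v = inverseʳ (f u v) constantTerm
    where
    *-zero₀ : ∀ g h → g 0 R.≈ R.0# → (g * h) 0 R.≈ R.0#
    *-zero₀ g h g₀≈0 = R.trans (R.+-identityʳ _) (R.trans (R.*-congʳ g₀≈0) (R.zeroˡ _))

    constantTerm : f u v 0 R.≈ R.1#
    constantTerm with does (u ≟ v)
    ... | true  = R.trans (R.+-congˡ (*-zero₀ t (const _) R.refl)) (R.+-identityʳ _)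
    ... | false = R.trans (R.+-congˡ (R.trans (R.-‿cong
      (*-zero₀ (t ^ 2 * const _) (const _) (*-zero₀ (t ^ 2) (const _) (*-zero₀ t (t ^ 1) R.refl))))
      (RingProperties.-0#≈0# R.ring))) (R.+-identityʳ _)

module Submission where

-- For an invertible matrix Y write ∂ log Y for tr(Y⁻¹ ∂Y), where ∂ = t d/dt; Jacobi's
-- formula identifies it with ∂(det Y) / det Y.  Since N_m = tr(θ^m), ∂ Z = - Z ∂ log(I - tθ).
-- Here I - tθ = P + KL, where P = I + J records the inverse arcs and K, L factor through
-- the vertices.  By the matrix determinant lemma, on the level of logarithmic derivatives,
-- ∂ log(P + KL) = ∂ log P + ∂ log(I + L P⁻¹ K).  The first term is ∂ fΔ / fΔ and
-- I + L P⁻¹ K = I - tA + t²D, so ∂(Z · RHS) = 0, and Z · RHS = 1 because ℚ ⊆ R.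

open import Defs
open import Algebra.Bundles using (CommutativeRing)
open import Algebra.Bundles.Raw using (RawRing)
open import Algebra.Morphism.Structures using (module RingMorphisms)
import Algebra.Properties.CommutativeMonoid.Mult as CommutativeMonoidMult
import Algebra.Properties.Monoid.Mult as MonoidMult
import Algebra.Properties.Monoid.Mult.TCOptimised as MonoidMult′
import Algebra.Properties.Ring as RingProperties
import Algebra.Properties.Semiring.Mult as SemiringMult
import Algebra.Properties.Semiring.Sum as SemiringSum
import Algebra.Solver.Ring as Solver
open import Algebra.Solver.Ring.AlmostCommutativeRing
  using (fromCommutativeRing; _-Raw-AlmostCommutative⟶_)
open import Data.Bool.Base using (true; false; if_then_else_)
open import Data.Fin.Base as Fin using (Fin; zero; suc; toℕ; fromℕ; inject₁; punchIn)
open import Data.Fin.Properties as Fin using (_≟_; <-cmp; any?; all?; ¬∀⟶∃¬)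
import Data.Integer.Base as ℤ
import Data.Integer.Properties as ℤ
import Data.Integer.Solver as ℤSolver
open import Data.Maybe.Base using (Maybe; just; nothing)
open import Data.Nat.Base as ℕ using (ℕ; zero; suc; _∸_; z≤n; s≤s; _!)
import Data.Nat.Properties as ℕ
open import Data.Product.Base using (_×_; _,_; ∃)
import Data.Rational.Base as ℚ
import Data.Rational.Properties as ℚ
import Data.Rational.Unnormalised.Base as ℚᵘ
import Data.Rational.Unnormalised.Properties as ℚᵘ
open import Data.Sum.Base using (inj₁; inj₂)
open import Data.Vec.Functional using (Vector; []; _∷_; updateAt)
open import Data.Vec.Functional.Properties
  using (updateAt-updates; updateAt-minimal; updateAt-id-local; map-updateAt)
open import Function.Base using (case_of_; _∘_)
open import Level using (0ℓ; _⊔_)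
open import Relation.Binary.Bundles using (Setoid)
open import Relation.Binary.Core using (Rel)
import Relation.Binary.Definitions as B
open import Relation.Binary.PropositionalEquality.Core as ≡ using (_≡_; _≢_)
import Relation.Binary.Reasoning.Setoid as SetoidReasoning
open import Relation.Binary.Structures using (IsTotalOrder)
open import Relation.Nullary.Decidable using (dec-true; dec-false)
open import Relation.Nullary.Decidable.Core using (Dec; does; yes; no; _×-dec_)
open import Relation.Nullary.Negation.Core using (¬_; contradiction)
import Relation.Unary as U

-- Comparing determinants directly would call for multiplicativity and Sylvester's identity for
-- arc-indexed matrices, starting from a `det` that is given as a Laplace expansion. Logarithmic
-- derivatives turn such products into sums of traces, where cyclicity does the work: the
-- determinants that are formed are vertex-indexed, and the arc-indexed matrices enter through
-- explicit inverses, the Neumann series `W` of tθ and the matrix `Q` = I - E. A logarithmic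
-- derivative is written without division, as an equation ∂ x = x * y. The comparison takes place in
-- an arbitrary commutative ring with a derivation and an element `t` with ∂ t = t; power series
-- enter when this is instantiated. The order on the vertices is a second obstacle: `fΔ` and `D`
-- list each adjacent pair once, whereas traces run over ordered pairs. `sum-Φ` mediates between the
-- two.

-- A ring solver with integer coefficients

-- The coefficient (m , n) stands for the integer m - n.
module IntegerSolver {c ℓ} (R : CommutativeRing c ℓ) where
  open CommutativeRing R
  open RingProperties ring
  open MonoidMult +-monoid using (×-homo-+) renaming (_×_ to _·_)
  open SemiringMult semiring using (×1-homo-*)
  open MonoidMult′ +-monoid using (×ᵤ≈×) renaming (_×_ to _·′_)
  open SetoidReasoning setoid

  differences : RawRing 0ℓ 0ℓ
  differences = record
    { Carrier = ℕ × ℕ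
    ; _≈_     = _≡_
    ; _+_     = λ { (a , b) (c , d) → a ℕ.+ c , b ℕ.+ d }
    ; _*_     = λ { (a , b) (c , d) → a ℕ.* c ℕ.+ b ℕ.* d , a ℕ.* d ℕ.+ b ℕ.* c }
    ; -_      = λ { (a , b) → b , a }
    ; 0#      = 0 , 0
    ; 1#      = 1 , 0
    }

  -- The case n = 0 is separate so that the constants 0 and 1 denote 0# and 1#.
  ⟦_⟧ : ℕ × ℕ → Carrier
  ⟦ a , zero  ⟧ = a ·′ 1#
  ⟦ a , suc b ⟧ = a ·′ 1# - suc b ·′ 1#

  private
    ι : ℕ → Carrier
    ι n = n · 1#

    ⟦⟧-difference : ∀ a b → ⟦ a , b ⟧ ≈ ι a - ι b
    ⟦⟧-difference a zero    =
      trans (sym (×ᵤ≈× a 1#)) (sym (trans (+-congˡ -0#≈0#) (+-identityʳ _)))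
    ⟦⟧-difference a (suc b) =
      +-cong (sym (×ᵤ≈× a 1#)) (-‿cong (sym (×ᵤ≈× (suc b) 1#)))

    interchange : ∀ a b c d → (a + b) + (c + d) ≈ (a + c) + (b + d)
    interchange a b c d = begin
      (a + b) + (c + d) ≈⟨ +-assoc a b _ ⟩
      a + (b + (c + d)) ≈⟨ +-congˡ (trans (sym (+-assoc b c d)) (+-congʳ (+-comm b c))) ⟩
      a + ((c + b) + d) ≈⟨ +-congˡ (+-assoc c b d) ⟩
      a + (c + (b + d)) ≈⟨ sym (+-assoc a c _) ⟩
      (a + c) + (b + d) ∎

    difference-+ : ∀ a b c d → (a + c) - (b + d) ≈ (a - b) + (c - d)
    difference-+ a b c d =
      trans (+-congˡ (sym (-‿+-comm b d))) (interchange a c (- b) (- d))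

    difference-neg : ∀ a b → b - a ≈ - (a - b)
    difference-neg a b = begin
      b - a           ≈⟨ +-comm b (- a) ⟩
      - a + b         ≈⟨ +-congˡ (sym (-‿involutive b)) ⟩
      - a + - (- b)   ≈⟨ -‿+-comm a (- b) ⟩
      - (a - b)       ∎

    difference-* : ∀ a b c d → (a * c + b * d) - (a * d + b * c) ≈ (a - b) * (c - d)
    difference-* a b c d = begin
      (a * c + b * d) - (a * d + b * c)     ≈⟨ difference-+ (a * c) (a * d) (b * d) (b * c) ⟩
      (a * c - a * d) + (b * d - b * c)
        ≈⟨ +-cong (sym (x[y-z]≈xy-xz a c d)) (sym (x[y-z]≈xy-xz b d c)) ⟩
      a * (c - d) + b * (d - c)
        ≈⟨ +-congˡ (trans (*-congˡ (difference-neg c d)) (sym (-‿distribʳ-* b (c - d)))) ⟩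
      a * (c - d) - b * (c - d)             ≈⟨ sym ([y-z]x≈yx-zx (c - d) a b) ⟩
      (a - b) * (c - d)                     ∎

    ι-+* : ∀ a b c d → ι (a ℕ.* b ℕ.+ c ℕ.* d) ≈ ι a * ι b + ι c * ι d
    ι-+* a b c d =
      trans (×-homo-+ 1# (a ℕ.* b) (c ℕ.* d)) (+-cong (×1-homo-* a b) (×1-homo-* c d))

  homomorphism : differences -Raw-AlmostCommutative⟶ fromCommutativeRing R
  homomorphism = record
    { ⟦_⟧    = ⟦_⟧
    ; +-homo = λ { (a , b) (c , d) → begin
        ⟦ a ℕ.+ c , b ℕ.+ d ⟧            ≈⟨ ⟦⟧-difference (a ℕ.+ c) (b ℕ.+ d) ⟩
        ι (a ℕ.+ c) - ι (b ℕ.+ d)        ≈⟨ +-cong (×-homo-+ 1# a c) (-‿cong (×-homo-+ 1# b d)) ⟩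
        (ι a + ι c) - (ι b + ι d)        ≈⟨ difference-+ (ι a) (ι b) (ι c) (ι d) ⟩
        (ι a - ι b) + (ι c - ι d)        ≈⟨ +-cong (sym (⟦⟧-difference a b)) (sym (⟦⟧-difference c d)) ⟩
        ⟦ a , b ⟧ + ⟦ c , d ⟧            ∎ }
    ; *-homo = λ { (a , b) (c , d) → begin
        ⟦ a ℕ.* c ℕ.+ b ℕ.* d , a ℕ.* d ℕ.+ b ℕ.* c ⟧
          ≈⟨ ⟦⟧-difference (a ℕ.* c ℕ.+ b ℕ.* d) (a ℕ.* d ℕ.+ b ℕ.* c) ⟩
        ι (a ℕ.* c ℕ.+ b ℕ.* d) - ι (a ℕ.* d ℕ.+ b ℕ.* c)
          ≈⟨ +-cong (ι-+* a c b d) (-‿cong (ι-+* a d b c)) ⟩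
        (ι a * ι c + ι b * ι d) - (ι a * ι d + ι b * ι c)
          ≈⟨ difference-* (ι a) (ι b) (ι c) (ι d) ⟩
        (ι a - ι b) * (ι c - ι d)
          ≈⟨ *-cong (sym (⟦⟧-difference a b)) (sym (⟦⟧-difference c d)) ⟩
        ⟦ a , b ⟧ * ⟦ c , d ⟧            ∎ }
    ; -‿homo = λ { (a , b) → begin
        ⟦ b , a ⟧        ≈⟨ ⟦⟧-difference b a ⟩
        ι b - ι a        ≈⟨ difference-neg (ι a) (ι b) ⟩
        - (ι a - ι b)    ≈⟨ -‿cong (sym (⟦⟧-difference a b)) ⟩
        - ⟦ a , b ⟧      ∎ }
    ; 0-homo = refl
    ; 1-homo = refl
    }

  private
    decide : ∀ x y → Maybe (⟦ x ⟧ ≈ ⟦ y ⟧)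
    decide (a , b) (c , d) with a ℕ.+ d ℕ.≟ c ℕ.+ b
    ... | no  _   = nothing
    ... | yes a+d≡c+b = just (begin
      ⟦ a , b ⟧                          ≈⟨ ⟦⟧-difference a b ⟩
      -- Adding `d` to both entries of one pair and `b` to both entries of the other makes the
      -- subtrahends agree.
      ι a - ι b                          ≈⟨ insert (ι a) (ι b) (ι d) ⟩
      (ι a + ι d) - (ι b + ι d)          ≈⟨ +-cong sums (-‿cong (+-comm (ι b) (ι d))) ⟩
      (ι c + ι b) - (ι d + ι b)          ≈⟨ sym (insert (ι c) (ι d) (ι b)) ⟩
      ι c - ι d                          ≈⟨ sym (⟦⟧-difference c d) ⟩
      ⟦ c , d ⟧                          ∎)
      where
      insert : ∀ x y z → x - y ≈ (x + z) - (y + z)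
      insert x y z = sym (trans (difference-+ x y z z) (trans (+-congˡ (-‿inverseʳ z)) (+-identityʳ _)))

      sums : ι a + ι d ≈ ι c + ι b
      sums = trans (sym (×-homo-+ 1# a d)) (trans (reflexive (≡.cong ι a+d≡c+b)) (×-homo-+ 1# c b))

  open Solver differences (fromCommutativeRing R) homomorphism decide public
    using (Polynomial; solve; _:=_; _:+_; _:*_; _:-_; :-_; con)

  :0 :1 : ∀ {n} → Polynomial n
  :0 = con (0 , 0)
  :1 = con (1 , 0)

-- Finite sums and Kronecker deltas

module Summation {c ℓ} (R : CommutativeRing c ℓ) where
  open CommutativeRing R hiding (zero)
  open FiniteAlgebra rawRing
  open SemiringSum semiring public
    using (sum-cong-≋; ∑-distrib-+; ∑-comm; *-distribˡ-sum; *-distribʳ-sum; sum-replicate-zero)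
  open RingProperties ring using (-1*x≈-x)
  open MonoidMult +-monoid renaming (_×_ to _·_)
  open SetoidReasoning setoid

  sum-zero : ∀ {n} (f : Fin n → Carrier) → (∀ i → f i ≈ 0#) → sum f ≈ 0#
  sum-zero {n} f f≈0 = trans (sum-cong-≋ f≈0) (sum-replicate-zero n)

  sum-+ : ∀ {n} {f g h : Fin n → Carrier} → (∀ i → h i ≈ f i + g i) → sum h ≈ sum f + sum g
  sum-+ {f = f} {g} h≈f+g = trans (sum-cong-≋ h≈f+g) (∑-distrib-+ f g)

  sum-*ˡ : ∀ {n} x {f h : Fin n → Carrier} → (∀ i → h i ≈ x * f i) → sum h ≈ x * sum f
  sum-*ˡ x {f} h≈x*f = trans (sum-cong-≋ h≈x*f) (sym (*-distribˡ-sum x f))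

  sum-*ʳ : ∀ {n} x {f h : Fin n → Carrier} → (∀ i → h i ≈ f i * x) → sum h ≈ sum f * x
  sum-*ʳ x {f} h≈f*x = trans (sum-cong-≋ h≈f*x) (sym (*-distribʳ-sum x f))

  sum-swap : ∀ {m n} {f : Fin m → Fin n → Carrier} {g : Fin n → Fin m → Carrier} →
             (∀ i j → f i j ≈ g j i) → sum (λ i → sum (f i)) ≈ sum (λ j → sum (g j))
  sum-swap {f = f} f≈g = trans (∑-comm f) (sum-cong-≋ λ j → sum-cong-≋ λ i → f≈g i j)

  sum-neg : ∀ {n} (f : Fin n → Carrier) → sum (λ i → - f i) ≈ - sum f
  sum-neg f = begin
    sum (λ i → - f i)        ≈⟨ sum-cong-≋ (λ i → sym (-1*x≈-x (f i))) ⟩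
    sum (λ i → - 1# * f i)   ≈⟨ sym (*-distribˡ-sum (- 1#) f) ⟩
    - 1# * sum f             ≈⟨ -1*x≈-x _ ⟩
    - sum f                  ∎

  ×-sum : ∀ {n} k (f : Fin n → Carrier) → k · sum f ≈ sum (λ i → k · f i)
  ×-sum {n} zero    f = sym (sum-zero {n} (λ _ → 0#) λ _ → refl)
  ×-sum     (suc k) f = trans (+-congˡ (×-sum k f)) (sym (∑-distrib-+ f (λ i → k · f i)))

  δ-× : ∀ {p q} {P : Set p} {Q : Set q} (P? : Dec P) (Q? : Dec Q) →
        δ⟨ P? ×-dec Q? ⟩ ≈ δ⟨ P? ⟩ * δ⟨ Q? ⟩
  δ-× P? Q? with does P? | does Q?
  ... | true  | true  = sym (*-identityˡ 1#)
  ... | true  | false = sym (zeroʳ 1#)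
  ... | false | _     = sym (zeroˡ _)

  if-δ : ∀ {p} {P : Set p} (P? : Dec P) x → (if does P? then x else 0#) ≈ δ⟨ P? ⟩ * x
  if-δ P? x with does P?
  ... | true  = sym (*-identityˡ x)
  ... | false = sym (zeroˡ x)

  δ-sym : ∀ {n} (x y : Fin n) → δ⟨ x ≟ y ⟩ ≈ δ⟨ y ≟ x ⟩
  δ-sym x y with x ≟ y | y ≟ x
  ... | yes _   | yes _   = refl
  ... | no  _   | no  _   = refl
  ... | yes x≡y | no  y≢x = contradiction (≡.sym x≡y) y≢x
  ... | no  x≢y | yes y≡x = contradiction (≡.sym y≡x) x≢y

  sum-δ : ∀ {n} (x : Fin n) (g : Fin n → Carrier) → sum (λ y → δ⟨ x ≟ y ⟩ * g y) ≈ g x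
  sum-δ zero    g =
    trans (+-cong (*-identityˡ _) (sum-zero (λ y → 0# * g (suc y)) λ _ → zeroˡ _)) (+-identityʳ _)
  sum-δ (suc x) g = trans (+-cong (zeroˡ _) (sum-δ x (λ y → g (suc y)))) (+-identityˡ _)

-- Derivations of a commutative ring

record Derivation {c ℓ} (R : CommutativeRing c ℓ) : Set (c ⊔ ℓ) where
  open CommutativeRing R hiding (zero)
  open FiniteAlgebra rawRing
  open RingProperties ring
  open SetoidReasoning setoid
  field
    ∂      : Carrier → Carrier
    ∂-cong : ∀ {x y} → x ≈ y → ∂ x ≈ ∂ y
    ∂-+    : ∀ x y → ∂ (x + y) ≈ ∂ x + ∂ y
    ∂-*    : ∀ x y → ∂ (x * y) ≈ ∂ x * y + x * ∂ y

  ∂-0# : ∂ 0# ≈ 0#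
  ∂-0# = x+x≈x⇒x≈0 (∂ 0#) (trans (sym (∂-+ 0# 0#)) (∂-cong (+-identityˡ 0#)))

  ∂-1# : ∂ 1# ≈ 0#
  ∂-1# = x+x≈x⇒x≈0 (∂ 1#) (begin
    ∂ 1# + ∂ 1#            ≈⟨ sym (+-cong (*-identityʳ _) (*-identityˡ _)) ⟩
    ∂ 1# * 1# + 1# * ∂ 1#  ≈⟨ sym (∂-* 1# 1#) ⟩
    ∂ (1# * 1#)            ≈⟨ ∂-cong (*-identityˡ 1#) ⟩
    ∂ 1#                   ∎)

  ∂-neg : ∀ x → ∂ (- x) ≈ - ∂ x
  ∂-neg x = +-inverseˡ-unique _ _ (trans (sym (∂-+ (- x) x)) (trans (∂-cong (-‿inverseˡ x)) ∂-0#))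

  ∂-sum : ∀ {n} (f : Fin n → Carrier) → ∂ (sum f) ≈ sum (λ i → ∂ (f i))
  ∂-sum {zero}  f = ∂-0#
  ∂-sum {suc n} f = trans (∂-+ _ _) (+-congˡ (∂-sum (λ i → f (suc i))))

  ∂-scale : ∀ k x → ∂ k ≈ 0# → ∂ (k * x) ≈ k * ∂ x
  ∂-scale k x ∂k≈0 = trans (∂-* k x) (trans (+-congʳ (trans (*-congʳ ∂k≈0) (zeroˡ x))) (+-identityˡ _))

  ∂-^ : ∀ x k → ∂ x ≈ 0# → ∂ (x ^ k) ≈ 0#
  ∂-^ x zero    ∂x≈0 = ∂-1#
  ∂-^ x (suc k) ∂x≈0 = trans (∂-scale x (x ^ k) ∂x≈0) (trans (*-congˡ (∂-^ x k ∂x≈0)) (zeroʳ x))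

  -- Written as ∂ g = g h, logarithmic derivatives add up over a product by the Leibniz rule alone,
  -- with no division.
  ∂-product : ∀ {n} (g h : Fin n → Carrier) → (∀ i → ∂ (g i) ≈ g i * h i) →
              ∂ (product g) ≈ product g * sum h
  ∂-product {zero}  g h eq = trans ∂-1# (sym (zeroʳ 1#))
  ∂-product {suc n} g h eq = begin
    ∂ (g₀ * p)                   ≈⟨ ∂-* g₀ p ⟩
    ∂ g₀ * p + g₀ * ∂ p          ≈⟨ +-cong (*-congʳ (eq zero)) (*-congˡ (∂-product _ _ (λ i → eq (suc i)))) ⟩
    g₀ * h₀ * p + g₀ * (p * s)   ≈⟨ solve 4 (λ g h p s → g :* h :* p :+ g :* (p :* s) := g :* p :* (h :+ s)) refl g₀ h₀ p s ⟩
    g₀ * p * (h₀ + s)            ∎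
    where
    open IntegerSolver R
    g₀ = g zero
    h₀ = h zero
    p = product (λ i → g (suc i))
    s = sum (λ i → h (suc i))

-- Rectangular matrices and traces

module Matrices {c ℓ} (R : CommutativeRing c ℓ) where
  open CommutativeRing R hiding (zero)
  open FiniteAlgebra rawRing
  open Summation R
  open SetoidReasoning setoid

  Mat : ℕ → ℕ → Set c
  Mat m n = Fin m → Fin n → Carrier

  infix  4 _≈ᴹ_
  infixl 7 _⊡_
  infixl 6 _⊞_

  _≈ᴹ_ : ∀ {m n} → Mat m n → Mat m n → Set ℓ
  A ≈ᴹ B = ∀ i j → A i j ≈ B i j

  _⊡_ : ∀ {m n p} → Mat m n → Mat n p → Mat m p
  (A ⊡ B) i k = sum λ j → A i j * B j k

  _⊞_ : ∀ {m n} → Mat m n → Mat m n → Mat m n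
  (A ⊞ B) i j = A i j + B i j

  ⊟_ : ∀ {m n} → Mat m n → Mat m n
  (⊟ A) i j = - A i j

  tr : ∀ {n} → Mat n n → Carrier
  tr A = sum λ i → A i i

  ⊡-cong : ∀ {m n p} {A A′ : Mat m n} {B B′ : Mat n p} → A ≈ᴹ A′ → B ≈ᴹ B′ → A ⊡ B ≈ᴹ A′ ⊡ B′
  ⊡-cong A≈A′ B≈B′ i k = sum-cong-≋ λ j → *-cong (A≈A′ i j) (B≈B′ j k)

  ⊡-congˡ : ∀ {m n p} (A : Mat m n) {B B′ : Mat n p} → B ≈ᴹ B′ → A ⊡ B ≈ᴹ A ⊡ B′
  ⊡-congˡ A = ⊡-cong {A = A} (λ _ _ → refl)

  ⊡-congʳ : ∀ {m n p} {A A′ : Mat m n} (B : Mat n p) → A ≈ᴹ A′ → A ⊡ B ≈ᴹ A′ ⊡ B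
  ⊡-congʳ B A≈A′ = ⊡-cong {B = B} A≈A′ (λ _ _ → refl)

  ⊡-assoc : ∀ {m n p q} (A : Mat m n) (B : Mat n p) (C : Mat p q) → (A ⊡ B) ⊡ C ≈ᴹ A ⊡ (B ⊡ C)
  ⊡-assoc A B C i l = begin
    sum (λ k → sum (λ j → A i j * B j k) * C k l)
      ≈⟨ sum-cong-≋ (λ k → *-distribʳ-sum (C k l) (λ j → A i j * B j k)) ⟩
    sum (λ k → sum (λ j → A i j * B j k * C k l))
      ≈⟨ sum-swap (λ k j → *-assoc (A i j) (B j k) (C k l)) ⟩
    sum (λ j → sum (λ k → A i j * (B j k * C k l)))
      ≈⟨ sum-cong-≋ (λ j → sym (*-distribˡ-sum (A i j) (λ k → B j k * C k l))) ⟩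
    sum (λ j → A i j * sum (λ k → B j k * C k l)) ∎

  ⊡-identityˡ : ∀ {m n} (A : Mat m n) → I ⊡ A ≈ᴹ A
  ⊡-identityˡ A i k = sum-δ i (λ j → A j k)

  ⊡-identityʳ : ∀ {m n} (A : Mat m n) → A ⊡ I ≈ᴹ A
  ⊡-identityʳ A i k = trans
    (sum-cong-≋ λ j → trans (*-congˡ (δ-sym j k)) (*-comm (A i j) _)) (sum-δ k (A i))

  ⊡-distribˡ : ∀ {m n p} (A : Mat m n) (B C : Mat n p) → A ⊡ (B ⊞ C) ≈ᴹ A ⊡ B ⊞ A ⊡ C
  ⊡-distribˡ A B C i k = sum-+ λ j → distribˡ (A i j) (B j k) (C j k)

  ⊡-distribʳ : ∀ {m n p} (A : Mat n p) (B C : Mat m n) → (B ⊞ C) ⊡ A ≈ᴹ B ⊡ A ⊞ C ⊡ A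
  ⊡-distribʳ A B C i k = sum-+ λ j → distribʳ (A j k) (B i j) (C i j)

  tr-cong : ∀ {n} {A B : Mat n n} → A ≈ᴹ B → tr A ≈ tr B
  tr-cong A≈B = sum-cong-≋ λ i → A≈B i i

  tr-⊞ : ∀ {n} (A B : Mat n n) → tr (A ⊞ B) ≈ tr A + tr B
  tr-⊞ A B = ∑-distrib-+ (λ i → A i i) (λ i → B i i)

  tr-comm : ∀ {m n} (A : Mat m n) (B : Mat n m) → tr (A ⊡ B) ≈ tr (B ⊡ A)
  tr-comm A B = sum-swap λ i j → *-comm (A i j) (B j i)

-- Determinants: alternation, linearity in the rows, Jacobi's formula

module Determinant {c ℓ} (R : CommutativeRing c ℓ) where
  open CommutativeRing R hiding (zero)
  open FiniteAlgebra rawRing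
  open RingProperties ring
  open Summation R
  open Matrices R
  open IntegerSolver R using (solve; _:=_; _:+_; _:*_; :-_; :0; :1)
  open SetoidReasoning setoid

  infixl 8 _[_≔_]

  _[_≔_] : ∀ {m n} → Mat m n → Fin m → Vector Carrier n → Mat m n
  M [ i ≔ r ] = updateAt M i (λ _ → r)

  minor : ∀ {m n} → Fin (suc n) → Mat (suc m) (suc n) → Mat m n
  minor j M i k = M (suc i) (punchIn j k)

  sign : ∀ {n} → Fin n → Carrier
  sign j = (- 1#) ^ toℕ j

  det-cong : ∀ {n} {M N : Matrix n} → M ≈ᴹ N → det M ≈ det N
  det-cong {zero}  M≈N = refl
  det-cong {suc n} {M} {N} M≈N = sum-cong-≋ λ j →
    *-cong (*-congˡ {sign j} (M≈N zero j)) (det-cong {n} {minor j M} {minor j N} λ i k → M≈N (suc i) (punchIn j k))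

  -- Partner j k j′ k′ says that deleting column j and then the k-th remaining
  -- one amounts to deleting the same two columns in the other order.
  data Partner : ∀ {n} → Fin (suc n) → Fin n → Fin (suc n) → Fin n → Set where
    base : ∀ {n} {k : Fin (suc n)} → Partner zero k (suc k) zero
    step : ∀ {n} {j : Fin (suc n)} {k j′ k′} → Partner j k j′ k′ →
           Partner (suc j) (suc k) (suc j′) (suc k′)

  Partner-punchIn : ∀ {n} {j : Fin (suc n)} {k j′ k′} → Partner j k j′ k′ → punchIn j k ≡ j′
  Partner-punchIn base     = ≡.refl
  Partner-punchIn (step p) = ≡.cong suc (Partner-punchIn p)

  Partner-punchIn′ : ∀ {n} {j : Fin (suc n)} {k j′ k′} → Partner j k j′ k′ → punchIn j′ k′ ≡ j
  Partner-punchIn′ base     = ≡.refl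
  Partner-punchIn′ (step p) = ≡.cong suc (Partner-punchIn′ p)

  Partner-punchIn² : ∀ {n} {j : Fin (suc (suc n))} {k j′ k′} → Partner j k j′ k′ →
                     ∀ l → punchIn j (punchIn k l) ≡ punchIn j′ (punchIn k′ l)
  Partner-punchIn² base     l       = ≡.refl
  Partner-punchIn² (step p) zero    = ≡.refl
  Partner-punchIn² (step p) (suc l) = ≡.cong suc (Partner-punchIn² p l)

  -- In the base case the positions 0, k are exchanged for k + 1, 0, so the exponents of -1 differ
  -- by one; each further step raises both exponents by two.
  Partner-sign : ∀ {n} {j : Fin (suc n)} {k j′ k′} → Partner j k j′ k′ →
                 sign j′ * sign k′ ≈ - (sign j * sign k)
  Partner-sign (base {k = k}) =
    solve 1 (λ s → :- :1 :* s :* :1 := :- (:1 :* s)) refl (sign k)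
  Partner-sign (step {j = j} {k} {j′} {k′} p) = begin
    (- 1# * sign j′) * (- 1# * sign k′)
      ≈⟨ solve 2 (λ x y → (:- :1 :* x) :* (:- :1 :* y) := x :* y) refl (sign j′) (sign k′) ⟩
    sign j′ * sign k′       ≈⟨ Partner-sign p ⟩
    - (sign j * sign k)
      ≈⟨ solve 2 (λ x y → :- (x :* y) := :- ((:- :1 :* x) :* (:- :1 :* y))) refl (sign j) (sign k) ⟩
    - ((- 1# * sign j) * (- 1# * sign k)) ∎

  -- The index pairs fall into those with j = 0, those with j > 0 and k = 0, and the rest. `base`
  -- matches the first two families with each other, and `step` reduces the third to a smaller
  -- instance.
  sum-Partner : ∀ {n} (g : Fin (suc n) → Fin n → Carrier) →
    (∀ {j k j′ k′} → Partner j k j′ k′ → g j k + g j′ k′ ≈ 0#) →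
    sum (λ j → sum (g j)) ≈ 0#
  sum-Partner {zero}  g cancel = +-identityʳ 0#
  sum-Partner {suc n} g cancel = begin
    sum (g zero) + sum (λ j → g (suc j) zero + sum (λ k → g (suc j) (suc k)))
      ≈⟨ +-congˡ (∑-distrib-+ left (λ j → sum (rest j))) ⟩
    sum (g zero) + (sum left + sum (λ j → sum (rest j)))
      ≈⟨ +-congˡ (trans (+-congˡ (sum-Partner rest (λ p → cancel (step p)))) (+-identityʳ _)) ⟩
    sum (g zero) + sum left
      ≈⟨ sym (∑-distrib-+ (g zero) left) ⟩
    sum (λ k → g zero k + left k)
      ≈⟨ sum-zero (λ k → g zero k + left k) (λ k → cancel base) ⟩
    0# ∎
    where
    left : Fin (suc n) → Carrier
    left j = g (suc j) zero

    rest : Fin (suc n) → Fin n → Carrier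
    rest j k = g (suc j) (suc k)

  minor² : ∀ {m n} → Fin (suc (suc n)) → Fin (suc n) → Mat (suc (suc m)) (suc (suc n)) → Mat m n
  minor² j k M = minor k (minor j M)

  -- A term of the Laplace expansion along two rows. The product of the two row entries is replaced
  -- by an arbitrary function `h` of the two columns, so that sums of such products, and in
  -- particular symmetric ones, can be inserted.
  expansionTerm² : ∀ {n} → Mat n (suc (suc n)) → (Fin (suc (suc n)) → Fin (suc (suc n)) → Carrier) →
                   Fin (suc (suc n)) → Fin (suc n) → Carrier
  expansionTerm² M h j k =
    (sign j * sign k) * (h j (punchIn j k) * det λ i l → M i (punchIn j (punchIn k l)))

  expansion² : ∀ {n} → Mat n (suc (suc n)) → (Fin (suc (suc n)) → Fin (suc (suc n)) → Carrier) → Carrier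
  expansion² M h = sum λ j → sum λ k → expansionTerm² M h j k

  det-expansion² : ∀ {n} (M : Matrix (suc (suc n))) →
    det M ≈ expansion² (λ i → M (suc (suc i))) (λ x y → M zero x * M (suc zero) y)
  det-expansion² {n} M = sum-cong-≋ {suc (suc n)} λ j → sym (sum-*ˡ {suc n} (sign j * M zero j) λ k →
    solve 5 (λ s s′ x y d → s :* s′ :* (x :* y :* d) := s :* x :* (s′ :* y :* d)) refl
      (sign j) (sign k) (M zero j) (M (suc zero) (punchIn j k)) (det (minor² j k M)))

  -- Partner terms delete the same two columns and hence share their minor; symmetry of `h` equates
  -- the remaining factors, and the signs are opposite. Cancelling in pairs makes this valid in
  -- every characteristic.
  expansion²-symmetric : ∀ {n} (M : Mat n (suc (suc n))) h → (∀ x y → h x y ≈ h y x) →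
    expansion² M h ≈ 0#
  expansion²-symmetric {n} M h h-sym = sum-Partner (expansionTerm² M h) cancel
    where
    X : Fin (suc (suc n)) → Fin (suc n) → Carrier
    X j k = det λ i l → M i (punchIn j (punchIn k l))

    cancel : ∀ {j k j′ k′} → Partner j k j′ k′ →
             expansionTerm² M h j k + expansionTerm² M h j′ k′ ≈ 0#
    cancel {j} {k} {j′} {k′} p
      rewrite Partner-punchIn p | Partner-punchIn′ p = begin
      s * (h j j′ * X j k) + (sign j′ * sign k′) * (h j′ j * X j′ k′)
        ≈⟨ +-congˡ (*-cong (Partner-sign p) (*-cong (h-sym j′ j) (sym X≈X′))) ⟩
      s * (h j j′ * X j k) + - s * (h j j′ * X j k)
        ≈⟨ solve 2 (λ s x → s :* x :+ :- s :* x := :0) refl s (h j j′ * X j k) ⟩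
      0# ∎
      where
      s = sign j * sign k

      X≈X′ : X j k ≈ X j′ k′
      X≈X′ = det-cong {M = λ i l → M i (punchIn j (punchIn k l))}
        λ i l → reflexive (≡.cong (M i) (Partner-punchIn² p l))

  expansion²-⊞ : ∀ {n} (M : Mat n (suc (suc n))) h h′ →
    expansion² M (λ x y → h x y + h′ x y) ≈ expansion² M h + expansion² M h′
  expansion²-⊞ {n} M h h′ = sum-+ {suc (suc n)} λ j → sum-+ {suc n} λ k →
    solve 4 (λ s x y d → s :* ((x :+ y) :* d) := s :* (x :* d) :+ s :* (y :* d)) refl
      (sign j * sign k) (h j (punchIn j k)) (h′ j (punchIn j k))
      (det λ i l → M i (punchIn j (punchIn k l)))

  swapRows : ∀ {m n} → Mat (suc (suc m)) n → Mat (suc (suc m)) n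
  swapRows M zero          = M (suc zero)
  swapRows M (suc zero)    = M zero
  swapRows M (suc (suc i)) = M (suc (suc i))

  -- The two determinants differ only in `h`, and the sum of the two functions is symmetric.
  det-swapRows : ∀ {n} (M : Matrix (suc (suc n))) → det M + det (swapRows M) ≈ 0#
  det-swapRows M = begin
    det M + det (swapRows M)
      ≈⟨ +-cong (det-expansion² M) (det-expansion² (swapRows M)) ⟩
    expansion² N (λ x y → M zero x * M (suc zero) y) + expansion² N (λ x y → M (suc zero) x * M zero y)
      ≈⟨ sym (expansion²-⊞ N (λ x y → M zero x * M (suc zero) y) (λ x y → M (suc zero) x * M zero y)) ⟩
    expansion² N (λ x y → M zero x * M (suc zero) y + M (suc zero) x * M zero y)
      ≈⟨ expansion²-symmetric N (λ x y → M zero x * M (suc zero) y + M (suc zero) x * M zero y) (λ x y →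
           solve 4 (λ a b c d → a :* d :+ b :* c := c :* b :+ d :* a) refl
             (M zero x) (M (suc zero) x) (M zero y) (M (suc zero) y)) ⟩
    0# ∎
    where N = λ i → M (suc (suc i))

  det-zero-minors : ∀ {n} (M : Matrix (suc n)) → (∀ j → det (minor j M) ≈ 0#) → det M ≈ 0#
  det-zero-minors {n} M minors≈0 = sum-zero {suc n} _ λ j → trans (*-congˡ {sign j * M zero j} (minors≈0 j)) (zeroʳ _)

  -- For rows 0 and 1 the function `h` of the double expansion is symmetric. For rows 0 and j > 1,
  -- exchanging rows 0 and 1 moves both equal rows below the first row, hence into every minor, and
  -- costs only a sign. If neither row is the first, the minors vanish already.
  det-equal-rows-< : ∀ {n} (M : Matrix n) i j → i Fin.< j →
                     (∀ k → M i k ≈ M j k) → det M ≈ 0#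
  det-equal-rows-< M zero (suc zero) _ eq = trans (det-expansion² M)
    (expansion²-symmetric (λ i → M (suc (suc i))) (λ x y → M zero x * M (suc zero) y) λ x y → begin
      M zero x * M (suc zero) y ≈⟨ *-cong (eq x) (sym (eq y)) ⟩
      M (suc zero) x * M zero y ≈⟨ *-comm _ _ ⟩
      M zero y * M (suc zero) x ∎)
  det-equal-rows-< M zero (suc (suc j)) _ eq = begin
    det M                        ≈⟨ sym (+-identityʳ _) ⟩
    det M + 0#                   ≈⟨ +-congˡ (sym (det-zero-minors (swapRows M) λ k →
      det-equal-rows-< (minor k (swapRows M)) zero (suc j) (ℕ.s≤s ℕ.z≤n) λ l → eq (punchIn k l))) ⟩
    det M + det (swapRows M)     ≈⟨ det-swapRows M ⟩
    0#                           ∎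
  det-equal-rows-< M (suc i) (suc j) (ℕ.s≤s i<j) eq = det-zero-minors M λ k →
    det-equal-rows-< (minor k M) i j i<j λ l → eq (punchIn k l)

  det-equal-rows : ∀ {n} (M : Matrix n) i j → i ≢ j → (∀ k → M i k ≈ M j k) → det M ≈ 0#
  det-equal-rows M i j i≢j eq with <-cmp i j
  ... | B.tri< i<j _ _ = det-equal-rows-< M i j i<j eq
  ... | B.tri≈ _ i≡j _ = contradiction i≡j i≢j
  ... | B.tri> _ _ j<i = det-equal-rows-< M j i j<i (λ k → sym (eq k))

  minor-≔ : ∀ {m n} (M : Mat (suc m) (suc n)) i r j →
    minor j (M [ suc i ≔ r ]) ≈ᴹ minor j M [ i ≔ r ∘ punchIn j ]
  minor-≔ M i r j i′ k = reflexive (≡.cong (λ row → row k)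
    (map-updateAt {f = _∘ punchIn j} {g = λ _ → r} (λ _ → ≡.refl) (λ i → M (suc i)) i i′))

  ≔-cong : ∀ {m n} (M : Mat m n) i {r s} → (∀ k → r k ≈ s k) → M [ i ≔ r ] ≈ᴹ M [ i ≔ s ]
  ≔-cong M zero    r≈s zero    k = r≈s k
  ≔-cong M zero    r≈s (suc j) k = refl
  ≔-cong M (suc i) r≈s zero    k = refl
  ≔-cong M (suc i) r≈s (suc j) k = ≔-cong (λ i → M (suc i)) i r≈s j k

  -- Linearity in row `i`, stated for a row of a matrix product: `jacobi` expresses the rows of ∂B
  -- as combinations of the rows of B.
  det-row-combination : ∀ {m n} (M : Matrix n) i (c : Fin m → Carrier) (N : Mat m n) →
    det (M [ i ≔ (λ k → sum λ j → c j * N j k) ]) ≈ sum (λ j → c j * det (M [ i ≔ N j ]))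
  det-row-combination {m} {suc n} M zero c N = begin
    sum (λ k → sign k * sum (λ j → c j * N j k) * d k)
      ≈⟨ sum-cong-≋ (λ k → trans (*-congʳ (*-distribˡ-sum (sign k) (λ j → c j * N j k)))
           (*-distribʳ-sum (d k) (λ j → sign k * (c j * N j k)))) ⟩
    sum (λ k → sum (λ j → sign k * (c j * N j k) * d k))
      ≈⟨ sum-swap {suc n} {m} (λ k j →
           solve 4 (λ s c x d → s :* (c :* x) :* d := c :* (s :* x :* d)) refl (sign k) (c j) (N j k) (d k)) ⟩
    sum (λ j → sum (λ k → c j * (sign k * N j k * d k)))
      ≈⟨ sum-cong-≋ (λ j → sym (*-distribˡ-sum (c j) (λ k → sign k * N j k * d k))) ⟩
    sum (λ j → c j * sum (λ k → sign k * N j k * d k)) ∎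
    where
    d : Fin (suc n) → Carrier
    d k = det (minor k M)
  det-row-combination {m} {suc n} M (suc i) c N = begin
    sum (λ k → a k * det (minor k (M [ suc i ≔ r ])))
      ≈⟨ sum-cong-≋ (λ k → *-congˡ {a k} (trans
           (det-cong {M = minor k (M [ suc i ≔ r ])} (minor-≔ M i r k))
           (det-row-combination (minor k M) i c (λ j → N j ∘ punchIn k)))) ⟩
    sum (λ k → a k * sum (λ j → c j * d k j))
      ≈⟨ sum-cong-≋ (λ k → *-distribˡ-sum (a k) (λ j → c j * d k j)) ⟩
    sum (λ k → sum (λ j → a k * (c j * d k j)))
      ≈⟨ sum-swap {suc n} {m} (λ k j →
           solve 3 (λ a c d → a :* (c :* d) := c :* (a :* d)) refl (a k) (c j) (d k j)) ⟩
    sum (λ j → sum (λ k → c j * (a k * d k j)))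
      ≈⟨ sum-cong-≋ (λ j → sym (*-distribˡ-sum (c j) (λ k → a k * d k j))) ⟩
    sum (λ j → c j * sum (λ k → a k * d k j))
      ≈⟨ sum-cong-≋ (λ j → *-congˡ {c j} (sum-cong-≋ λ k → *-congˡ {a k}
           (sym (det-cong {M = minor k (M [ suc i ≔ N j ])} (minor-≔ M i (N j) k))))) ⟩
    sum (λ j → c j * det (M [ suc i ≔ N j ])) ∎
    where
    r : Vector Carrier (suc n)
    r k = sum λ j → c j * N j k

    a : Fin (suc n) → Carrier
    a k = sign k * M zero k

    d : Fin (suc n) → Fin m → Carrier
    d k j = det (minor k M [ i ≔ N j ∘ punchIn k ])

  -- For i ≠ j the new matrix contains row `j` twice. This is the identity M adj(M) = det(M) I, read
  -- entry by entry.
  det-≔-row : ∀ {n} (M : Matrix n) i j → det (M [ i ≔ M j ]) ≈ δ⟨ i ≟ j ⟩ * det M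
  det-≔-row M i j with i ≟ j
  ... | yes ≡.refl = trans
    (det-cong λ i′ k → reflexive (≡.cong (λ row → row k) (updateAt-id-local i M ≡.refl i′)))
    (sym (*-identityˡ _))
  ... | no  i≢j    = trans
    (det-equal-rows (M [ i ≔ M j ]) i j i≢j λ k → reflexive (≡.cong (λ row → row k)
      (≡.trans (updateAt-updates i M) (≡.sym (updateAt-minimal j i M (λ j≡i → i≢j (≡.sym j≡i)))))))
    (sym (zeroˡ _))

  module _ (derivation : Derivation R) where
    open Derivation derivation

    ∂ᴹ : ∀ {m n} → Mat m n → Mat m n
    ∂ᴹ A i j = ∂ (A i j)

    -- The signs are constants, so the product rule along the first row leaves two parts:
    -- differentiating the entries gives the summand for row 0, and differentiating the minors gives
    -- the others by induction.
    ∂-det : ∀ {n} (M : Matrix n) → ∂ (det M) ≈ sum (λ i → det (M [ i ≔ ∂ᴹ M i ]))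
    ∂-det {zero}  M = ∂-1#
    ∂-det {suc n} M = begin
      ∂ (det M)
        ≈⟨ ∂-sum (λ j → a j * d j) ⟩
      sum (λ j → ∂ (a j * d j))
        ≈⟨ sum-+ (λ j → trans (∂-* (a j) (d j))
             (+-cong (*-congʳ (∂-scale (sign j) (M zero j) (∂-sign j))) (*-congˡ (∂-det (minor j M))))) ⟩
      det (M [ zero ≔ ∂ᴹ M zero ]) + sum (λ j → a j * sum (d′ j))
        ≈⟨ +-congˡ (sum-cong-≋ λ j → *-distribˡ-sum (a j) (d′ j)) ⟩
      det (M [ zero ≔ ∂ᴹ M zero ]) + sum (λ j → sum (λ i → a j * d′ j i))
        ≈⟨ +-congˡ (sum-swap {suc n} {n} λ j i → *-congˡ {a j} (sym (det-cong
             {M = minor j (M [ suc i ≔ ∂ᴹ M (suc i) ])} (minor-≔ M i (∂ᴹ M (suc i)) j)))) ⟩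
      sum (λ i → det (M [ i ≔ ∂ᴹ M i ])) ∎
      where
      a d : Fin (suc n) → Carrier
      a j = sign j * M zero j
      d j = det (minor j M)

      d′ : Fin (suc n) → Fin n → Carrier
      d′ j i = det (minor j M [ i ≔ ∂ᴹ M (suc i) ∘ punchIn j ])

      ∂-sign : ∀ (j : Fin (suc n)) → ∂ (sign j) ≈ 0#
      ∂-sign j = ∂-^ (- 1#) (toℕ j) (trans (∂-neg 1#) (trans (-‿cong ∂-1#) -0#≈0#))

    -- Since C B = I, the rows of ∂B are combinations of rows of B with coefficients from G = ∂B C.
    -- Substituting them into row i, every combination with j ≠ i repeats a row, so only the
    -- diagonal of G survives.
    jacobi : ∀ {n} (B C : Matrix n) → C ⊡ B ≈ᴹ I → ∂ (det B) ≈ det B * tr (C ⊡ ∂ᴹ B)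
    jacobi B C CB≈I = begin
      ∂ (det B)
        ≈⟨ ∂-det B ⟩
      sum (λ i → det (B [ i ≔ ∂ᴹ B i ]))
        ≈⟨ sum-cong-≋ (λ i → det-cong (≔-cong B i (λ k → sym (GB≈∂B i k)))) ⟩
      sum (λ i → det (B [ i ≔ (G ⊡ B) i ]))
        ≈⟨ sum-cong-≋ (λ i → det-row-combination B i (G i) B) ⟩
      sum (λ i → sum (λ j → G i j * det (B [ i ≔ B j ])))
        ≈⟨ sum-*ˡ (det B) (λ i → trans
             (sum-*ˡ (det B) λ j → trans (*-congˡ (det-≔-row B i j))
               (solve 3 (λ g d b → g :* (d :* b) := b :* (d :* g)) refl (G i j) δ⟨ i ≟ j ⟩ (det B)))
             (*-congˡ (sum-δ i (G i)))) ⟩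
      det B * tr (∂ᴹ B ⊡ C)
        ≈⟨ *-congˡ (tr-comm (∂ᴹ B) C) ⟩
      det B * tr (C ⊡ ∂ᴹ B) ∎
      where
      G = ∂ᴹ B ⊡ C

      GB≈∂B : G ⊡ B ≈ᴹ ∂ᴹ B
      GB≈∂B i k = begin
        (G ⊡ B) i k               ≈⟨ ⊡-assoc (∂ᴹ B) C B i k ⟩
        (∂ᴹ B ⊡ (C ⊡ B)) i k      ≈⟨ ⊡-congˡ (∂ᴹ B) CB≈I i k ⟩
        (∂ᴹ B ⊡ I) i k            ≈⟨ ⊡-identityʳ (∂ᴹ B) i k ⟩
        ∂ᴹ B i k                  ∎

-- The matrix determinant lemma for logarithmic derivatives

module LogarithmicDerivative {c ℓ} (R : CommutativeRing c ℓ) (derivation : Derivation R) where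
  open CommutativeRing R hiding (zero)
  open FiniteAlgebra rawRing
  open RingProperties ring
  open Derivation derivation
  open Summation R
  open Matrices R
  open Determinant R

  Matˢ : ℕ → ℕ → Setoid c ℓ
  Matˢ m n = record
    { Carrier       = Mat m n
    ; _≈_           = _≈ᴹ_
    ; isEquivalence = record
      { refl  = λ i j → refl
      ; sym   = λ A≈B i j → sym (A≈B i j)
      ; trans = λ A≈B B≈C i j → trans (A≈B i j) (B≈C i j)
      }
    }

  ⊡-assoc⁻¹ : ∀ {m n p q} (A : Mat m n) (B : Mat n p) (C : Mat p q) → A ⊡ (B ⊡ C) ≈ᴹ (A ⊡ B) ⊡ C
  ⊡-assoc⁻¹ A B C i j = sym (⊡-assoc A B C i j)

  ⊞-congˡ : ∀ {m n} (A : Mat m n) {B C : Mat m n} → B ≈ᴹ C → A ⊞ B ≈ᴹ A ⊞ C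
  ⊞-congˡ A B≈C i j = +-congˡ (B≈C i j)

  ⊞-cancelʳ : ∀ {m n} (A B C : Mat m n) → B ⊞ A ≈ᴹ C ⊞ A → B ≈ᴹ C
  ⊞-cancelʳ A B C eq i j = +-cancelʳ (A i j) (B i j) (C i j) (eq i j)

  private
    ∂′ : ∀ {m n} → Mat m n → Mat m n
    ∂′ = ∂ᴹ derivation

  ∂-⊡ : ∀ {m n p} (A : Mat m n) (B : Mat n p) → ∂′ (A ⊡ B) ≈ᴹ ∂′ A ⊡ B ⊞ A ⊡ ∂′ B
  ∂-⊡ A B i k = trans (∂-sum (λ j → A i j * B j k)) (sum-+ λ j → ∂-* (A i j) (B j k))

  ∂-I : ∀ {n} (i j : Fin n) → ∂ (I i j) ≈ 0#
  ∂-I i j with does (i ≟ j)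
  ... | true  = ∂-1#
  ... | false = ∂-0#

  -- With Y = P + KL and U = QK one has Y = P (I + UL), and I + UL has the same
  -- determinant, hence the same logarithmic derivative, as the smaller matrix I + LU.
  module LowRank {k n : ℕ} (P Q W : Mat k k) (K : Mat k n) (L : Mat n k)
    (PQ≈I : P ⊡ Q ≈ᴹ I) (QP≈I : Q ⊡ P ≈ᴹ I)
    (YW≈I : (P ⊞ K ⊡ L) ⊡ W ≈ᴹ I) (WY≈I : W ⊡ (P ⊞ K ⊡ L) ≈ᴹ I)
    (∂L≈0 : ∀ i j → ∂ (L i j) ≈ 0#) where

    -- `W′` will invert `Y′` = I + UL from the left, and `C` is what Woodbury's formula then gives
    -- as an inverse of `B` = I + LU, namely I - L (I + UL)⁻¹ U.
    Y Y′ W′ : Mat k k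
    U : Mat k n
    B C X : Mat n n
    Y = P ⊞ K ⊡ L
    U = Q ⊡ K
    Y′ = I ⊞ U ⊡ L
    W′ = W ⊡ P
    B = I ⊞ L ⊡ U
    X = L ⊡ (W′ ⊡ U)
    C = I ⊞ ⊟ X

    Y≈PY′ : Y ≈ᴹ P ⊡ Y′
    Y≈PY′ = begin
      P ⊞ K ⊡ L               ≈⟨ ⊞-congˡ P (⊡-congʳ L (⊡-identityˡ K)) ⟨
      P ⊞ I ⊡ K ⊡ L           ≈⟨ ⊞-congˡ P (⊡-congʳ L (⊡-congʳ K PQ≈I)) ⟨
      P ⊞ P ⊡ Q ⊡ K ⊡ L       ≈⟨ ⊞-congˡ P (⊡-congʳ L (⊡-assoc P Q K)) ⟩
      P ⊞ P ⊡ U ⊡ L           ≈⟨ ⊞-congˡ P (⊡-assoc P U L) ⟩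
      P ⊞ P ⊡ (U ⊡ L)         ≈⟨ (λ i j → +-congʳ (⊡-identityʳ P i j)) ⟨
      P ⊡ I ⊞ P ⊡ (U ⊡ L)     ≈⟨ ⊡-distribˡ P I (U ⊡ L) ⟨
      P ⊡ Y′                  ∎
      where open SetoidReasoning (Matˢ k k)

    W′Y′≈I : W′ ⊡ Y′ ≈ᴹ I
    W′Y′≈I = begin
      W ⊡ P ⊡ Y′      ≈⟨ ⊡-assoc W P Y′ ⟩
      W ⊡ (P ⊡ Y′)    ≈⟨ ⊡-congˡ W Y≈PY′ ⟨
      W ⊡ Y           ≈⟨ WY≈I ⟩
      I               ∎
      where open SetoidReasoning (Matˢ k k)

    -- From P Y′ W = Y W = I by multiplying with Q. Once the trace has been rotated, this is what
    -- removes `W` from the term containing ∂P.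
    Y′W≈Q : Y′ ⊡ W ≈ᴹ Q
    Y′W≈Q = begin
      Y′ ⊡ W                ≈⟨ ⊡-congʳ W (⊡-identityˡ Y′) ⟨
      I ⊡ Y′ ⊡ W            ≈⟨ ⊡-congʳ W (⊡-congʳ Y′ QP≈I) ⟨
      Q ⊡ P ⊡ Y′ ⊡ W        ≈⟨ ⊡-congʳ W (⊡-assoc Q P Y′) ⟩
      Q ⊡ (P ⊡ Y′) ⊡ W      ≈⟨ ⊡-congʳ W (⊡-congˡ Q Y≈PY′) ⟨
      Q ⊡ Y ⊡ W             ≈⟨ ⊡-assoc Q Y W ⟩
      Q ⊡ (Y ⊡ W)           ≈⟨ ⊡-congˡ Q YW≈I ⟩
      Q ⊡ I                 ≈⟨ ⊡-identityʳ Q ⟩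
      Q                     ∎
      where open SetoidReasoning (Matˢ k k)

    C⊞X≈I : C ⊞ X ≈ᴹ I
    C⊞X≈I i j = trans (+-assoc _ _ _) (trans (+-congˡ (-‿inverseˡ _)) (+-identityʳ _))

    -- The push-through identity (I + LU)⁻¹ L = L (I + UL)⁻¹. After adding X L, both sides equal L:
    -- the left because C + X = I, the right because L W′ + X L = L W′ Y′.
    CL≈LW′ : C ⊡ L ≈ᴹ L ⊡ W′
    CL≈LW′ = ⊞-cancelʳ (X ⊡ L) (C ⊡ L) (L ⊡ W′) (begin
      C ⊡ L ⊞ X ⊡ L                       ≈⟨ ⊡-distribʳ L C X ⟨
      (C ⊞ X) ⊡ L                         ≈⟨ ⊡-congʳ L C⊞X≈I ⟩
      I ⊡ L                               ≈⟨ ⊡-identityˡ L ⟩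
      L                                   ≈⟨ ⊡-identityʳ L ⟨
      L ⊡ I                               ≈⟨ ⊡-congˡ L W′Y′≈I ⟨
      L ⊡ (W′ ⊡ Y′)                       ≈⟨ ⊡-congˡ L (⊡-distribˡ W′ I (U ⊡ L)) ⟩
      L ⊡ (W′ ⊡ I ⊞ W′ ⊡ (U ⊡ L))
        ≈⟨ ⊡-congˡ L (λ i j → +-cong (⊡-identityʳ W′ i j) (⊡-assoc⁻¹ W′ U L i j)) ⟩
      L ⊡ (W′ ⊞ W′ ⊡ U ⊡ L)               ≈⟨ ⊡-distribˡ L W′ (W′ ⊡ U ⊡ L) ⟩
      L ⊡ W′ ⊞ L ⊡ (W′ ⊡ U ⊡ L)           ≈⟨ ⊞-congˡ (L ⊡ W′) (⊡-assoc L (W′ ⊡ U) L) ⟨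
      L ⊡ W′ ⊞ X ⊡ L                      ∎)
      where open SetoidReasoning (Matˢ n k)

    CB≈I : C ⊡ B ≈ᴹ I
    CB≈I = begin
      C ⊡ B                   ≈⟨ ⊡-distribˡ C I (L ⊡ U) ⟩
      C ⊡ I ⊞ C ⊡ (L ⊡ U)     ≈⟨ (λ i j → +-cong (⊡-identityʳ C i j) (⊡-assoc⁻¹ C L U i j)) ⟩
      C ⊞ C ⊡ L ⊡ U           ≈⟨ ⊞-congˡ C (⊡-congʳ U CL≈LW′) ⟩
      C ⊞ L ⊡ W′ ⊡ U          ≈⟨ ⊞-congˡ C (⊡-assoc L W′ U) ⟩
      C ⊞ X                   ≈⟨ C⊞X≈I ⟩
      I                       ∎
      where open SetoidReasoning (Matˢ n n)

    ∂Y≈ : ∂′ Y ≈ᴹ ∂′ P ⊡ Y′ ⊞ P ⊡ (∂′ U ⊡ L)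
    ∂Y≈ = begin
      ∂′ Y                            ≈⟨ (λ i j → ∂-cong (Y≈PY′ i j)) ⟩
      ∂′ (P ⊡ Y′)                     ≈⟨ ∂-⊡ P Y′ ⟩
      ∂′ P ⊡ Y′ ⊞ P ⊡ ∂′ Y′           ≈⟨ ⊞-congˡ (∂′ P ⊡ Y′) (⊡-congˡ P ∂Y′≈) ⟩
      ∂′ P ⊡ Y′ ⊞ P ⊡ (∂′ U ⊡ L)      ∎
      where
      open SetoidReasoning (Matˢ k k)

      ∂Y′≈ : ∂′ Y′ ≈ᴹ ∂′ U ⊡ L
      ∂Y′≈ i j = trans (∂-+ _ _) (trans (+-cong (∂-I i j) (trans (∂-⊡ U L i j)
        (trans (+-congˡ (sum-zero (λ l → U i l * ∂ (L l j)) λ l → trans (*-congˡ (∂L≈0 l j)) (zeroʳ _)))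
          (+-identityʳ _)))) (+-identityˡ _))

    ∂B≈L∂U : ∂′ B ≈ᴹ L ⊡ ∂′ U
    ∂B≈L∂U i j = trans (∂-+ _ _) (trans (+-cong (∂-I i j) (trans (∂-⊡ L U i j)
      (trans (+-congʳ (sum-zero (λ l → ∂ (L i l) * U l j) λ l → trans (*-congʳ (∂L≈0 i l)) (zeroˡ _)))
        (+-identityˡ _)))) (+-identityˡ _))

    -- The product rule for Y = P Y′ gives two terms. Cyclicity of the trace lets Y′ W = Q act in
    -- the first and L W′ = C L in the second.
    tr-W∂Y : tr (W ⊡ ∂′ Y) ≈ tr (Q ⊡ ∂′ P) + tr (C ⊡ ∂′ B)
    tr-W∂Y = begin
      tr (W ⊡ ∂′ Y)
        ≈⟨ tr-cong (⊡-congˡ W ∂Y≈) ⟩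
      tr (W ⊡ (∂′ P ⊡ Y′ ⊞ P ⊡ (∂′ U ⊡ L)))
        ≈⟨ tr-cong (⊡-distribˡ W (∂′ P ⊡ Y′) (P ⊡ (∂′ U ⊡ L))) ⟩
      tr (W ⊡ (∂′ P ⊡ Y′) ⊞ W ⊡ (P ⊡ (∂′ U ⊡ L)))
        ≈⟨ tr-⊞ (W ⊡ (∂′ P ⊡ Y′)) (W ⊡ (P ⊡ (∂′ U ⊡ L))) ⟩
      tr (W ⊡ (∂′ P ⊡ Y′)) + tr (W ⊡ (P ⊡ (∂′ U ⊡ L)))
        ≈⟨ +-cong first second ⟩
      tr (Q ⊡ ∂′ P) + tr (C ⊡ ∂′ B) ∎
      where
      open SetoidReasoning setoid

      first : tr (W ⊡ (∂′ P ⊡ Y′)) ≈ tr (Q ⊡ ∂′ P)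
      first = begin
        tr (W ⊡ (∂′ P ⊡ Y′))    ≈⟨ tr-cong (⊡-assoc W (∂′ P) Y′) ⟨
        tr (W ⊡ ∂′ P ⊡ Y′)      ≈⟨ tr-comm (W ⊡ ∂′ P) Y′ ⟩
        tr (Y′ ⊡ (W ⊡ ∂′ P))    ≈⟨ tr-cong (⊡-assoc Y′ W (∂′ P)) ⟨
        tr (Y′ ⊡ W ⊡ ∂′ P)      ≈⟨ tr-cong (⊡-congʳ (∂′ P) Y′W≈Q) ⟩
        tr (Q ⊡ ∂′ P)           ∎

      second : tr (W ⊡ (P ⊡ (∂′ U ⊡ L))) ≈ tr (C ⊡ ∂′ B)
      second = begin
        tr (W ⊡ (P ⊡ (∂′ U ⊡ L)))   ≈⟨ tr-cong (⊡-assoc W P (∂′ U ⊡ L)) ⟨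
        tr (W′ ⊡ (∂′ U ⊡ L))        ≈⟨ tr-cong (⊡-assoc W′ (∂′ U) L) ⟨
        tr (W′ ⊡ ∂′ U ⊡ L)          ≈⟨ tr-comm (W′ ⊡ ∂′ U) L ⟩
        tr (L ⊡ (W′ ⊡ ∂′ U))        ≈⟨ tr-cong (⊡-assoc L W′ (∂′ U)) ⟨
        tr (L ⊡ W′ ⊡ ∂′ U)          ≈⟨ tr-cong (⊡-congʳ (∂′ U) CL≈LW′) ⟨
        tr (C ⊡ L ⊡ ∂′ U)           ≈⟨ tr-cong (⊡-assoc C L (∂′ U)) ⟩
        tr (C ⊡ (L ⊡ ∂′ U))         ≈⟨ tr-cong (⊡-congˡ C ∂B≈L∂U) ⟨
        tr (C ⊡ ∂′ B)               ∎

    ∂-det-B : ∂ (det B) ≈ det B * tr (C ⊡ ∂′ B)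
    ∂-det-B = jacobi derivation B C CB≈I

-- The ring of formal power series

module PowerSeriesRing {c ℓ} (R : CommutativeRing c ℓ) where
  open PowerSeries R
  private
    module R = CommutativeRing R
    module Σ = Summation R
  open R using (Carrier; 0#; 1#)
  open CommutativeMonoidMult R.+-commutativeMonoid
    using (×-congʳ; ×-distrib-+; ×-homo-+) renaming (_×_ to _·_)
  open SemiringMult R.semiring using (×-assoc-*; ×-comm-*)
  open IntegerSolver R using (solve; _:=_; _:+_; _:*_; :0)
  open SetoidReasoning R.setoid

  *-head : ∀ f g → (f * g) 0 R.≈ f 0 R.* g 0
  *-head f g = R.+-identityʳ _

  private
    tail : R⟦t⟧ → R⟦t⟧
    tail f n = f (suc n)

    *-cong′ : ∀ {f f′ g g′} → f ≈ f′ → g ≈ g′ → f * g ≈ f′ * g′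
    *-cong′ f≈f′ g≈g′ n = Σ.sum-cong-≋ {suc n} λ i → R.*-cong (f≈f′ (toℕ i)) (g≈g′ (n ∸ toℕ i))

    -- By definition the product unfolds along its left factor. This mirror recursion along the
    -- right factor lets commutativity go through by induction.
    *-tailʳ : ∀ n f g → (f * g) (suc n) R.≈ f (suc n) R.* g 0 R.+ (f * tail g) n
    *-tailʳ zero    f g = solve 4 (λ f₀ f₁ g₀ g₁ → f₀ :* g₁ :+ (f₁ :* g₀ :+ :0) := f₁ :* g₀ :+ (f₀ :* g₁ :+ :0))
      R.refl (f 0) (f 1) (g 0) (g 1)
    *-tailʳ (suc n) f g = begin
      f 0 R.* g (suc (suc n)) R.+ (tail f * g) (suc n)
        ≈⟨ R.+-congˡ (*-tailʳ n (tail f) g) ⟩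
      f 0 R.* g (suc (suc n)) R.+ (f (suc (suc n)) R.* g 0 R.+ (tail f * tail g) n)
        ≈⟨ solve 3 (λ x y z → x :+ (y :+ z) := y :+ (x :+ z)) R.refl _ _ _ ⟩
      f (suc (suc n)) R.* g 0 R.+ (f * tail g) (suc n) ∎

    *-comm′ : ∀ f g → f * g ≈ g * f
    *-comm′ f g zero    = R.+-congʳ (R.*-comm (f 0) (g 0))
    *-comm′ f g (suc n) = begin
      f 0 R.* g (suc n) R.+ (tail f * g) n   ≈⟨ R.+-cong (R.*-comm _ _) (*-comm′ (tail f) g n) ⟩
      g (suc n) R.* f 0 R.+ (g * tail f) n   ≈⟨ *-tailʳ n g f ⟨
      (g * f) (suc n)                        ∎

    *-distribʳ′ : ∀ h f g → (f + g) * h ≈ f * h + g * h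
    *-distribʳ′ h f g n = Σ.sum-+ {suc n} λ i → R.distribʳ (h (n ∸ toℕ i)) (f (toℕ i)) (g (toℕ i))

    *-scale : ∀ x f g n → ((λ m → x R.* f m) * g) n R.≈ x R.* (f * g) n
    *-scale x f g n = Σ.sum-*ˡ {suc n} x λ i → R.*-assoc x (f (toℕ i)) (g (n ∸ toℕ i))

    *-assoc′ : ∀ f g h → (f * g) * h ≈ f * (g * h)
    *-assoc′ f g h zero    =
      solve 3 (λ f g h → (f :* g :+ :0) :* h :+ :0 := f :* (g :* h :+ :0) :+ :0) R.refl (f 0) (g 0) (h 0)
    *-assoc′ f g h (suc n) = begin
      (f * g) 0 R.* h (suc n) R.+ (tail (f * g) * h) n
        -- By computation, `tail (f * g)` is f 0 times `tail g`, plus `tail f * g`; the induction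
        -- hypothesis applies to the second part.
        ≈⟨ R.+-cong (R.*-congʳ (*-head f g)) (R.trans
             (*-distribʳ′ h (λ m → f 0 R.* tail g m) (tail f * g) n)
             (R.+-cong (*-scale (f 0) (tail g) h n) (*-assoc′ (tail f) g h n))) ⟩
      f 0 R.* g 0 R.* h (suc n) R.+ (f 0 R.* (tail g * h) n R.+ (tail f * (g * h)) n)
        ≈⟨ solve 5 (λ f g h x y → f :* g :* h :+ (f :* x :+ y) := f :* (g :* h :+ x) :+ y) R.refl
             (f 0) (g 0) (h (suc n)) ((tail g * h) n) ((tail f * (g * h)) n) ⟩
      (f * (g * h)) (suc n) ∎

  const-0 : ∀ n → const 0# n R.≈ 0#
  const-0 zero    = R.refl
  const-0 (suc n) = R.refl

  const-*-coefficient : ∀ x f n → (const x * f) n R.≈ x R.* f n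
  const-*-coefficient x f zero    = R.+-identityʳ _
  const-*-coefficient x f (suc n) = R.trans
    (R.+-congˡ (Σ.sum-zero {suc n} (λ i → 0# R.* f (n ∸ toℕ i)) λ i → R.zeroˡ _)) (R.+-identityʳ _)

  private
    *-identityˡ′ : ∀ f → 1ₛ * f ≈ f
    *-identityˡ′ f n = R.trans (const-*-coefficient 1# f n) (R.*-identityˡ (f n))

  commutativeRing : CommutativeRing c ℓ
  commutativeRing = record
    { Carrier = R⟦t⟧
    ; _≈_ = _≈_
    ; _+_ = _+_
    ; _*_ = _*_
    ; -_  = -_
    ; 0#  = const 0#
    ; 1#  = 1ₛ
    ; isCommutativeRing = record
      { isRing = record
        { +-isAbelianGroup = record
          { isGroup = record
            { isMonoid = record
              { isSemigroup = record
                { isMagma = record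
                  { isEquivalence = record
                    { refl  = λ _ → R.refl
                    ; sym   = λ f≈g n → R.sym (f≈g n)
                    ; trans = λ f≈g g≈h n → R.trans (f≈g n) (g≈h n)
                    }
                  ; ∙-cong = λ f≈f′ g≈g′ n → R.+-cong (f≈f′ n) (g≈g′ n)
                  }
                ; assoc = λ f g h n → R.+-assoc (f n) (g n) (h n)
                }
              ; identity = (λ f n → R.trans (R.+-congʳ (const-0 n)) (R.+-identityˡ (f n)))
                         , (λ f n → R.trans (R.+-congˡ (const-0 n)) (R.+-identityʳ (f n)))
              }
            ; inverse = (λ f n → R.trans (R.-‿inverseˡ (f n)) (R.sym (const-0 n)))
                      , (λ f n → R.trans (R.-‿inverseʳ (f n)) (R.sym (const-0 n)))
            ; ⁻¹-cong = λ f≈g n → R.-‿cong (f≈g n)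
            }
          ; comm = λ f g n → R.+-comm (f n) (g n)
          }
        ; *-cong     = *-cong′
        ; *-assoc    = *-assoc′
        ; *-identity = *-identityˡ′ , λ f n → R.trans (*-comm′ f 1ₛ n) (*-identityˡ′ f n)
        ; distrib    = (λ h f g n → R.trans (*-comm′ h (f + g) n) (R.trans (*-distribʳ′ h f g n)
                         (R.+-cong (*-comm′ f h n) (*-comm′ g h n))))
                     , *-distribʳ′
        }
      ; *-comm = *-comm′
      }
    }

  -- t d/dt rather than d/dt, so that coefficients keep their index.
  euler : Derivation commutativeRing
  euler = record
    { ∂      = λ f n → n · f n
    ; ∂-cong = λ f≈g n → ×-congʳ n (f≈g n)
    ; ∂-+    = λ f g n → ×-distrib-+ (f n) (g n) n
    ; ∂-*    = λ f g n → R.trans (Σ.×-sum {suc n} n λ (i : Fin (suc n)) → f (toℕ i) R.* g (n ∸ toℕ i))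
        (Σ.sum-+ {suc n} λ i → split (f (toℕ i)) (g (n ∸ toℕ i)) (Fin.toℕ≤pred[n] i))
    }
    where
    split : ∀ {i n} x y → i ℕ.≤ n → n · (x R.* y) R.≈ (i · x) R.* y R.+ x R.* ((n ∸ i) · y)
    split {i} {n} x y i≤n = begin
      n · (x R.* y)                             ≈⟨ R.reflexive (≡.cong (_· (x R.* y)) (≡.sym (ℕ.m+[n∸m]≡n i≤n))) ⟩
      (i ℕ.+ (n ∸ i)) · (x R.* y)               ≈⟨ ×-homo-+ (x R.* y) i (n ∸ i) ⟩
      i · (x R.* y) R.+ (n ∸ i) · (x R.* y)     ≈⟨ R.+-cong (×-assoc-* i x y) (×-comm-* (n ∸ i) x y) ⟨
      (i · x) R.* y R.+ x R.* ((n ∸ i) · y)     ∎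

-- Coefficients, substitution and the chain rule

module PowerSeriesCalculus {c ℓ} (R : CommutativeRing c ℓ) where
  open PowerSeries R
  open PowerSeriesRing R public
  private
    module R = CommutativeRing R
    module S = CommutativeRing commutativeRing
    module F = FiniteAlgebra R.rawRing
    module Σ = Summation R
    module RP = RingProperties R.ring
    module × = SemiringMult S.semiring
  open R using (Carrier; 0#; 1#)
  open Derivation euler
  open CommutativeMonoidMult R.+-commutativeMonoid using (×-congʳ) renaming (_×_ to _·_)
  open SemiringMult R.semiring using (×-assoc-*; ×-comm-*)
  open SetoidReasoning R.setoid

  const-cong : ∀ {x y} → x R.≈ y → const x ≈ const y
  const-cong x≈y zero    = x≈y
  const-cong x≈y (suc n) = R.refl

  const-+ : ∀ x y → const (x R.+ y) ≈ const x + const y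
  const-+ x y zero    = R.refl
  const-+ x y (suc n) = R.sym (R.+-identityˡ 0#)

  const-* : ∀ x y → const (x R.* y) ≈ const x * const y
  const-* x y zero    = R.sym (const-*-coefficient x (const y) zero)
  const-* x y (suc n) = R.sym (R.trans (const-*-coefficient x (const y) (suc n)) (R.zeroʳ x))

  const-neg : ∀ x → const (R.- x) ≈ - const x
  const-neg x zero    = R.refl
  const-neg x (suc n) = R.sym RP.-0#≈0#

  const-sum : ∀ {n} (f : Fin n → Carrier) → const (F.sum f) ≈ sum (λ i → const (f i))
  const-sum {zero}  f = S.refl
  const-sum {suc n} f = S.trans (const-+ (f zero) _) (S.+-congˡ (const-sum (λ i → f (suc i))))

  const-if : ∀ b x y → const (if b then x else y) ≈ (if b then const x else const y)
  const-if true  x y = S.refl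
  const-if false x y = S.refl

  sum-coefficient : ∀ {m} (f : Fin m → R⟦t⟧) n → sum f n R.≈ F.sum (λ i → f i n)
  sum-coefficient {zero}  f n = const-0 n
  sum-coefficient {suc m} f n = R.+-congˡ (sum-coefficient (λ i → f (suc i)) n)

  t-*-zero : ∀ f → (t * f) 0 R.≈ 0#
  t-*-zero f = R.trans (R.+-identityʳ _) (R.zeroˡ (f 0))

  t-*-suc : ∀ f n → (t * f) (suc n) R.≈ f n
  t-*-suc f n = begin
    0# R.* f (suc n) R.+ ((λ m → t (suc m)) * f) n   ≈⟨ R.+-cong (R.zeroˡ _) (S.*-congʳ {f} tail-t n) ⟩
    0# R.+ (1ₛ * f) n                                ≈⟨ R.+-identityˡ _ ⟩
    (1ₛ * f) n                                       ≈⟨ S.*-identityˡ f n ⟩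
    f n                                              ∎
    where
    tail-t : (λ m → t (suc m)) ≈ 1ₛ
    tail-t zero    = R.refl
    tail-t (suc n) = R.refl

  private
    ·-zero : ∀ n → n · 0# R.≈ 0#
    ·-zero zero    = R.refl
    ·-zero (suc n) = R.trans (R.+-identityˡ _) (·-zero n)

  ∂-t : ∂ t ≈ t
  ∂-t zero          = R.refl
  ∂-t (suc zero)    = R.+-identityʳ 1#
  ∂-t (suc (suc n)) = ·-zero (suc (suc n))

  ∂-const : ∀ x → ∂ (const x) ≈ const 0#
  ∂-const x zero    = R.refl
  ∂-const x (suc n) = ·-zero (suc n)

  ∂-^suc : ∀ g k → ∂ (g ^ suc k) ≈ suc k ×.× (g ^ k * ∂ g)
  ∂-^suc g zero    = S.trans (∂-cong (S.*-identityʳ g))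
    (S.sym (S.trans (S.+-identityʳ (1ₛ * ∂ g)) (S.*-identityˡ (∂ g))))
  ∂-^suc g (suc k) = S.trans (∂-* g (g ^ suc k)) (S.+-cong (S.*-comm (∂ g) (g ^ suc k))
    (S.trans (S.*-congˡ {g} (∂-^suc g k))
      (S.trans (×.×-comm-* (suc k) g (g ^ k * ∂ g)) (×.×-congʳ (suc k) (S.sym (S.*-assoc g (g ^ k) (∂ g)))))))

  ×-coefficient : ∀ k f n → (k ×.× f) n R.≈ k · f n
  ×-coefficient zero    f n = const-0 n
  ×-coefficient (suc k) f n = R.+-congˡ (×-coefficient k f n)

  ^-order : ∀ g → g 0 R.≈ 0# → ∀ k n → n ℕ.< k → (g ^ k) n R.≈ 0#
  ^-order g g₀≈0 (suc k) n (s≤s n≤k) = Σ.sum-zero {suc n} _ term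
    where
    term : ∀ (i : Fin (suc n)) → g (toℕ i) R.* (g ^ k) (n ∸ toℕ i) R.≈ 0#
    term zero    = R.trans (R.*-congʳ g₀≈0) (R.zeroˡ _)
    term (suc i) = R.trans (R.*-congˡ (^-order g g₀≈0 k _
      (ℕ.<-≤-trans (ℕ.∸-monoʳ-< (s≤s (z≤n {toℕ i})) (Fin.toℕ<n i)) n≤k))) (R.zeroʳ _)

  private
    sum-extend : ∀ {m n} (h : ℕ → Carrier) → m ℕ.≤ n → (∀ k → m ℕ.≤ k → h k R.≈ 0#) →
                 F.sum {m} (λ i → h (toℕ i)) R.≈ F.sum {n} (λ i → h (toℕ i))
    sum-extend {zero} {n} h z≤n       h≈0 = R.sym (Σ.sum-zero {n} _ λ i → h≈0 (toℕ i) z≤n)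
    sum-extend {suc m}    h (s≤s m≤n) h≈0 =
      R.+-congˡ (sum-extend (λ k → h (suc k)) m≤n λ k m≤k → h≈0 (suc k) (s≤s m≤k))

  -- The truncation in `substitute` depends on the coefficient that is read. A common bound for all
  -- coefficients up to n is what allows sums to be interchanged.
  substitute-extend : ∀ c g → g 0 R.≈ 0# → ∀ {m n} → m ℕ.≤ n →
    substitute c g m R.≈ F.sum {suc n} (λ k → c (toℕ k) R.* (g ^ toℕ k) m)
  substitute-extend c g g₀≈0 {m} m≤n = sum-extend (λ k → c k R.* (g ^ k) m) (s≤s m≤n)
    λ k m<k → R.trans (R.*-congˡ (^-order g g₀≈0 k m m<k)) (R.zeroʳ _)

  -- Here `c′` lists the coefficients of the formal derivative of the outer series: the factor k + 1
  -- produced by differentiating the power k + 1 of g is absorbed by `c (suc k)`.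
  ∂-substitute : ∀ c c′ g → g 0 R.≈ 0# → (∀ k → suc k · c (suc k) R.≈ c′ k) →
                 ∂ (substitute c g) ≈ substitute c′ g * ∂ g
  ∂-substitute c c′ g g₀≈0 c→c′ zero    = R.sym (R.trans (R.+-identityʳ _) (R.zeroʳ _))
  ∂-substitute c c′ g g₀≈0 c→c′ (suc m) = begin
    n · substitute c g n
      ≈⟨ Σ.×-sum {suc n} n (λ k → c (toℕ k) R.* (g ^ toℕ k) n) ⟩
    F.sum {suc n} (λ k → n · (c (toℕ k) R.* (g ^ toℕ k) n))
      ≈⟨ Σ.sum-cong-≋ {suc n} (λ k → R.sym (×-comm-* n (c (toℕ k)) ((g ^ toℕ k) n))) ⟩
    F.sum {suc n} (λ k → c (toℕ k) R.* ∂ (g ^ toℕ k) n)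
      ≈⟨ R.+-cong (R.trans (R.*-congˡ (∂-const 1# n)) (R.zeroʳ _)) (Σ.sum-cong-≋ {n} λ k → term (toℕ k)) ⟩
    0# R.+ F.sum {n} (λ k → c′ (toℕ k) R.* (∂ g * g ^ toℕ k) n)
      ≈⟨ R.+-identityˡ _ ⟩
    F.sum {n} (λ k → c′ (toℕ k) R.* (∂ g * g ^ toℕ k) n)
      -- As `∂ g` has no constant term, coefficient m + 1 of its product with h reads h only up to
      -- m. This matches the m + 1 powers left after the constant power 0 has dropped out.
      ≈⟨ Σ.sum-cong-≋ {n} (λ k → R.trans (R.*-congˡ (∂g*-suc (g ^ toℕ k)))
           (Σ.*-distribˡ-sum (c′ (toℕ k)) λ (i : Fin n) → ∂ g (suc (toℕ i)) R.* (g ^ toℕ k) (m ∸ toℕ i))) ⟩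
    F.sum {n} (λ k → F.sum {n} (λ i → c′ (toℕ k) R.* (∂ g (suc (toℕ i)) R.* (g ^ toℕ k) (m ∸ toℕ i))))
      ≈⟨ Σ.sum-swap {n} {n} (λ k i → solve 3 (λ x y z → x :* (y :* z) := y :* (x :* z)) R.refl
           (c′ (toℕ k)) (∂ g (suc (toℕ i))) ((g ^ toℕ k) (m ∸ toℕ i))) ⟩
    F.sum {n} (λ i → F.sum {n} (λ k → ∂ g (suc (toℕ i)) R.* (c′ (toℕ k) R.* (g ^ toℕ k) (m ∸ toℕ i))))
      ≈⟨ Σ.sum-cong-≋ {n} (λ i → R.sym (R.trans
           (R.*-congˡ (substitute-extend c′ g g₀≈0 (ℕ.m∸n≤m m (toℕ i))))
           (Σ.*-distribˡ-sum (∂ g (suc (toℕ i))) λ (k : Fin n) → c′ (toℕ k) R.* (g ^ toℕ k) (m ∸ toℕ i)))) ⟩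
    F.sum {n} (λ i → ∂ g (suc (toℕ i)) R.* substitute c′ g (m ∸ toℕ i))
      ≈⟨ ∂g*-suc (substitute c′ g) ⟨
    (∂ g * substitute c′ g) n
      ≈⟨ S.*-comm (∂ g) (substitute c′ g) n ⟩
    (substitute c′ g * ∂ g) n ∎
    where
    open IntegerSolver R using (solve; _:=_; _:*_)

    n = suc m

    ∂g*-suc : ∀ h → (∂ g * h) n R.≈ F.sum {n} (λ i → ∂ g (suc (toℕ i)) R.* h (m ∸ toℕ i))
    ∂g*-suc h = R.trans (R.+-congʳ (R.zeroˡ (h n))) (R.+-identityˡ _)

    term : ∀ k → c (suc k) R.* ∂ (g ^ suc k) n R.≈ c′ k R.* (∂ g * g ^ k) n
    term k = begin
      c (suc k) R.* ∂ (g ^ suc k) n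
        ≈⟨ R.*-congˡ (R.trans (∂-^suc g k n) (×-coefficient (suc k) (g ^ k * ∂ g) n)) ⟩
      c (suc k) R.* (suc k · (g ^ k * ∂ g) n)
        ≈⟨ ×-comm-* (suc k) (c (suc k)) _ ⟩
      suc k · (c (suc k) R.* (g ^ k * ∂ g) n)
        ≈⟨ ×-assoc-* (suc k) (c (suc k)) _ ⟨
      (suc k · c (suc k)) R.* (g ^ k * ∂ g) n
        ≈⟨ R.*-cong (c→c′ k) (S.*-comm (g ^ k) (∂ g) n) ⟩
      c′ k R.* (∂ g * g ^ k) n ∎

-- The exponential series and division by integers

module ExponentialDerivative {c ℓ} (R : CommutativeℚAlgebra c ℓ) where
  private module R = CommutativeℚAlgebra R
  open R using (algebraMap; isHomomorphism)
  open RingMorphisms.IsRingHomomorphism isHomomorphism using (⟦⟧-cong; +-homo; 0#-homo; 1#-homo)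
  open PowerSeries R.commutativeRing
  open PowerSeriesCalculus R.commutativeRing
  open Exponential R
  open Derivation euler
  open MonoidMult R.+-monoid renaming (_×_ to _·_)
  open SemiringMult R.semiring using (×-assoc-*)

  private
    /-+ : ∀ n d .{{_ : ℕ.NonZero d}} → (ℤ.+ 1) ℚ./ d ℚ.+ (ℤ.+ n) ℚ./ d ≡ (ℤ.+ suc n) ℚ./ d
    /-+ n (suc d) = ℚ.toℚᵘ-injective (begin
      ℚ.toℚᵘ ((ℤ.+ 1) ℚ./ suc d ℚ.+ (ℤ.+ n) ℚ./ suc d)
        ≈⟨ ℚ.toℚᵘ-homo-+ ((ℤ.+ 1) ℚ./ suc d) ((ℤ.+ n) ℚ./ suc d) ⟩
      ℚ.toℚᵘ ((ℤ.+ 1) ℚ./ suc d) ℚᵘ.+ ℚ.toℚᵘ ((ℤ.+ n) ℚ./ suc d)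
        ≈⟨ ℚᵘ.+-cong (ℚ.toℚᵘ-fromℚᵘ (ℚᵘ.mkℚᵘ (ℤ.+ 1) d)) (ℚ.toℚᵘ-fromℚᵘ (ℚᵘ.mkℚᵘ (ℤ.+ n) d)) ⟩
      ℚᵘ.mkℚᵘ (ℤ.+ 1) d ℚᵘ.+ ℚᵘ.mkℚᵘ (ℤ.+ n) d
        ≈⟨ ℚᵘ.*≡* (solve 2 (λ n d → (con (ℤ.+ 1) :* d :+ n :* d) :* d := (con (ℤ.+ 1) :+ n) :* (d :* d))
             ≡.refl (ℤ.+ n) (ℤ.+ suc d)) ⟩
      ℚᵘ.mkℚᵘ (ℤ.+ suc n) d
        ≈⟨ ℚ.toℚᵘ-fromℚᵘ (ℚᵘ.mkℚᵘ (ℤ.+ suc n) d) ⟨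
      ℚ.toℚᵘ ((ℤ.+ suc n) ℚ./ suc d) ∎)
      where
      open ℤSolver.+-*-Solver
      open SetoidReasoning ℚᵘ.≃-setoid

    0/ : ∀ d .{{_ : ℕ.NonZero d}} → (ℤ.+ 0) ℚ./ d ≡ ℚ.0ℚ
    0/ (suc d) = ℚ.fromℚᵘ-cong {ℚᵘ.mkℚᵘ (ℤ.+ 0) d} {ℚᵘ.mkℚᵘ (ℤ.+ 0) 0} (ℚᵘ.*≡* ≡.refl)

    /-cancel : ∀ k d .{{_ : ℕ.NonZero d}} .{{_ : ℕ.NonZero (suc k ℕ.* d)}} →
               (ℤ.+ suc k) ℚ./ (suc k ℕ.* d) ≡ (ℤ.+ 1) ℚ./ d
    /-cancel k (suc d) = ℚ.fromℚᵘ-cong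
      {ℚᵘ.mkℚᵘ (ℤ.+ suc k) (d ℕ.+ k ℕ.* suc d)} {ℚᵘ.mkℚᵘ (ℤ.+ 1) d}
      (ℚᵘ.*≡* (≡.sym (ℤ.*-identityˡ _)))

    ·-fraction : ∀ n d .{{_ : ℕ.NonZero d}} → n · algebraMap ((ℤ.+ 1) ℚ./ d) R.≈ algebraMap ((ℤ.+ n) ℚ./ d)
    ·-fraction zero    d = R.sym (R.trans (⟦⟧-cong (0/ d)) 0#-homo)
    ·-fraction (suc n) d = R.trans (R.+-congˡ (·-fraction n d))
      (R.trans (R.sym (+-homo _ _)) (⟦⟧-cong (/-+ n d)))

  ·-unit-fraction : ∀ n x → suc n · (algebraMap ((ℤ.+ 1) ℚ./ suc n) R.* x) R.≈ x
  ·-unit-fraction n x = begin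
    suc n · (algebraMap ((ℤ.+ 1) ℚ./ suc n) R.* x)    ≈⟨ ×-assoc-* (suc n) _ x ⟨
    (suc n · algebraMap ((ℤ.+ 1) ℚ./ suc n)) R.* x    ≈⟨ R.*-congʳ (·-fraction (suc n) (suc n)) ⟩
    algebraMap ((ℤ.+ suc n) ℚ./ suc n) R.* x          ≈⟨ R.*-congʳ (⟦⟧-cong n/n≡1) ⟩
    algebraMap ℚ.1ℚ R.* x                             ≈⟨ R.*-congʳ 1#-homo ⟩
    R.1# R.* x                                        ≈⟨ R.*-identityˡ x ⟩
    x                                                 ∎
    where
    open SetoidReasoning R.setoid
    n/n≡1 : (ℤ.+ suc n) ℚ./ suc n ≡ ℚ.1ℚ
    n/n≡1 = ℚ.fromℚᵘ-cong {ℚᵘ.mkℚᵘ (ℤ.+ suc n) n} {ℚᵘ.mkℚᵘ (ℤ.+ 1) 0} (ℚᵘ.*≡* (ℤ.*-comm (ℤ.+ suc n) (ℤ.+ 1)))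

  ·-cancel : ∀ n {x} → suc n · x R.≈ R.0# → x R.≈ R.0#
  ·-cancel n {x} nx≈0 = begin
    x                                                ≈⟨ ·-unit-fraction n x ⟨
    suc n · (algebraMap ((ℤ.+ 1) ℚ./ suc n) R.* x)   ≈⟨ ×-comm-* (suc n) _ x ⟨
    algebraMap ((ℤ.+ 1) ℚ./ suc n) R.* (suc n · x)   ≈⟨ R.*-congˡ nx≈0 ⟩
    algebraMap ((ℤ.+ 1) ℚ./ suc n) R.* R.0#          ≈⟨ R.zeroʳ _ ⟩
    R.0#                                             ∎
    where
    open SetoidReasoning R.setoid
    open SemiringMult R.semiring using (×-comm-*)

  -- The coefficients 1/k! reproduce themselves under formal differentiation: (k + 1)/(k + 1)! =
  -- 1/k!, where the factorial unfolds by computation.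
  ∂-exp : ∀ g → g 0 R.≈ R.0# → ∂ (exp g) ≈ exp g * ∂ g
  ∂-exp g g₀≈0 = ∂-substitute 1/_! 1/_! g g₀≈0 λ k →
    let instance
          k!≢0 = k ℕ.!≢0
          sk!≢0 = suc k ℕ.!≢0
    in R.trans (·-fraction (suc k) (suc k !)) (⟦⟧-cong (/-cancel k (k !)))
    where
    1/_! : ℕ → R.Carrier
    1/ k ! = algebraMap (ℚ._/_ (ℤ.+ 1) (k !) {{k ℕ.!≢0}})

  ∂≈0⇒const : ∀ f → ∂ f ≈ const R.0# → f ≈ const (f 0)
  ∂≈0⇒const f ∂f≈0 zero    = R.refl
  ∂≈0⇒const f ∂f≈0 (suc n) = ·-cancel n (∂f≈0 (suc n))

-- Sums over arcs, sorted by end points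

module ArcSums {c ℓ} (S : CommutativeRing c ℓ) (Δ : Digraph) where
  open Digraph Δ using (V; 𝒜; 𝔱; 𝔥; 𝒜⟨_,_⟩?)
  open CommutativeRing S hiding (zero)
  open FiniteAlgebra rawRing
  open Summation S
  open SetoidReasoning setoid

  χ : V → V → 𝒜 → Carrier
  χ u v a = δ⟨ 𝒜⟨ u , v ⟩? a ⟩

  δ-cong-on : ∀ {p} {P : Set p} (P? : Dec P) {x y} → (P → x ≈ y) → δ⟨ P? ⟩ * x ≈ δ⟨ P? ⟩ * y
  δ-cong-on (yes p) x≈y = *-congˡ (x≈y p)
  δ-cong-on (no  _) x≈y = trans (zeroˡ _) (sym (zeroˡ _))

  ∑-empty : ∀ {n p} {P : U.Pred (Fin n) p} (P? : U.Decidable P) (x : Fin n → Carrier) →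
            ¬ ∃ P → ∑[ P? ] x ≈ 0#
  ∑-empty {P = P} P? x ∄P = sum-zero (λ i → if does (P? i) then x i else 0#) λ i → excluded (P? i) (λ p → ∄P (i , p))
    where
    excluded : ∀ {q} {Q : Set q} (Q? : Dec Q) {y} → ¬ Q → (if does Q? then y else 0#) ≈ 0#
    excluded (yes q) ¬q = contradiction q ¬q
    excluded (no  _) ¬q = refl

  -- Up to a weight, the arc-indexed matrices see arcs only through their end points. Products of
  -- such matrices therefore collapse to sums of this shape, in which `g` is constant on the class.
  sum-class : ∀ u v (x : 𝒜 → Carrier) (g : V → V → Carrier) →
    sum (λ a → χ u v a * (x a * g (𝔱 a) (𝔥 a))) ≈ ∑[ 𝒜⟨ u , v ⟩? ] x * g u v
  sum-class u v x g = sum-*ʳ (g u v) λ a → begin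
    χ u v a * (x a * g (𝔱 a) (𝔥 a))
      ≈⟨ δ-cong-on (𝒜⟨ u , v ⟩? a) (λ { (≡.refl , ≡.refl) → refl }) ⟩
    χ u v a * (x a * g u v)
      ≈⟨ *-assoc _ _ _ ⟨
    χ u v a * x a * g u v
      ≈⟨ *-congʳ (if-δ (𝒜⟨ u , v ⟩? a) (x a)) ⟨
    (if does (𝒜⟨ u , v ⟩? a) then x a else 0#) * g u v ∎

  -- Inserting the sum over v of the delta of 𝔥 a and v, which is 1, sorts the arcs leaving `w` by
  -- their heads.
  sum-tail : ∀ w (x : 𝒜 → Carrier) (g : V → V → Carrier) →
    sum (λ a → δ⟨ 𝔱 a ≟ w ⟩ * (x a * g (𝔱 a) (𝔥 a))) ≈ sum (λ v → ∑[ 𝒜⟨ w , v ⟩? ] x * g w v)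
  sum-tail w x g = begin
    sum (λ a → y a)
      ≈⟨ sum-cong-≋ (λ a → sum-δ (𝔥 a) (λ _ → y a)) ⟨
    sum (λ a → sum (λ v → δ⟨ 𝔥 a ≟ v ⟩ * y a))
      ≈⟨ sum-swap (λ a v → begin
           δ⟨ 𝔥 a ≟ v ⟩ * (δ⟨ 𝔱 a ≟ w ⟩ * z a)   ≈⟨ *-assoc _ _ _ ⟨
           δ⟨ 𝔥 a ≟ v ⟩ * δ⟨ 𝔱 a ≟ w ⟩ * z a     ≈⟨ *-congʳ (*-comm _ _) ⟩
           δ⟨ 𝔱 a ≟ w ⟩ * δ⟨ 𝔥 a ≟ v ⟩ * z a     ≈⟨ *-congʳ (δ-× (𝔱 a ≟ w) (𝔥 a ≟ v)) ⟨
           χ w v a * z a                         ∎) ⟩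
    sum (λ v → sum (λ a → χ w v a * z a))
      ≈⟨ sum-cong-≋ (λ v → sum-class w v x g) ⟩
    sum (λ v → ∑[ 𝒜⟨ w , v ⟩? ] x * g w v) ∎
    where
    z y : 𝒜 → Carrier
    z a = x a * g (𝔱 a) (𝔥 a)
    y a = δ⟨ 𝔱 a ≟ w ⟩ * z a

  sum-arcs : ∀ (x : 𝒜 → Carrier) (g : V → V → Carrier) →
    sum (λ a → x a * g (𝔱 a) (𝔥 a)) ≈ sum (λ u → sum (λ v → ∑[ 𝒜⟨ u , v ⟩? ] x * g u v))
  sum-arcs x g = begin
    sum (λ a → z a)
      ≈⟨ sum-cong-≋ (λ a → sum-δ (𝔱 a) (λ _ → z a)) ⟨
    sum (λ a → sum (λ u → δ⟨ 𝔱 a ≟ u ⟩ * z a))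
      ≈⟨ ∑-comm (λ a u → δ⟨ 𝔱 a ≟ u ⟩ * z a) ⟩
    sum (λ u → sum (λ a → δ⟨ 𝔱 a ≟ u ⟩ * z a))
      ≈⟨ sum-cong-≋ (λ u → sum-tail u x g) ⟩
    sum (λ u → sum (λ v → ∑[ 𝒜⟨ u , v ⟩? ] x * g u v)) ∎
    where
    z : 𝒜 → Carrier
    z a = x a * g (𝔱 a) (𝔥 a)

-- From ordered pairs of vertices to pairs listed once

Adjacent : (Δ : Digraph) → Digraph.V Δ → Digraph.V Δ → Set
Adjacent Δ u v = ∃ (𝒜⟨ u , v ⟩ U.∪ 𝒜⟨ v , u ⟩)
  where open Digraph Δ

module VertexPairs {c ℓ ℓ′} (S : CommutativeRing c ℓ) (Δ : Digraph)
  {_≤_ : Rel (Digraph.V Δ) ℓ′} (≤-isTotalOrder : IsTotalOrder _≡_ _≤_)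
  (_≤?_ : B.Decidable _≤_)
  (Φ? : B.Decidable λ u v → u ≤ v × Adjacent Δ u v) where
  open Digraph Δ using (V)
  open CommutativeRing S hiding (zero)
  open FiniteAlgebra rawRing
  open Summation S
  open SetoidReasoning setoid
  private module ≤ = IsTotalOrder ≤-isTotalOrder

  symmetrized : (V → V → Carrier) → V → V → Carrier
  symmetrized h u v = if does (u ≟ v) then h u v else h u v + h v u

  -- Pairs with u ≤ v stay in place and the others are transposed, so a pair in Φ collects both
  -- orientations. A diagonal pair is its own transpose and is counted once, which is the reason for
  -- the case distinction in `symmetrized`.
  sum-Φ : ∀ h → (∀ u v → ¬ Adjacent Δ u v → h u v ≈ 0#) →
    sum (λ u → sum (h u)) ≈ sum (λ u → ∑[ Φ? u ] (symmetrized h u))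
  sum-Φ h h-support = begin
    sum (λ u → sum (h u))
      ≈⟨ sum-+ (λ u → sum-+ (λ v → split u v)) ⟩
    sum (λ u → sum (λ v → up u v)) + sum (λ u → sum (λ v → down u v))
      ≈⟨ +-congˡ (∑-comm down) ⟩
    sum (λ u → sum (λ v → up u v)) + sum (λ u → sum (λ v → down v u))
      ≈⟨ sum-+ (λ u → sum-+ (λ v → combine u v (u ≤? v) (v ≤? u) (u ≟ v) (Φ? u v))) ⟨
    sum (λ u → ∑[ Φ? u ] (symmetrized h u)) ∎
    where
    up down : V → V → Carrier
    up   u v = if does (u ≤? v) then h u v else 0#
    down u v = if does (u ≤? v) then 0# else h u v

    split : ∀ u v → h u v ≈ up u v + down u v
    split u v with does (u ≤? v)
    ... | true  = sym (+-identityʳ _)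
    ... | false = sym (+-identityˡ _)

    -- The decisions are passed as arguments so that they can be matched together; reflexivity,
    -- antisymmetry and totality exclude the inconsistent combinations.
    combine : ∀ u v (u≤?v : Dec (u ≤ v)) (v≤?u : Dec (v ≤ u)) (u≟v : Dec (u ≡ v))
      (Φ? : Dec (u ≤ v × Adjacent Δ u v)) →
      (if does Φ? then (if does u≟v then h u v else h u v + h v u) else 0#) ≈
      (if does u≤?v then h u v else 0#) + (if does v≤?u then 0# else h v u)
    combine u v (yes _) (yes _) (yes _) (yes _) = sym (+-identityʳ _)
    combine u v (yes u≤v) (yes _) (yes _) (no ¬Φ) =
      sym (trans (+-identityʳ _) (h-support u v λ arc → ¬Φ (u≤v , arc)))
    combine u v (no u≰v) _ (yes u≡v) _ = contradiction (≤.reflexive u≡v) u≰v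
    combine u v _ (no v≰u) (yes u≡v) _ = contradiction (≤.reflexive (≡.sym u≡v)) v≰u
    combine u v (yes u≤v) (yes v≤u) (no u≢v) _ = contradiction (≤.antisym u≤v v≤u) u≢v
    combine u v (yes _) (no _) (no _) (yes _) = refl
    combine u v (yes u≤v) (no _) (no _) (no ¬Φ) = sym (trans
      (+-cong (h-support u v λ arc → ¬Φ (u≤v , arc))
              (h-support v u λ { (a , inj₁ p) → ¬Φ (u≤v , a , inj₂ p) ; (a , inj₂ p) → ¬Φ (u≤v , a , inj₁ p) }))
      (+-identityˡ _))
    combine u v (no u≰v) v≤?u (no _) (yes (u≤v , _)) = contradiction u≤v u≰v
    combine u v (no u≰v) (yes _) (no _) (no _) = sym (+-identityˡ _)
    combine u v (no u≰v) (no v≰u) (no _) (no _) with ≤.total u v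
    ... | inj₁ u≤v = contradiction u≤v u≰v
    ... | inj₂ v≤u = contradiction v≤u v≰u

-- The inverse-arc matrix I + J, its inverse, and its trace

module WeightedDigraph {c ℓ} (S : CommutativeRing c ℓ) (derivation : Derivation S) (Δ : Digraph)
  (t : CommutativeRing.Carrier S) (τ υ : Digraph.𝒜 Δ → CommutativeRing.Carrier S)
  (τ̂ υ̂ f⁻¹ : Digraph.V Δ → Digraph.V Δ → CommutativeRing.Carrier S) where
  open Digraph Δ using (V; 𝒜; #V; #𝒜; 𝔱; 𝔥; 𝒜⟨_,_⟩; 𝒜⟨_,_⟩?)
  open CommutativeRing S hiding (zero)
  open FiniteAlgebra rawRing
  open RingProperties ring
  open Summation S
  open Derivation derivation
  open Matrices S
  open LogarithmicDerivative S derivation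
  open ArcSums S Δ
  open IntegerSolver S using (solve; _:=_; _:+_; _:*_; _:-_; :-_; :0; :1)
  open SetoidReasoning setoid

  f : V → V → Carrier
  f u v = if does (u ≟ v)
    then 1# + t * υ̂ u u
    else 1# - t ^ 2 * υ̂ u v * υ̂ v u

  -- In E = J - J² + J³ - ... for an arc from u to v with u ≠ v, the odd powers are supported on
  -- inverse arcs and sum up to `α`, the even ones on parallel arcs and sum up to `β`. At a loop
  -- inverse and parallel arcs coincide; the whole series is then put into `α`, and `ν` switches `β`
  -- off.
  ν α β : V → V → Carrier
  ν u v = if does (u ≟ v) then 0# else 1#
  α u v = t * f⁻¹ u v
  β u v = ν u v * (t * υ̂ v u * α u v)

  -- N w is D w w: the order on V only serves to list each pair {w , v} once.
  N : V → Carrier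
  N w = sum λ v → ν w v * (f⁻¹ w v * (τ̂ w v * υ̂ v w))

  -- Every arc parallel to a has the same inverse arcs as a, so the powers of J are
  -- combinations of J and of the parallelism matrix; E = I - (I + J)⁻¹ is read off
  -- the resulting geometric series.
  J E : Mat #𝒜 #𝒜
  J a b = t * (χ (𝔥 a) (𝔱 a) b * υ b)
  E a b = υ b * (α (𝔱 a) (𝔥 a) * χ (𝔥 a) (𝔱 a) b - β (𝔱 a) (𝔥 a) * χ (𝔱 a) (𝔥 a) b)

  -- K L is -t times the τ-part of θ. The factor t sits in `K` so that ∂ annihilates `L`, as
  -- `LowRank` requires.
  K : Mat #𝒜 #V
  K a v = - (t * δ⟨ 𝔥 a ≟ v ⟩)

  L : Mat #V #𝒜
  L v a = δ⟨ 𝔱 a ≟ v ⟩ * τ a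

  ν-loop : ∀ u → ν u u ≈ 0#
  ν-loop u rewrite dec-true (u ≟ u) ≡.refl = refl

  ν-edge : ∀ {u v} → u ≢ v → ν u v ≈ 1#
  ν-edge {u} {v} u≢v rewrite dec-false (u ≟ v) u≢v = refl

  δ-loop : ∀ (u : V) → δ⟨ u ≟ u ⟩ ≈ 1#
  δ-loop u rewrite dec-true (u ≟ u) ≡.refl = refl

  δ-edge : ∀ {u v : V} → u ≢ v → δ⟨ u ≟ v ⟩ ≈ 0#
  δ-edge {u} {v} u≢v rewrite dec-false (u ≟ v) u≢v = refl

  f-loop : ∀ u → f u u ≈ 1# + t * υ̂ u u
  f-loop u rewrite dec-true (u ≟ u) ≡.refl = refl

  f-edge : ∀ {u v} → u ≢ v → f u v ≈ 1# - t ^ 2 * υ̂ u v * υ̂ v u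
  f-edge {u} {v} u≢v rewrite dec-false (u ≟ v) u≢v = refl

  β-loop : ∀ u → β u u ≈ 0#
  β-loop u = trans (*-congʳ (ν-loop u)) (zeroˡ _)

  β-edge : ∀ {u v} → u ≢ v → β u v ≈ t * υ̂ v u * α u v
  β-edge u≢v = trans (*-congʳ (ν-edge u≢v)) (*-identityˡ _)

  f-sym : ∀ u v → f u v ≈ f v u
  f-sym u v = case u ≟ v of λ where
    (yes ≡.refl) → refl
    (no  u≢v)    → begin
      f u v                           ≈⟨ f-edge u≢v ⟩
      1# - t ^ 2 * υ̂ u v * υ̂ v u
        ≈⟨ +-congˡ (-‿cong (trans (*-assoc _ _ _) (trans (*-congˡ (*-comm _ _)) (sym (*-assoc _ _ _))))) ⟩
      1# - t ^ 2 * υ̂ v u * υ̂ u v     ≈⟨ f-edge (u≢v ∘ ≡.sym) ⟨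
      f v u                           ∎

  module Inverses (ff⁻¹≈1 : ∀ u v → f u v * f⁻¹ u v ≈ 1#)
    (υ̂-sum : ∀ u v → υ̂ u v ≈ ∑[ 𝒜⟨ u , v ⟩? ] υ) where

    -- `f⁻¹` is an arbitrary family of inverses here, so its symmetry comes from that of `f` and the
    -- uniqueness of inverses.
    f⁻¹-sym : ∀ u v → f⁻¹ u v ≈ f⁻¹ v u
    f⁻¹-sym u v = begin
      f⁻¹ u v                        ≈⟨ *-identityʳ _ ⟨
      f⁻¹ u v * 1#                   ≈⟨ *-congˡ (ff⁻¹≈1 v u) ⟨
      f⁻¹ u v * (f v u * f⁻¹ v u)    ≈⟨ *-congˡ (*-congʳ (f-sym u v)) ⟨
      f⁻¹ u v * (f u v * f⁻¹ v u)
        ≈⟨ solve 3 (λ x y z → x :* (y :* z) := y :* x :* z) refl (f⁻¹ u v) (f u v) (f⁻¹ v u) ⟩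
      f u v * f⁻¹ u v * f⁻¹ v u      ≈⟨ *-congʳ (ff⁻¹≈1 u v) ⟩
      1# * f⁻¹ v u                   ≈⟨ *-identityˡ _ ⟩
      f⁻¹ v u                        ∎

    loop-inverse : ∀ u → (1# + t * υ̂ u u) * f⁻¹ u u ≈ 1#
    loop-inverse u = trans (*-congʳ (sym (f-loop u))) (ff⁻¹≈1 u u)

    edge-inverse : ∀ {u v} → u ≢ v → (1# - t ^ 2 * υ̂ u v * υ̂ v u) * f⁻¹ u v ≈ 1#
    edge-inverse u≢v = trans (*-congʳ (sym (f-edge u≢v))) (ff⁻¹≈1 _ _)

    α-sym : ∀ u v → α u v ≈ α v u
    α-sym u v = *-congˡ (f⁻¹-sym u v)

    β-swap : ∀ u v → β u v * υ̂ u v ≈ β v u * υ̂ v u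
    β-swap u v = case u ≟ v of λ where
      (yes ≡.refl) → refl
      (no  u≢v)    → begin
        β u v * υ̂ u v                     ≈⟨ *-congʳ (β-edge u≢v) ⟩
        t * υ̂ v u * α u v * υ̂ u v         ≈⟨ *-congʳ (*-congˡ (α-sym u v)) ⟩
        t * υ̂ v u * α v u * υ̂ u v
          ≈⟨ solve 4 (λ t x y z → t :* x :* y :* z := t :* z :* y :* x) refl t (υ̂ v u) (α v u) (υ̂ u v) ⟩
        t * υ̂ u v * α v u * υ̂ v u         ≈⟨ *-congʳ (β-edge (u≢v ∘ ≡.sym)) ⟨
        β v u * υ̂ v u                     ∎

    -- The equation E + EJ = J on one entry, with `x` and `y` standing for the indicators of inverse
    -- and parallel arcs. Off the diagonal the terms in `y` cancel and those in `x` carry (1 - t² υ̂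
    -- υ̂) f⁻¹ = 1. On the diagonal x = y, and the factor is (1 + t υ̂) f⁻¹ = 1.
    α-β-relation : ∀ u v x y → (u ≡ v → x ≈ y) →
      (α u v * x - β u v * y) + t * (α u v * υ̂ v u * y - β u v * υ̂ u v * x) ≈ t * x
    α-β-relation u v x y x≈y = case u ≟ v of λ where
      (yes ≡.refl) → begin
        (α u u * x - β u u * y) + t * (α u u * υ̂ u u * y - β u u * υ̂ u u * x)
          ≈⟨ +-cong (+-congˡ (-‿cong (*-congʳ (β-loop u))))
               (*-congˡ (+-cong (*-congˡ (sym (x≈y ≡.refl))) (-‿cong (*-congʳ (*-congʳ (β-loop u)))))) ⟩
        (α u u * x - 0# * y) + t * (α u u * υ̂ u u * x - 0# * υ̂ u u * x)
          ≈⟨ solve 5 (λ t i a x y → (t :* i :* x :- :0 :* y) :+ t :* (t :* i :* a :* x :- :0 :* a :* x)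
                                    := (:1 :+ t :* a) :* i :* (t :* x)) refl t (f⁻¹ u u) (υ̂ u u) x y ⟩
        (1# + t * υ̂ u u) * f⁻¹ u u * (t * x)
          ≈⟨ *-congʳ (loop-inverse u) ⟩
        1# * (t * x)
          ≈⟨ *-identityˡ _ ⟩
        t * x ∎
      (no u≢v) → begin
        (α u v * x - β u v * y) + t * (α u v * υ̂ v u * y - β u v * υ̂ u v * x)
          ≈⟨ +-cong (+-congˡ (-‿cong (*-congʳ (β-edge u≢v))))
               (*-congˡ (+-congˡ (-‿cong (*-congʳ (*-congʳ (β-edge u≢v)))))) ⟩
        (α u v * x - t * υ̂ v u * α u v * y) + t * (α u v * υ̂ v u * y - t * υ̂ v u * α u v * υ̂ u v * x)
          ≈⟨ solve 6 (λ t i a b x y →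
               (t :* i :* x :- t :* b :* (t :* i) :* y) :+ t :* (t :* i :* b :* y :- t :* b :* (t :* i) :* a :* x)
               := (:1 :- t :* (t :* :1) :* a :* b) :* i :* (t :* x)) refl t (f⁻¹ u v) (υ̂ u v) (υ̂ v u) x y ⟩
        (1# - t ^ 2 * υ̂ u v * υ̂ v u) * f⁻¹ u v * (t * x)
          ≈⟨ *-congʳ (edge-inverse u≢v) ⟩
        1# * (t * x)
          ≈⟨ *-identityˡ _ ⟩
        t * x ∎

    private
      χ-sym : ∀ {u v : V} b → u ≡ v → χ v u b ≈ χ u v b
      χ-sym b ≡.refl = refl

    sum-class-υ̂ : ∀ u v (g : V → V → Carrier) →
      sum (λ a → χ u v a * (υ a * g (𝔱 a) (𝔥 a))) ≈ υ̂ u v * g u v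
    sum-class-υ̂ u v g = trans (sum-class u v υ g) (*-congʳ (sym (υ̂-sum u v)))

    sum-class-E : ∀ a (g : V → V → Carrier) → sum (λ b → E a b * g (𝔱 b) (𝔥 b)) ≈
      α (𝔱 a) (𝔥 a) * (υ̂ (𝔥 a) (𝔱 a) * g (𝔥 a) (𝔱 a)) - β (𝔱 a) (𝔥 a) * (υ̂ (𝔱 a) (𝔥 a) * g (𝔱 a) (𝔥 a))
    sum-class-E a g = begin
      sum (λ b → E a b * g (𝔱 b) (𝔥 b))
        ≈⟨ sum-+ (λ b → solve 6 (λ υ p q x y g → υ :* (p :* x :- q :* y) :* g
             := p :* (x :* (υ :* g)) :+ (:- q) :* (y :* (υ :* g))) refl
             (υ b) (α u v) (β u v) (χ v u b) (χ u v b) (g (𝔱 b) (𝔥 b))) ⟩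
      sum (λ b → α u v * (χ v u b * (υ b * g (𝔱 b) (𝔥 b)))) + sum (λ b → (- β u v) * (χ u v b * (υ b * g (𝔱 b) (𝔥 b))))
        ≈⟨ +-cong (*-distribˡ-sum (α u v) (λ b → χ v u b * (υ b * g (𝔱 b) (𝔥 b))))
                  (*-distribˡ-sum (- β u v) (λ b → χ u v b * (υ b * g (𝔱 b) (𝔥 b)))) ⟨
      α u v * sum (λ b → χ v u b * (υ b * g (𝔱 b) (𝔥 b))) + (- β u v) * sum (λ b → χ u v b * (υ b * g (𝔱 b) (𝔥 b)))
        ≈⟨ +-cong (*-congˡ (sum-class-υ̂ v u g)) (*-congˡ (sum-class-υ̂ u v g)) ⟩
      α u v * (υ̂ v u * g v u) + (- β u v) * (υ̂ u v * g u v)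
        ≈⟨ +-congˡ (sym (-‿distribˡ-* _ _)) ⟩
      α u v * (υ̂ v u * g v u) - β u v * (υ̂ u v * g u v) ∎
      where
      u v : V
      u = 𝔱 a
      v = 𝔥 a

    E+EJ≈J : E ⊞ E ⊡ J ≈ᴹ J
    E+EJ≈J a b = begin
      E a b + (E ⊡ J) a b
        ≈⟨ +-congˡ (sum-class-E a (λ p q → t * (χ q p b * υ b))) ⟩
      υ b * (α u v * x - β u v * y) + (α u v * (υ̂ v u * (t * (y * υ b))) - β u v * (υ̂ u v * (t * (x * υ b))))
        ≈⟨ solve 8 (λ t υ p q a c x y →
             υ :* (p :* x :- q :* y) :+ (p :* (c :* (t :* (y :* υ))) :- q :* (a :* (t :* (x :* υ))))
             := υ :* ((p :* x :- q :* y) :+ t :* (p :* c :* y :- q :* a :* x))) refl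
             t (υ b) (α u v) (β u v) (υ̂ u v) (υ̂ v u) x y ⟩
      υ b * ((α u v * x - β u v * y) + t * (α u v * υ̂ v u * y - β u v * υ̂ u v * x))
        ≈⟨ *-congˡ (α-β-relation u v x y (χ-sym b)) ⟩
      υ b * (t * x)
        ≈⟨ solve 3 (λ υ t x → υ :* (t :* x) := t :* (x :* υ)) refl (υ b) t x ⟩
      J a b ∎
      where
      u v : V
      u = 𝔱 a
      v = 𝔥 a
      x y : Carrier
      x = χ v u b
      y = χ u v b

    E+JE≈J : E ⊞ J ⊡ E ≈ᴹ J
    E+JE≈J a b = begin
      E a b + (J ⊡ E) a b
        ≈⟨ +-congˡ (sum-*ˡ t λ c → solve 4 (λ t χ υ e → t :* (χ :* υ) :* e := t :* (χ :* (υ :* e))) refl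
             t (χ v u c) (υ c) (E c b)) ⟩
      E a b + t * sum (λ c → χ v u c * (υ c * E c b))
        ≈⟨ +-congˡ (*-congˡ (sum-class-υ̂ v u λ p q → υ b * (α p q * χ q p b - β p q * χ p q b))) ⟩
      υ b * (α u v * x - β u v * y) + t * (υ̂ v u * (υ b * (α v u * y - β v u * x)))
        ≈⟨ solve 9 (λ t υ p q a x y p′ q′ →
             υ :* (p :* x :- q :* y) :+ t :* (a :* (υ :* (p′ :* y :- q′ :* x)))
             := υ :* ((p :* x :- q :* y) :+ t :* (p′ :* a :* y :- q′ :* a :* x))) refl
             t (υ b) (α u v) (β u v) (υ̂ v u) x y (α v u) (β v u) ⟩
      υ b * ((α u v * x - β u v * y) + t * (α v u * υ̂ v u * y - β v u * υ̂ v u * x))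
        -- In J E the coefficients are read at the reversed pair (v , u). Symmetry of `α` and of `β`
        -- times υ̂ returns them to (u , v), where the relation for E J applies.
        ≈⟨ *-congˡ (+-congˡ (*-congˡ (+-cong (*-congʳ (*-congʳ (α-sym v u))) (-‿cong (*-congʳ (β-swap v u)))))) ⟩
      υ b * ((α u v * x - β u v * y) + t * (α u v * υ̂ v u * y - β u v * υ̂ u v * x))
        ≈⟨ *-congˡ (α-β-relation u v x y (χ-sym b)) ⟩
      υ b * (t * x)
        ≈⟨ solve 3 (λ υ t x → υ :* (t :* x) := t :* (x :* υ)) refl (υ b) t x ⟩
      J a b ∎
      where
      u v : V
      u = 𝔱 a
      v = 𝔥 a
      x y : Carrier
      x = χ v u b
      y = χ u v b

    P Q : Mat #𝒜 #𝒜
    P = I ⊞ J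
    Q = I ⊞ ⊟ E

    PQ≈I : P ⊡ Q ≈ᴹ I
    PQ≈I a b = begin
      (P ⊡ Q) a b
        ≈⟨ ⊡-distribʳ Q I J a b ⟩
      (I ⊡ Q) a b + (J ⊡ Q) a b
        ≈⟨ +-cong (⊡-identityˡ Q a b) (⊡-distribˡ J I (⊟ E) a b) ⟩
      (I a b - E a b) + ((J ⊡ I) a b + (J ⊡ ⊟ E) a b)
        ≈⟨ +-congˡ (+-cong (⊡-identityʳ J a b)
             (trans (sum-cong-≋ λ c → sym (-‿distribʳ-* (J a c) (E c b))) (sum-neg λ c → J a c * E c b))) ⟩
      (I a b - E a b) + (J a b - (J ⊡ E) a b)
        ≈⟨ +-congˡ (+-congʳ (E+JE≈J a b)) ⟨
      (I a b - E a b) + ((E a b + (J ⊡ E) a b) - (J ⊡ E) a b)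
        ≈⟨ solve 3 (λ i e x → (i :- e) :+ ((e :+ x) :- x) := i) refl (I a b) (E a b) ((J ⊡ E) a b) ⟩
      I a b ∎

    -- It serves twice: it gives Q P = I, and because ∂P = J it identifies tr(Q ∂P) with tr E.
    QJ≈E : Q ⊡ J ≈ᴹ E
    QJ≈E a b = begin
      (Q ⊡ J) a b
        ≈⟨ ⊡-distribʳ J I (⊟ E) a b ⟩
      (I ⊡ J) a b + (⊟ E ⊡ J) a b
        ≈⟨ +-cong (⊡-identityˡ J a b)
             (trans (sum-cong-≋ λ c → sym (-‿distribˡ-* (E a c) (J c b))) (sum-neg λ c → E a c * J c b)) ⟩
      J a b - (E ⊡ J) a b
        ≈⟨ +-congʳ (E+EJ≈J a b) ⟨
      (E a b + (E ⊡ J) a b) - (E ⊡ J) a b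
        ≈⟨ solve 2 (λ e x → (e :+ x) :- x := e) refl (E a b) ((E ⊡ J) a b) ⟩
      E a b ∎

    QP≈I : Q ⊡ P ≈ᴹ I
    QP≈I a b = begin
      (Q ⊡ P) a b                   ≈⟨ ⊡-distribˡ Q I J a b ⟩
      (Q ⊡ I) a b + (Q ⊡ J) a b     ≈⟨ +-cong (⊡-identityʳ Q a b) (QJ≈E a b) ⟩
      (I a b - E a b) + E a b       ≈⟨ solve 2 (λ i e → (i :- e) :+ e := i) refl (I a b) (E a b) ⟩
      I a b                         ∎

    QK : ∀ a w → (Q ⊡ K) a w ≈ K a w -
      (α (𝔱 a) (𝔥 a) * (υ̂ (𝔥 a) (𝔱 a) * - (t * δ⟨ 𝔱 a ≟ w ⟩)) -
       β (𝔱 a) (𝔥 a) * (υ̂ (𝔱 a) (𝔥 a) * - (t * δ⟨ 𝔥 a ≟ w ⟩)))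
    QK a w = begin
      (Q ⊡ K) a w
        ≈⟨ ⊡-distribʳ K I (⊟ E) a w ⟩
      (I ⊡ K) a w + (⊟ E ⊡ K) a w
        ≈⟨ +-cong (⊡-identityˡ K a w)
             (trans (sum-cong-≋ λ b → sym (-‿distribˡ-* (E a b) (K b w))) (sum-neg λ b → E a b * K b w)) ⟩
      K a w - (E ⊡ K) a w
        ≈⟨ +-congˡ (-‿cong (sum-class-E a λ _ v → - (t * δ⟨ v ≟ w ⟩))) ⟩
      _ ∎

    module _ (τ̂-sum : ∀ u v → τ̂ u v ≈ ∑[ 𝒜⟨ u , v ⟩? ] τ) where
      -- An arc from w to v contributes in two ways. Its `edge` part ends in v and so forces v = w′;
      -- its `returning` part comes back to w along an inverse arc and so forces w = w′. The former
      -- yields the entries of A, the latter those of D together with a loop term.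
      LQK : ∀ w w′ → (L ⊡ (Q ⊡ K)) w w′ ≈ - (t * (f⁻¹ w w′ * τ̂ w w′)) + t ^ 2 * (δ⟨ w ≟ w′ ⟩ * N w)
      LQK w w′ = begin
        (L ⊡ (Q ⊡ K)) w w′
          ≈⟨ sum-cong-≋ (λ a → trans (*-assoc _ _ _) (*-congˡ (*-congˡ (QK a w′)))) ⟩
        sum (λ a → δ⟨ 𝔱 a ≟ w ⟩ * (τ a * g (𝔱 a) (𝔥 a)))
          ≈⟨ sum-tail w τ g ⟩
        sum (λ v → ∑[ 𝒜⟨ w , v ⟩? ] τ * g w v)
          ≈⟨ sum-+ (λ v → begin
               ∑[ 𝒜⟨ w , v ⟩? ] τ * g w v    ≈⟨ *-congʳ (τ̂-sum w v) ⟨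
               τ̂ w v * g w v
                 ≈⟨ solve 8 (λ t x p q a b d e →
                      x :* (:- (t :* d) :- (p :* (b :* :- (t :* e)) :- q :* (a :* :- (t :* d))))
                      := d :* (:- (t :* x :* (:1 :+ q :* a))) :+ t :* e :* (x :* (p :* b))) refl
                      t (τ̂ w v) (α w v) (β w v) (υ̂ w v) (υ̂ v w) δ⟨ v ≟ w′ ⟩ δ⟨ w ≟ w′ ⟩ ⟩
               δ⟨ v ≟ w′ ⟩ * edge v + t * δ⟨ w ≟ w′ ⟩ * returning v
                 ≈⟨ +-congʳ (*-congʳ (δ-sym v w′)) ⟩
               δ⟨ w′ ≟ v ⟩ * edge v + t * δ⟨ w ≟ w′ ⟩ * returning v ∎) ⟩
        sum (λ v → δ⟨ w′ ≟ v ⟩ * edge v) + sum (λ v → t * δ⟨ w ≟ w′ ⟩ * returning v)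
          ≈⟨ +-cong (sum-δ w′ edge) (sym (*-distribˡ-sum (t * δ⟨ w ≟ w′ ⟩) returning)) ⟩
        edge w′ + t * δ⟨ w ≟ w′ ⟩ * sum returning
          ≈⟨ +-congˡ (*-congˡ returning-sum) ⟩
        edge w′ + t * δ⟨ w ≟ w′ ⟩ * (t * (N w + f⁻¹ w w * (τ̂ w w * υ̂ w w)))
          ≈⟨ collect ⟩
        - (t * (f⁻¹ w w′ * τ̂ w w′)) + t ^ 2 * (δ⟨ w ≟ w′ ⟩ * N w) ∎
        where
        g : V → V → Carrier
        g u v = - (t * δ⟨ v ≟ w′ ⟩) -
          (α u v * (υ̂ v u * - (t * δ⟨ u ≟ w′ ⟩)) - β u v * (υ̂ u v * - (t * δ⟨ v ≟ w′ ⟩)))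

        edge returning nonloop : V → Carrier
        edge v = - (t * τ̂ w v * (1# + β w v * υ̂ w v))
        returning v = τ̂ w v * (α w v * υ̂ v w)
        nonloop v = f⁻¹ w v * (τ̂ w v * υ̂ v w)

        ν+δ : ∀ v → ν w v + δ⟨ w ≟ v ⟩ ≈ 1#
        ν+δ v with does (w ≟ v)
        ... | true  = +-identityˡ 1#
        ... | false = +-identityʳ 1#

        returning-sum : sum returning ≈ t * (N w + f⁻¹ w w * (τ̂ w w * υ̂ w w))
        returning-sum = begin
          sum returning
            ≈⟨ sum-*ˡ t (λ v → solve 4 (λ t i x b → x :* (t :* i :* b) := t :* (i :* (x :* b))) refl
                 t (f⁻¹ w v) (τ̂ w v) (υ̂ v w)) ⟩
          t * sum nonloop
            ≈⟨ *-congˡ (sum-+ λ v → trans (sym (*-identityˡ _))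
                 (trans (*-congʳ (sym (ν+δ v))) (distribʳ (nonloop v) (ν w v) δ⟨ w ≟ v ⟩))) ⟩
          t * (N w + sum (λ v → δ⟨ w ≟ v ⟩ * nonloop v))
            ≈⟨ *-congˡ (+-congˡ (sum-δ w nonloop)) ⟩
          t * (N w + nonloop w) ∎

        collect : edge w′ + t * δ⟨ w ≟ w′ ⟩ * (t * (N w + f⁻¹ w w * (τ̂ w w * υ̂ w w))) ≈
                  - (t * (f⁻¹ w w′ * τ̂ w w′)) + t ^ 2 * (δ⟨ w ≟ w′ ⟩ * N w)
        collect = case w ≟ w′ of λ where
          (yes ≡.refl) → begin
            edge w + t * δ⟨ w ≟ w ⟩ * (t * (N w + f⁻¹ w w * (τ̂ w w * υ̂ w w)))
              -- Writing 1 as (1 + t υ̂) f⁻¹ in the edge term brings out f⁻¹; the surplus -t² f⁻¹ τ̂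
              -- υ̂ is cancelled by the loop contained in the sum of `returning`.
              ≈⟨ +-cong (-‿cong (*-cong (trans (*-congˡ (sym (*-identityˡ _))) (*-congˡ (*-congʳ (sym (loop-inverse w)))))
                   (+-congˡ (*-congʳ (β-loop w))))) (*-congʳ (*-congˡ (δ-loop w))) ⟩
            - (t * ((1# + t * υ̂ w w) * f⁻¹ w w * τ̂ w w) * (1# + 0# * υ̂ w w)) +
              t * 1# * (t * (N w + f⁻¹ w w * (τ̂ w w * υ̂ w w)))
              ≈⟨ solve 5 (λ t i x a n →
                   :- (t :* ((:1 :+ t :* a) :* i :* x) :* (:1 :+ :0 :* a)) :+ t :* :1 :* (t :* (n :+ i :* (x :* a)))
                   := :- (t :* (i :* x)) :+ t :* (t :* :1) :* (:1 :* n)) refl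
                   t (f⁻¹ w w) (τ̂ w w) (υ̂ w w) (N w) ⟩
            - (t * (f⁻¹ w w * τ̂ w w)) + t ^ 2 * (1# * N w)
              ≈⟨ +-congˡ (*-congˡ (*-congʳ (δ-loop w))) ⟨
            - (t * (f⁻¹ w w * τ̂ w w)) + t ^ 2 * (δ⟨ w ≟ w ⟩ * N w) ∎
          (no w≢w′) → begin
            edge w′ + t * δ⟨ w ≟ w′ ⟩ * (t * (N w + f⁻¹ w w * (τ̂ w w * υ̂ w w)))
              -- Writing 1 as (1 - t² υ̂ υ̂) f⁻¹ shows that 1 + β υ̂ equals f⁻¹.
              ≈⟨ +-cong (-‿cong (*-congˡ (+-cong (sym (edge-inverse w≢w′)) (*-congʳ (β-edge w≢w′)))))
                   (*-congʳ (*-congˡ (δ-edge w≢w′))) ⟩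
            - (t * τ̂ w w′ * ((1# - t ^ 2 * υ̂ w w′ * υ̂ w′ w) * f⁻¹ w w′ + t * υ̂ w′ w * α w w′ * υ̂ w w′)) +
              t * 0# * (t * (N w + f⁻¹ w w * (τ̂ w w * υ̂ w w)))
              ≈⟨ solve 7 (λ t i x a b n m →
                   :- (t :* x :* ((:1 :- t :* (t :* :1) :* a :* b) :* i :+ t :* b :* (t :* i) :* a)) :+ t :* :0 :* (t :* (n :+ m))
                   := :- (t :* (i :* x)) :+ t :* (t :* :1) :* (:0 :* n)) refl
                   t (f⁻¹ w w′) (τ̂ w w′) (υ̂ w w′) (υ̂ w′ w) (N w) (f⁻¹ w w * (τ̂ w w * υ̂ w w)) ⟩
            - (t * (f⁻¹ w w′ * τ̂ w w′)) + t ^ 2 * (0# * N w)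
              ≈⟨ +-congˡ (*-congˡ (*-congʳ (δ-edge w≢w′))) ⟨
            - (t * (f⁻¹ w w′ * τ̂ w w′)) + t ^ 2 * (δ⟨ w ≟ w′ ⟩ * N w) ∎

    -- The contribution of the pair (u , v) to the trace of E.
    h : V → V → Carrier
    h u v = υ̂ u v * (α u v * δ⟨ u ≟ v ×-dec v ≟ u ⟩ - β u v * δ⟨ u ≟ u ×-dec v ≟ v ⟩)

    h-loop : ∀ u → h u u ≈ υ̂ u u * α u u
    h-loop u = *-congˡ (begin
      α u u * δ⟨ u ≟ u ×-dec u ≟ u ⟩ - β u u * δ⟨ u ≟ u ×-dec u ≟ u ⟩
        ≈⟨ +-cong (*-congˡ (trans (δ-× (u ≟ u) (u ≟ u)) (*-cong (δ-loop u) (δ-loop u))))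
                  (-‿cong (*-congʳ (β-loop u))) ⟩
      α u u * (1# * 1#) - 0# * δ⟨ u ≟ u ×-dec u ≟ u ⟩
        ≈⟨ solve 2 (λ a d → a :* (:1 :* :1) :- :0 :* d := a) refl (α u u) δ⟨ u ≟ u ×-dec u ≟ u ⟩ ⟩
      α u u ∎)

    h-edge : ∀ {u v} → u ≢ v → h u v ≈ - (υ̂ u v * (t * υ̂ v u * α u v))
    h-edge {u} {v} u≢v = trans (*-congˡ (begin
      α u v * δ⟨ u ≟ v ×-dec v ≟ u ⟩ - β u v * δ⟨ u ≟ u ×-dec v ≟ v ⟩
        ≈⟨ +-cong (*-congˡ (trans (δ-× (u ≟ v) (v ≟ u)) (*-congʳ (δ-edge u≢v))))
             (-‿cong (*-cong (β-edge u≢v) (trans (δ-× (u ≟ u) (v ≟ v)) (*-cong (δ-loop u) (δ-loop v))))) ⟩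
      α u v * (0# * δ⟨ v ≟ u ⟩) - t * υ̂ v u * α u v * (1# * 1#)
        ≈⟨ solve 3 (λ a d b → a :* (:0 :* d) :- b :* (:1 :* :1) := :- b) refl
             (α u v) δ⟨ v ≟ u ⟩ (t * υ̂ v u * α u v) ⟩
      - (t * υ̂ v u * α u v) ∎)) (sym (-‿distribʳ-* _ _))

    -- Apart from υ a, the entry `E a a` depends only on the end points of a. The conjunctions of
    -- decisions in `h` are the indicators χ evaluated at a itself.
    tr-E : tr E ≈ sum (λ u → sum (h u))
    tr-E = trans (sum-arcs υ g) (sum-cong-≋ λ u → sum-cong-≋ λ v → *-congʳ (sym (υ̂-sum u v)))
      where
      g : V → V → Carrier
      g u v = α u v * δ⟨ u ≟ v ×-dec v ≟ u ⟩ - β u v * δ⟨ u ≟ u ×-dec v ≟ v ⟩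

    module Constants (∂t≈t : ∂ t ≈ t) (∂τ≈0 : ∀ a → ∂ (τ a) ≈ 0#) (∂υ≈0 : ∀ a → ∂ (υ a) ≈ 0#) where

      ∂-δ : ∀ {p} {P : Set p} (P? : Dec P) → ∂ δ⟨ P? ⟩ ≈ 0#
      ∂-δ (yes _) = ∂-1#
      ∂-δ (no  _) = ∂-0#

      ∂L≈0 : ∀ v a → ∂ (L v a) ≈ 0#
      ∂L≈0 v a = trans (∂-scale _ _ (∂-δ (𝔱 a ≟ v))) (trans (*-congˡ (∂τ≈0 a)) (zeroʳ _))

      -- A constant times t is fixed by ∂. Together with the Leibniz rule this is how the degree in
      -- t is tracked in the abstract ring.
      ∂-t* : ∀ x → ∂ x ≈ 0# → ∂ (t * x) ≈ t * x
      ∂-t* x ∂x≈0 = trans (∂-* t x) (trans (+-cong (*-congʳ ∂t≈t) (trans (*-congˡ ∂x≈0) (zeroʳ t))) (+-identityʳ _))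

      ∂J≈J : ∀ a b → ∂ (J a b) ≈ J a b
      ∂J≈J a b = ∂-t* _ (trans (∂-scale _ _ (∂-δ (𝒜⟨ 𝔥 a , 𝔱 a ⟩? b))) (trans (*-congˡ (∂υ≈0 b)) (zeroʳ _)))

      ∂υ̂≈0 : ∀ u v → ∂ (υ̂ u v) ≈ 0#
      ∂υ̂≈0 u v = trans (∂-cong (υ̂-sum u v)) (trans (∂-sum λ a → if does (𝒜⟨ u , v ⟩? a) then υ a else 0#)
        (sum-zero (λ a → ∂ (if does (𝒜⟨ u , v ⟩? a) then υ a else 0#)) λ a → ∂-if (does (𝒜⟨ u , v ⟩? a)) (∂υ≈0 a)))
        where
        ∂-if : ∀ b {x} → ∂ x ≈ 0# → ∂ (if b then x else 0#) ≈ 0#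
        ∂-if true  ∂x≈0 = ∂x≈0
        ∂-if false _    = ∂-0#

      tr-Q∂P : tr (Q ⊡ (λ a b → ∂ (P a b))) ≈ tr E
      tr-Q∂P = tr-cong λ a b → trans (⊡-congˡ Q ∂P≈J a b) (QJ≈E a b)
        where
        ∂P≈J : ∀ a b → ∂ (P a b) ≈ J a b
        ∂P≈J a b = trans (∂-+ _ _) (trans (+-cong (∂-I a b) (∂J≈J a b)) (+-identityˡ _))

      ∂f-loop : ∀ u → ∂ (f u u) ≈ f u u * h u u
      ∂f-loop u = begin
        ∂ (f u u)                                  ≈⟨ ∂-cong (f-loop u) ⟩
        ∂ (1# + t * υ̂ u u)                         ≈⟨ ∂-+ _ _ ⟩
        ∂ 1# + ∂ (t * υ̂ u u)                       ≈⟨ +-cong ∂-1# (∂-t* _ (∂υ̂≈0 u u)) ⟩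
        0# + t * υ̂ u u                             ≈⟨ +-congˡ (*-identityˡ _) ⟨
        0# + 1# * (t * υ̂ u u)                      ≈⟨ +-congˡ (*-congʳ (ff⁻¹≈1 u u)) ⟨
        0# + f u u * f⁻¹ u u * (t * υ̂ u u)
          ≈⟨ solve 4 (λ f i t a → :0 :+ f :* i :* (t :* a) := f :* (a :* (t :* i))) refl (f u u) (f⁻¹ u u) t (υ̂ u u) ⟩
        f u u * (υ̂ u u * α u u)                    ≈⟨ *-congˡ (h-loop u) ⟨
        f u u * h u u                              ∎

      ∂f-edge : ∀ {u v} → u ≢ v → ∂ (f u v) ≈ f u v * (h u v + h v u)
      ∂f-edge {u} {v} u≢v = begin
        ∂ (f u v)
          ≈⟨ ∂-cong (f-edge u≢v) ⟩
        ∂ (1# - t ^ 2 * υ̂ u v * υ̂ v u)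
          -- Splitting t² between the two factors makes each of them fixed by ∂. The Leibniz rule
          -- then produces two equal terms, one for each orientation of the pair.
          ≈⟨ ∂-cong (solve 3 (λ t a b → :1 :- t :* (t :* :1) :* a :* b := :1 :- t :* a :* (t :* b)) refl
               t (υ̂ u v) (υ̂ v u)) ⟩
        ∂ (1# - t * υ̂ u v * (t * υ̂ v u))
          ≈⟨ trans (∂-+ _ _) (+-cong ∂-1# (trans (∂-neg _) (-‿cong (trans (∂-* _ _)
               (+-cong (*-congʳ (∂-t* _ (∂υ̂≈0 u v))) (*-congˡ (∂-t* _ (∂υ̂≈0 v u)))))))) ⟩
        0# - (t * υ̂ u v * (t * υ̂ v u) + t * υ̂ u v * (t * υ̂ v u))
          ≈⟨ +-congˡ (-‿cong (*-identityˡ _)) ⟨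
        0# - 1# * (t * υ̂ u v * (t * υ̂ v u) + t * υ̂ u v * (t * υ̂ v u))
          ≈⟨ +-congˡ (-‿cong (*-congʳ (ff⁻¹≈1 u v))) ⟨
        0# - f u v * f⁻¹ u v * (t * υ̂ u v * (t * υ̂ v u) + t * υ̂ u v * (t * υ̂ v u))
          ≈⟨ solve 5 (λ f i t a b →
               :0 :- f :* i :* (t :* a :* (t :* b) :+ t :* a :* (t :* b))
               := f :* ((:- (a :* (t :* b :* (t :* i)))) :+ (:- (b :* (t :* a :* (t :* i))))))
               refl (f u v) (f⁻¹ u v) t (υ̂ u v) (υ̂ v u) ⟩
        f u v * (- (υ̂ u v * (t * υ̂ v u * α u v)) - υ̂ v u * (t * υ̂ u v * α u v))
          ≈⟨ *-congˡ (+-cong (sym (h-edge u≢v)) (trans (-‿cong (*-congˡ (*-congˡ (α-sym u v))))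
               (sym (h-edge (u≢v ∘ ≡.sym))))) ⟩
        f u v * (h u v + h v u) ∎

-- The logarithmic derivative of the right-hand side

module CycleIdentity {c ℓ ℓ′} (S : CommutativeRing c ℓ) (derivation : Derivation S) (Δ : Digraph)
  {_≤_ : Rel (Digraph.V Δ) ℓ′} (≤-isTotalOrder : IsTotalOrder _≡_ _≤_)
  (_≤?_ : B.Decidable _≤_)
  (Φ? : B.Decidable λ u v → u ≤ v × Adjacent Δ u v)
  (Φ⁽³⁾? : B.Decidable λ u v → (u ≤ v × Adjacent Δ u v) ×
    u ≢ v × ∃ (Digraph.𝒜⟨_,_⟩ Δ u v) × ∃ (Digraph.𝒜⟨_,_⟩ Δ v u))
  (t : CommutativeRing.Carrier S) (τ υ : Digraph.𝒜 Δ → CommutativeRing.Carrier S)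
  (τ̂ υ̂ d̂ f⁻¹ : Digraph.V Δ → Digraph.V Δ → CommutativeRing.Carrier S) where
  open Digraph Δ using (V; 𝒜; #V; #𝒜; 𝔱; 𝔥; 𝒜⟨_,_⟩; 𝒜⟨_,_⟩?; S?)
  open CommutativeRing S hiding (zero)
  open FiniteAlgebra rawRing
  open RingProperties ring
  open Summation S
  open Derivation derivation
  open Matrices S
  open Determinant S using (det-cong)
  open LogarithmicDerivative S derivation
  open ArcSums S Δ
  open VertexPairs S Δ ≤-isTotalOrder _≤?_ Φ?
  open WeightedDigraph S derivation Δ t τ υ τ̂ υ̂ f⁻¹
  open IntegerSolver S using (solve; _:=_; _:+_; _:*_; _:-_; :-_; :1)
  open SetoidReasoning setoid

  fΔ : Carrier
  fΔ = product λ u → ∏[ Φ? u ] λ v → f u v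

  A D : Matrix #V
  A w w′ = f⁻¹ w w′ * τ̂ w w′
  D w w′ = δ⟨ w ≟ w′ ⟩ * sum λ u → ∑[ Φ⁽³⁾? u ] λ v →
    f⁻¹ u v * (δ⟨ w ≟ u ⟩ * d̂ u v + δ⟨ w ≟ v ⟩ * d̂ v u)

  module _ (ff⁻¹≈1 : ∀ u v → f u v * f⁻¹ u v ≈ 1#)
    (τ̂-sum : ∀ u v → τ̂ u v ≈ ∑[ 𝒜⟨ u , v ⟩? ] τ)
    (υ̂-sum : ∀ u v → υ̂ u v ≈ ∑[ 𝒜⟨ u , v ⟩? ] υ)
    (d̂-product : ∀ u v → d̂ u v ≈ τ̂ u v * υ̂ v u)
    (∂t≈t : ∂ t ≈ t) (∂τ≈0 : ∀ a → ∂ (τ a) ≈ 0#) (∂υ≈0 : ∀ a → ∂ (υ a) ≈ 0#)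
    (θ W : Matrix #𝒜) (∂θ≈0 : ∀ a b → ∂ (θ a b) ≈ 0#)
    (θ≈ : ∀ a b → θ a b ≈ τ b * δ⟨ 𝔥 a ≟ 𝔱 b ⟩ - υ b * δ⟨ S? a b ⟩)
    (I-tθ⊡W≈I : (I -ᴹ t ·ᴹ θ) ⊡ W ≈ᴹ I) (W⊡I-tθ≈I : W ⊡ (I -ᴹ t ·ᴹ θ) ≈ᴹ I) where

    open Inverses ff⁻¹≈1 υ̂-sum
    open Constants ∂t≈t ∂τ≈0 ∂υ≈0

    υ̂-empty : ∀ {u v} → ¬ ∃ 𝒜⟨ u , v ⟩ → υ̂ u v ≈ 0#
    υ̂-empty {u} {v} ∄arc = trans (υ̂-sum u v) (∑-empty 𝒜⟨ u , v ⟩? υ ∄arc)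

    d̂-empty : ∀ {u v} → ¬ (∃ 𝒜⟨ u , v ⟩ × ∃ 𝒜⟨ v , u ⟩) → d̂ u v ≈ 0#
    d̂-empty {u} {v} ¬both = trans (d̂-product u v) (case any? 𝒜⟨ u , v ⟩? of λ where
      (no  ∄uv) → trans (*-congʳ (trans (τ̂-sum u v) (∑-empty 𝒜⟨ u , v ⟩? τ ∄uv))) (zeroˡ _)
      (yes ∃uv) → trans (*-congˡ (υ̂-empty λ ∃vu → ¬both (∃uv , ∃vu))) (zeroʳ _))

    -- The summand `k` vanishes on loops and unless arcs run in both directions, so Φ⁽³⁾ may be
    -- enlarged to Φ. Then `sum-Φ`, read backwards, releases the order, and the delta selects u = w.
    D≈N : ∀ w w′ → D w w′ ≈ δ⟨ w ≟ w′ ⟩ * N w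
    D≈N w w′ = *-congˡ (begin
      sum (λ u → ∑[ Φ⁽³⁾? u ] λ v → f⁻¹ u v * (δ⟨ w ≟ u ⟩ * d̂ u v + δ⟨ w ≟ v ⟩ * d̂ v u))
        ≈⟨ sum-cong-≋ (λ u → sum-cong-≋ λ v → compare u v (Φ⁽³⁾? u v) (Φ? u v) (u ≟ v)) ⟩
      sum (λ u → ∑[ Φ? u ] (symmetrized k u))
        ≈⟨ sum-Φ k k-support ⟨
      sum (λ u → sum (k u))
        ≈⟨ sum-cong-≋ (λ u → *-distribˡ-sum δ⟨ w ≟ u ⟩ (λ v → ν u v * (f⁻¹ u v * d̂ u v))) ⟨
      sum (λ u → δ⟨ w ≟ u ⟩ * sum (λ v → ν u v * (f⁻¹ u v * d̂ u v)))
        ≈⟨ sum-δ w (λ u → sum (λ v → ν u v * (f⁻¹ u v * d̂ u v))) ⟩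
      sum (λ v → ν w v * (f⁻¹ w v * d̂ w v))
        ≈⟨ sum-cong-≋ (λ v → *-congˡ {ν w v} (*-congˡ {f⁻¹ w v} (d̂-product w v))) ⟩
      N w ∎)
      where
      k : V → V → Carrier
      k u v = δ⟨ w ≟ u ⟩ * (ν u v * (f⁻¹ u v * d̂ u v))

      k-empty : ∀ {u v} → ¬ (∃ 𝒜⟨ u , v ⟩ × ∃ 𝒜⟨ v , u ⟩) → k u v ≈ 0#
      k-empty ¬both = trans (*-congˡ (trans (*-congˡ (trans (*-congˡ (d̂-empty ¬both)) (zeroʳ _))) (zeroʳ _))) (zeroʳ _)

      k-support : ∀ u v → ¬ Adjacent Δ u v → k u v ≈ 0#
      k-support u v ¬adjacent = k-empty λ { ((a , p) , _) → ¬adjacent (a , inj₁ p) }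

      compare : ∀ u v (Φ⁽³⁾? : Dec ((u ≤ v × Adjacent Δ u v) × u ≢ v × ∃ 𝒜⟨ u , v ⟩ × ∃ 𝒜⟨ v , u ⟩))
        (Φ? : Dec (u ≤ v × Adjacent Δ u v)) (u≟v : Dec (u ≡ v)) →
        (if does Φ⁽³⁾? then f⁻¹ u v * (δ⟨ w ≟ u ⟩ * d̂ u v + δ⟨ w ≟ v ⟩ * d̂ v u) else 0#) ≈
        (if does Φ? then (if does u≟v then k u v else k u v + k v u) else 0#)
      compare u v (yes (_ , u≢v , _)) _ (yes u≡v) = contradiction u≡v u≢v
      compare u v (yes (Φuv , _)) (no ¬Φ) _ = contradiction Φuv ¬Φ
      compare u v (yes _) (yes _) (no u≢v) = begin
        f⁻¹ u v * (δ⟨ w ≟ u ⟩ * d̂ u v + δ⟨ w ≟ v ⟩ * d̂ v u)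
          ≈⟨ solve 5 (λ i x d y e → i :* (x :* d :+ y :* e) := x :* (:1 :* (i :* d)) :+ y :* (:1 :* (i :* e))) refl
               (f⁻¹ u v) δ⟨ w ≟ u ⟩ (d̂ u v) δ⟨ w ≟ v ⟩ (d̂ v u) ⟩
        δ⟨ w ≟ u ⟩ * (1# * (f⁻¹ u v * d̂ u v)) + δ⟨ w ≟ v ⟩ * (1# * (f⁻¹ u v * d̂ v u))
          ≈⟨ +-cong (*-congˡ (*-congʳ (sym (ν-edge u≢v))))
               (*-congˡ (*-cong (sym (ν-edge (u≢v ∘ ≡.sym))) (*-congʳ (f⁻¹-sym u v)))) ⟩
        k u v + k v u ∎
      compare u v (no _) (no _) _ = refl
      compare u .u (no _) (yes _) (yes ≡.refl) =
        sym (trans (*-congˡ (trans (*-congʳ (ν-loop u)) (zeroˡ _))) (zeroʳ _))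
      compare u v (no ¬Φ⁽³⁾) (yes Φuv) (no u≢v) = sym (trans
        (+-cong (k-empty λ both → ¬Φ⁽³⁾ (Φuv , u≢v , both))
                (k-empty λ { (vu , uv) → ¬Φ⁽³⁾ (Φuv , u≢v , uv , vu) }))
        (+-identityˡ _))

    -- The logarithmic derivative of `f u v` gathers the contributions `h` of both orientations to
    -- tr E, so the sum over Φ unfolds to the whole trace; factors outside Φ are 1 and contribute 0.
    ∂fΔ : ∂ fΔ ≈ fΔ * tr E
    ∂fΔ = begin
      ∂ fΔ
        ≈⟨ ∂-product _ (λ u → ∑[ Φ? u ] (symmetrized h u)) (λ u → ∂-product _ _ λ v → factor u v (Φ? u v) (u ≟ v) ) ⟩
      fΔ * sum (λ u → ∑[ Φ? u ] (symmetrized h u))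
        ≈⟨ *-congˡ (sum-Φ h h-support) ⟨
      fΔ * sum (λ u → sum (h u))
        ≈⟨ *-congˡ tr-E ⟨
      fΔ * tr E ∎
      where
      h-support : ∀ u v → ¬ Adjacent Δ u v → h u v ≈ 0#
      h-support u v ¬adjacent = trans (*-congʳ (υ̂-empty λ { (a , p) → ¬adjacent (a , inj₁ p) })) (zeroˡ _)

      factor : ∀ u v (Φ? : Dec (u ≤ v × Adjacent Δ u v)) (u≟v : Dec (u ≡ v)) →
        ∂ (if does Φ? then f u v else 1#) ≈
        (if does Φ? then f u v else 1#) * (if does Φ? then (if does u≟v then h u v else h u v + h v u) else 0#)
      factor u v  (no  _) _            = trans ∂-1# (sym (zeroʳ 1#))
      factor u .u (yes _) (yes ≡.refl) = ∂f-loop u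
      factor u v  (yes _) (no u≢v)     = ∂f-edge u≢v

    I-tθ≈P+KL : I -ᴹ t ·ᴹ θ ≈ᴹ P ⊞ K ⊡ L
    I-tθ≈P+KL a b = begin
      I a b - t * θ a b
        ≈⟨ +-congˡ (-‿cong (*-congˡ (trans (θ≈ a b) (+-congʳ (*-congˡ (δ-sym (𝔥 a) (𝔱 b))))))) ⟩
      I a b - t * (τ b * δ⟨ 𝔱 b ≟ 𝔥 a ⟩ - υ b * χ (𝔥 a) (𝔱 a) b)
        ≈⟨ solve 6 (λ i t x d y e → i :- t :* (x :* d :- y :* e) := i :+ t :* (e :* y) :+ :- (t :* (d :* x))) refl
             (I a b) t (τ b) δ⟨ 𝔱 b ≟ 𝔥 a ⟩ (υ b) (χ (𝔥 a) (𝔱 a) b) ⟩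
      I a b + J a b - t * (δ⟨ 𝔱 b ≟ 𝔥 a ⟩ * τ b)
        ≈⟨ +-congˡ (sym (trans
             (sum-cong-≋ λ v → solve 3 (λ t d l → (:- (t :* d)) :* l := d :* :- (t :* l)) refl t δ⟨ 𝔥 a ≟ v ⟩ (L v b))
             (sum-δ (𝔥 a) (λ v → - (t * L v b))))) ⟩
      I a b + J a b + (K ⊡ L) a b ∎

    private
      YW≈I : (P ⊞ K ⊡ L) ⊡ W ≈ᴹ I
      YW≈I a b = trans (sym (⊡-congʳ W I-tθ≈P+KL a b)) (I-tθ⊡W≈I a b)

      WY≈I : W ⊡ (P ⊞ K ⊡ L) ≈ᴹ I
      WY≈I a b = trans (sym (⊡-congˡ W I-tθ≈P+KL a b)) (W⊡I-tθ≈I a b)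

    open LowRank P Q W K L PQ≈I QP≈I YW≈I WY≈I ∂L≈0

    G : Carrier
    G = fΔ * det (I -ᴹ t ·ᴹ A +ᴹ t ^ 2 ·ᴹ D)

    G≈ : G ≈ fΔ * det B
    G≈ = *-congˡ (det-cong λ w w′ → begin
      I w w′ - t * A w w′ + t ^ 2 * D w w′
        ≈⟨ +-assoc _ _ _ ⟩
      I w w′ + (- (t * A w w′) + t ^ 2 * D w w′)
        ≈⟨ +-congˡ (+-congˡ (*-congˡ (D≈N w w′))) ⟩
      I w w′ + (- (t * A w w′) + t ^ 2 * (δ⟨ w ≟ w′ ⟩ * N w))
        ≈⟨ +-congˡ (LQK τ̂-sum w w′) ⟨
      B w w′ ∎)

    tr-W∂Y≈ : tr (W ⊡ λ a b → ∂ (Y a b)) ≈ - tr ((t ·ᴹ θ) ⊡ W)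
    tr-W∂Y≈ = begin
      tr (W ⊡ λ a b → ∂ (Y a b))
        ≈⟨ tr-cong (⊡-congˡ W ∂Y≈-tθ) ⟩
      tr (W ⊡ ⊟ (t ·ᴹ θ))
        ≈⟨ tr-comm W (⊟ (t ·ᴹ θ)) ⟩
      tr (⊟ (t ·ᴹ θ) ⊡ W)
        ≈⟨ tr-cong (λ a b → trans (sum-cong-≋ λ c → sym (-‿distribˡ-* (t * θ a c) (W c b)))
             (sum-neg λ c → t * θ a c * W c b)) ⟩
      tr (⊟ ((t ·ᴹ θ) ⊡ W))
        ≈⟨ sum-neg (λ a → ((t ·ᴹ θ) ⊡ W) a a) ⟩
      - tr ((t ·ᴹ θ) ⊡ W) ∎
      where
      ∂Y≈-tθ : ∀ a b → ∂ (Y a b) ≈ - (t * θ a b)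
      ∂Y≈-tθ a b = begin
        ∂ (Y a b)                      ≈⟨ ∂-cong (I-tθ≈P+KL a b) ⟨
        ∂ (I a b - t * θ a b)          ≈⟨ ∂-+ _ _ ⟩
        ∂ (I a b) + ∂ (- (t * θ a b))  ≈⟨ +-cong (∂-I a b) (trans (∂-neg _) (-‿cong (∂-t* _ (∂θ≈0 a b)))) ⟩
        0# - t * θ a b                 ≈⟨ +-identityˡ _ ⟩
        - (t * θ a b)                  ∎

    ∂G : ∂ G ≈ G * - tr ((t ·ᴹ θ) ⊡ W)
    ∂G = begin
      ∂ G
        ≈⟨ ∂-cong G≈ ⟩
      ∂ (fΔ * det B)
        ≈⟨ ∂-* fΔ (det B) ⟩
      ∂ fΔ * det B + fΔ * ∂ (det B)
        ≈⟨ +-cong (*-congʳ ∂fΔ) (*-congˡ ∂-det-B) ⟩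
      fΔ * tr E * det B + fΔ * (det B * tr (C ⊡ λ w w′ → ∂ (B w w′)))
        ≈⟨ solve 4 (λ f e b x → f :* e :* b :+ f :* (b :* x) := f :* b :* (e :+ x)) refl
             fΔ (tr E) (det B) (tr (C ⊡ λ w w′ → ∂ (B w w′))) ⟩
      fΔ * det B * (tr E + tr (C ⊡ λ w w′ → ∂ (B w w′)))
        ≈⟨ *-congˡ (+-congʳ tr-Q∂P) ⟨
      fΔ * det B * (tr (Q ⊡ λ a b → ∂ (P a b)) + tr (C ⊡ λ w w′ → ∂ (B w w′)))
        ≈⟨ *-cong (sym G≈) (trans (sym tr-W∂Y) tr-W∂Y≈) ⟩
      G * - tr ((t ·ᴹ θ) ⊡ W) ∎

-- Matrix powers and the Neumann series

module MatrixPowers {c ℓ} (R : CommutativeRing c ℓ) where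
  open CommutativeRing R hiding (zero)
  open FiniteAlgebra rawRing using (Matrix; I)
  open Matrices R

  power : ∀ {k} → Matrix k → ℕ → Matrix k
  power M zero    = I
  power M (suc n) = M ⊡ power M n

  power-sucʳ : ∀ {k} (M : Matrix k) n → power M n ⊡ M ≈ᴹ power M (suc n)
  power-sucʳ M zero    i j = trans (⊡-identityˡ M i j) (sym (⊡-identityʳ M i j))
  power-sucʳ M (suc n) i j = trans (⊡-assoc M (power M n) M i j) (⊡-congˡ M (power-sucʳ M n) i j)

module NeumannSeries {c ℓ} (R : CommutativeRing c ℓ) {k} (M : Fin k → Fin k → CommutativeRing.Carrier R) where
  open PowerSeries R
  open PowerSeriesCalculus R
  private
    module R = CommutativeRing R
    module S = CommutativeRing commutativeRing
    module F = FiniteAlgebra R.rawRing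
    module Mᴿ = Matrices R
    module Σ = Summation commutativeRing
    module RP = RingProperties R.ring
    module SP = RingProperties S.ring
  open MatrixPowers R
  open Matrices commutativeRing

  -- `W` is the sum of the Mⁿ tⁿ; the placing of the index n turns a sequence of matrices into a
  -- matrix of series.
  constᴹ W : Matrix k
  constᴹ a b = const (M a b)
  W a b n = power M n a b

  I-coefficient : ∀ (a b : Fin k) → I a b ≈ const (F.I a b)
  I-coefficient a b = S.sym (const-if (does (a ≟ b)) R.1# R.0#)

  constᴹ⊡W : ∀ a b n → (constᴹ ⊡ W) a b n R.≈ power M (suc n) a b
  constᴹ⊡W a b n = R.trans (sum-coefficient (λ c → constᴹ a c * W c b) n)
    (Summation.sum-cong-≋ R λ c → const-*-coefficient (M a c) (W c b) n)

  W⊡constᴹ : ∀ a b n → (W ⊡ constᴹ) a b n R.≈ power M (suc n) a b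
  W⊡constᴹ a b n = R.trans (sum-coefficient (λ c → W a c * constᴹ c b) n) (R.trans
    (Summation.sum-cong-≋ R λ c → R.trans (S.*-comm (W a c) (constᴹ c b) n)
      (R.trans (const-*-coefficient (M c b) (W a c) n) (R.*-comm (M c b) (power M n a c))))
    (power-sucʳ M n a b))

  -- Multiplying `W` by M, on either side, advances the powers by one, and multiplying by t delays
  -- them by one; the difference leaves only M⁰. Keeping `f` general covers both sides at once.
  W-recursion : ∀ a b (f : R⟦t⟧) → (∀ n → f n R.≈ power M (suc n) a b) → W a b - t * f ≈ I a b
  W-recursion a b f f≈ n = R.trans (coefficient n) (R.sym (I-coefficient a b n))
    where
    coefficient : ∀ n → W a b n R.+ R.- (t * f) n R.≈ const (F.I a b) n
    coefficient zero    = R.trans (R.+-congˡ (R.trans (R.-‿cong (t-*-zero f)) RP.-0#≈0#)) (R.+-identityʳ _)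
    coefficient (suc n) = R.trans (R.+-congˡ (R.-‿cong (R.trans (t-*-suc f n) (f≈ n)))) (R.-‿inverseʳ _)

  inverseʳ : (I -ᴹ t ·ᴹ constᴹ) ⊡ W ≈ᴹ I
  inverseʳ a b = S.trans (S.trans (⊡-distribʳ W I (⊟ (t ·ᴹ constᴹ)) a b)
    (S.+-cong {x = (I ⊡ W) a b} (⊡-identityˡ W a b) (S.trans
      (Σ.sum-cong-≋ λ c → S.trans (S.sym (SP.-‿distribˡ-* (t * constᴹ a c) (W c b)))
        (S.-‿cong (S.*-assoc t (constᴹ a c) (W c b))))
      (S.trans (Σ.sum-neg λ c → t * (constᴹ a c * W c b))
        (S.-‿cong (S.sym (Σ.*-distribˡ-sum t (λ c → constᴹ a c * W c b))))))))
    (W-recursion a b ((constᴹ ⊡ W) a b) (constᴹ⊡W a b))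

  inverseˡ : W ⊡ (I -ᴹ t ·ᴹ constᴹ) ≈ᴹ I
  inverseˡ a b = S.trans (S.trans (⊡-distribˡ W I (⊟ (t ·ᴹ constᴹ)) a b)
    (S.+-cong {x = (W ⊡ I) a b} (⊡-identityʳ W a b) (S.trans
      (Σ.sum-cong-≋ λ c → S.trans (S.sym (SP.-‿distribʳ-* (W a c) (t * constᴹ c b)))
        (S.-‿cong (S.trans (S.sym (S.*-assoc (W a c) t (constᴹ c b)))
          (S.trans (S.*-congʳ {constᴹ c b} (S.*-comm (W a c) t)) (S.*-assoc t (W a c) (constᴹ c b))))))
      (S.trans (Σ.sum-neg λ c → t * (W a c * constᴹ c b))
        (S.-‿cong (S.sym (Σ.*-distribˡ-sum t (λ c → W a c * constᴹ c b))))))))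
    (W-recursion a b ((W ⊡ constᴹ) a b) (W⊡constᴹ a b))

  trace-zero : tr ((t ·ᴹ constᴹ) ⊡ W) 0 R.≈ R.0#
  trace-suc : ∀ n → tr ((t ·ᴹ constᴹ) ⊡ W) (suc n) R.≈ Mᴿ.tr (power M (suc n))

  private
    factor-t : tr ((t ·ᴹ constᴹ) ⊡ W) ≈ t * tr (constᴹ ⊡ W)
    factor-t = Σ.sum-*ˡ t λ a → Σ.sum-*ˡ t λ c → S.*-assoc t (constᴹ a c) (W c a)

  trace-zero  = R.trans (factor-t 0) (t-*-zero (tr (constᴹ ⊡ W)))
  trace-suc n = R.trans (factor-t (suc n)) (R.trans (t-*-suc (tr (constᴹ ⊡ W)) n)
    (R.trans (sum-coefficient (λ a → (constᴹ ⊡ W) a a) n)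
      (Summation.sum-cong-≋ R λ a → constᴹ⊡W a a n)))

-- Constant terms of products and determinants

module ConstantTerms {c ℓ} (R : CommutativeRing c ℓ) where
  open PowerSeries R
  open PowerSeriesCalculus R
  private
    module R = CommutativeRing R
    module F = FiniteAlgebra R.rawRing
    module Σ = Summation R
  open R using (0#; 1#)

  *-head-zero : ∀ f g → f 0 R.≈ 0# → (f * g) 0 R.≈ 0#
  *-head-zero f g f₀≈0 = R.trans (*-head f g) (R.trans (R.*-congʳ f₀≈0) (R.zeroˡ _))

  *-head-one : ∀ f g → f 0 R.≈ 1# → g 0 R.≈ 1# → (f * g) 0 R.≈ 1#
  *-head-one f g f₀≈1 g₀≈1 = R.trans (*-head f g) (R.trans (R.*-cong f₀≈1 g₀≈1) (R.*-identityˡ 1#))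

  product-head : ∀ {n} (f : Fin n → R⟦t⟧) → (∀ i → f i 0 R.≈ 1#) → product f 0 R.≈ 1#
  product-head {zero}  f f₀≈1 = R.refl
  product-head {suc n} f f₀≈1 =
    *-head-one (f zero) (product λ i → f (suc i)) (f₀≈1 zero) (product-head _ λ i → f₀≈1 (suc i))

  -- At t = 0 the first row is that of the identity, so only column 0 remains; its sign is 1 by
  -- computation, and its minor satisfies the same hypothesis.
  det-head : ∀ {n} (M : Matrix n) → (∀ i j → M i j 0 R.≈ F.I i j) → det M 0 R.≈ 1#
  det-head {zero}  M M₀≈I = R.refl
  det-head {suc n} M M₀≈I = begin
    det M 0
      ≈⟨ sum-coefficient (λ j → s j * M zero j * d j) 0 ⟩
    F.sum (λ j → (s j * M zero j * d j) 0)
      ≈⟨ Σ.sum-cong-≋ {suc n} (λ j → begin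
           (s j * M zero j * d j) 0                ≈⟨ *-head (s j * M zero j) (d j) ⟩
           (s j * M zero j) 0 R.* d j 0            ≈⟨ R.*-congʳ (*-head (s j) (M zero j)) ⟩
           s j 0 R.* M zero j 0 R.* d j 0          ≈⟨ R.*-congʳ (R.*-congˡ (M₀≈I zero j)) ⟩
           s j 0 R.* F.I zero j R.* d j 0          ≈⟨ R.*-congʳ (R.*-comm (s j 0) (F.I zero j)) ⟩
           F.I zero j R.* s j 0 R.* d j 0          ≈⟨ R.*-assoc (F.I zero j) (s j 0) (d j 0) ⟩
           F.δ⟨ zero ≟ j ⟩ R.* (s j 0 R.* d j 0)   ∎) ⟩
    F.sum (λ j → F.δ⟨ zero ≟ j ⟩ R.* (s j 0 R.* d j 0))
      ≈⟨ Σ.sum-δ zero (λ j → s j 0 R.* d j 0) ⟩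
    1# R.* d zero 0
      ≈⟨ R.*-identityˡ (d zero 0) ⟩
    d zero 0
      ≈⟨ det-head (λ i k → M (suc i) (suc k)) (λ i k → M₀≈I (suc i) (suc k)) ⟩
    1# ∎
    where
    open SetoidReasoning R.setoid
    s d : Fin (suc n) → R⟦t⟧
    s j = (- 1ₛ) ^ toℕ j
    d j = det λ i k → M (suc i) (punchIn j k)

-- Closed paths and traces of powers

module ClosedPaths {c ℓ} (R : CommutativeℚAlgebra c ℓ) (Δ : Digraph)
  (θ : Digraph.𝒜 Δ → Digraph.𝒜 Δ → CommutativeℚAlgebra.Carrier R) where
  open Digraph Δ
  open CommutativeℚAlgebra R hiding (zero)
  open FiniteAlgebra rawRing
  open Summation commutativeRing
  open Matrices commutativeRing
  open MatrixPowers commutativeRing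
  open Zeta R Δ
  open SetoidReasoning setoid

  ∑Seq-cong : ∀ {k} m {F G : Vector (Fin k) m → Carrier} → (∀ w → F w ≈ G w) → ∑Seq m F ≈ ∑Seq m G
  ∑Seq-cong zero    F≈G = F≈G []
  ∑Seq-cong (suc m) F≈G = sum-cong-≋ λ a → ∑Seq-cong m λ w → F≈G (a ∷ w)

  ∑Seq-*ˡ : ∀ {k} m x (F : Vector (Fin k) m → Carrier) → ∑Seq m (λ w → x * F w) ≈ x * ∑Seq m F
  ∑Seq-*ˡ zero    x F = refl
  ∑Seq-*ˡ (suc m) x F = sum-*ˡ x λ a → ∑Seq-*ˡ m x (λ w → F (a ∷ w))

  product-zero : ∀ {n} (g : Fin n → Carrier) i → g i ≈ 0# → product g ≈ 0#
  product-zero g zero    gᵢ≈0 = trans (*-congʳ gᵢ≈0) (zeroˡ _)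
  product-zero g (suc i) gᵢ≈0 = trans (*-congˡ (product-zero (λ i → g (suc i)) i gᵢ≈0)) (zeroʳ _)

  steps : ∀ {k} → Vector 𝒜 (suc k) → Carrier
  steps {k} a = product λ (i : Fin k) → θ (a (inject₁ i)) (a (suc i))

  -- A walk with k + 1 arcs has k inner steps, and the step to `b` makes k + 1 factors. The end `b`
  -- stays independent of `a`, because peeling off the first step changes the start only.
  walks≈power : ∀ k a b → ∑Seq k (λ w → steps (a ∷ w) * θ ((a ∷ w) (fromℕ k)) b) ≈ power θ (suc k) a b
  walks≈power zero    a b = trans (*-identityˡ _) (sym (⊡-identityʳ θ a b))
  walks≈power (suc k) a b = sum-cong-≋ λ c → begin
    ∑Seq k (λ w → (θ a c * steps (c ∷ w)) * θ ((c ∷ w) (fromℕ k)) b)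
      ≈⟨ ∑Seq-cong k (λ w → *-assoc (θ a c) (steps (c ∷ w)) (θ ((c ∷ w) (fromℕ k)) b)) ⟩
    ∑Seq k (λ w → θ a c * (steps (c ∷ w) * θ ((c ∷ w) (fromℕ k)) b))
      ≈⟨ ∑Seq-*ˡ k (θ a c) (λ w → steps (c ∷ w) * θ ((c ∷ w) (fromℕ k)) b) ⟩
    θ a c * ∑Seq k (λ w → steps (c ∷ w) * θ ((c ∷ w) (fromℕ k)) b)
      ≈⟨ *-congˡ (walks≈power k c b) ⟩
    θ a c * power θ (suc k) c b ∎

  module _ (θ-support : ∀ a b → 𝔥 a ≢ 𝔱 b → θ a b ≈ 0#) where

    not-closed : ∀ {k} (a : Vector 𝒜 (suc k)) → ¬ IsClosedPath a → steps a * θ (a (fromℕ k)) (a zero) ≈ 0#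
    not-closed {k} a ¬closed = case all? step? of λ where
        (yes steps-match) → trans (*-congˡ (θ-support _ _ λ last → ¬closed (steps-match , last))) (zeroʳ _)
        (no ¬steps-match) → case ¬∀⟶∃¬ k _ step? ¬steps-match of λ where
          (i , ¬step) → trans (*-congʳ (product-zero _ i (θ-support _ _ ¬step))) (zeroˡ _)
      where
      step? : ∀ (i : Fin k) → Dec (𝔥 (a (inject₁ i)) ≡ 𝔱 (a (suc i)))
      step? i = 𝔥 (a (inject₁ i)) ≟ 𝔱 (a (suc i))

    N≈trace : ∀ k → N θ k ≈ tr (power θ (suc k))
    N≈trace k = sum-cong-≋ λ a → trans
      (∑Seq-cong k λ w → drop (a ∷ w) (isClosedPath? (a ∷ w)))
      (walks≈power k a a)
      where
      drop : ∀ (a : Vector 𝒜 (suc k)) (closed? : Dec (IsClosedPath a)) →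
        (if does closed? then steps a * θ (a (fromℕ k)) (a zero) else 0#) ≈ steps a * θ (a (fromℕ k)) (a zero)
      drop a (yes _)      = refl
      drop a (no ¬closed) = sym (not-closed a ¬closed)

-- The zeta function and the conclusion

module ZetaDeterminant {c ℓ ℓ′} (R : CommutativeℚAlgebra c ℓ) (Δ : Digraph)
  {_≤_ : Rel (Digraph.V Δ) ℓ′} (≤-isTotalOrder : IsTotalOrder _≡_ _≤_)
  (τ υ : Digraph.𝒜 Δ → CommutativeℚAlgebra.Carrier R) where
  open Digraph Δ
  private module R = CommutativeℚAlgebra R
  open PowerSeries R.commutativeRing
  open PowerSeriesCalculus R.commutativeRing
  open ExponentialDerivative R
  open ConstantTerms R.commutativeRing
  open Zeta R Δ
  open Weighted R Δ ≤-isTotalOrder τ υ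
  open WeightedInverse R Δ ≤-isTotalOrder τ υ
  open ZetaInverse R Δ
  open Derivation euler
  private
    module S = CommutativeRing commutativeRing
    module F = FiniteAlgebra R.rawRing
    module ΣR = Summation R.commutativeRing
    module RP = RingProperties R.ring
  open Matrices commutativeRing using (tr; _⊡_)
  open NeumannSeries R.commutativeRing θᴳ
  open ClosedPaths R Δ θᴳ using (N≈trace)

  -- These are constant series of sums taken in R, whereas the abstract argument sums in the ring of
  -- series. Since `CycleIdentity` takes them as parameters and the comparison as hypotheses, its
  -- `G` is by computation the right-hand side of the theorem.
  τ̂ υ̂ d̂ : V → V → R⟦t⟧
  τ̂ u v = const a⟨ u , v ⟩
  υ̂ u v = const (F.∑[ 𝒜⟨ u , v ⟩? ] υ)
  d̂ u v = const d⟨ u , v ⟩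

  const-∑ : ∀ {n p} {P : U.Pred (Fin n) p} (P? : U.Decidable P) (x : Fin n → R.Carrier) →
            const (F.∑[ P? ] x) ≈ ∑[ P? ] (λ i → const (x i))
  const-∑ P? x = S.trans (const-sum (λ i → if does (P? i) then x i else R.0#))
    (Summation.sum-cong-≋ commutativeRing λ i → const-if (does (P? i)) (x i) R.0#)

  d̂-product : ∀ u v → d̂ u v ≈ τ̂ u v * υ̂ v u
  d̂-product u v = S.trans (const-cong (ΣR.sum-*ʳ (F.∑[ 𝒜⟨ v , u ⟩? ] υ) λ a → factor (does (𝒜⟨ u , v ⟩? a)) (τ a)))
    (const-* a⟨ u , v ⟩ (F.∑[ 𝒜⟨ v , u ⟩? ] υ))
    where
    if-*ˡ : ∀ b x y → (if b then x R.* y else R.0#) R.≈ x R.* (if b then y else R.0#)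
    if-*ˡ true  x y = R.refl
    if-*ˡ false x y = R.sym (R.zeroʳ x)

    factor : ∀ b x → (if b then (F.∑[ 𝒜⟨ v , u ⟩? ] λ a′ → x R.* υ a′) else R.0#) R.≈
                     (if b then x else R.0#) R.* (F.∑[ 𝒜⟨ v , u ⟩? ] υ)
    factor true  x = ΣR.sum-*ˡ x λ a′ → if-*ˡ (does (𝒜⟨ v , u ⟩? a′)) x (υ a′)
    factor false x = R.sym (R.zeroˡ _)

  constᴹ-θᴳ : ∀ a b → constᴹ a b ≈ const (τ b) * δ⟨ 𝔥 a ≟ 𝔱 b ⟩ - const (υ b) * δ⟨ S? a b ⟩
  constᴹ-θᴳ a b = S.trans (const-+ (τ b R.* F.δ⟨ 𝔥 a ≟ 𝔱 b ⟩) (R.- (υ b R.* F.δ⟨ S? a b ⟩)))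
    (S.+-cong (term (𝔥 a ≟ 𝔱 b) (τ b)) (S.trans (const-neg (υ b R.* F.δ⟨ S? a b ⟩)) (S.-‿cong (term (S? a b) (υ b)))))
    where
    term : ∀ {p} {P : Set p} (P? : Dec P) x → const (x R.* F.δ⟨ P? ⟩) ≈ const x * δ⟨ P? ⟩
    term P? x = S.trans (const-* x F.δ⟨ P? ⟩) (S.*-congˡ {const x} (const-if (does P?) R.1# R.0#))

  -- An inverse arc of `a` starts where `a` ends, so the υ-part has the same support condition as
  -- the τ-part.
  θᴳ-support : ∀ a b → 𝔥 a ≢ 𝔱 b → θᴳ a b R.≈ R.0#
  θᴳ-support a b ha≢tb = R.trans (R.+-cong (vanish (𝔥 a ≟ 𝔱 b) (τ b) ha≢tb)
    (R.trans (R.-‿cong (vanish (S? a b) (υ b) λ { (tb≡ha , _) → ha≢tb (≡.sym tb≡ha) })) RP.-0#≈0#)) (R.+-identityˡ R.0#)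
    where
    vanish : ∀ {p} {P : Set p} (P? : Dec P) x → ¬ P → x R.* F.δ⟨ P? ⟩ R.≈ R.0#
    vanish (yes p) x ¬p = contradiction p ¬p
    vanish (no  _) x _  = R.zeroʳ x

  T G : R⟦t⟧
  T = tr ((t ·ᴹ constᴹ) ⊡ W)
  G = fΔ * det (I -ᴹ t ·ᴹ A +ᴹ t ^ 2 ·ᴹ D)

  ∂G≈ : ∂ G ≈ G * - T
  ∂G≈ = CycleIdentity.∂G commutativeRing euler Δ ≤-isTotalOrder _≤?_ Φ? Φ⁽³⁾?
    t (λ a → const (τ a)) (λ a → const (υ a)) τ̂ υ̂ d̂ (λ u v → f u v ⁻¹)
    f-inverseʳ (λ u v → const-∑ 𝒜⟨ u , v ⟩? τ) (λ u v → const-∑ 𝒜⟨ u , v ⟩? υ) d̂-product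
    ∂-t (λ a → ∂-const (τ a)) (λ a → ∂-const (υ a))
    constᴹ W (λ a b → ∂-const (θᴳ a b)) constᴹ-θᴳ inverseʳ inverseˡ

  -- ∂ multiplies coefficient n + 1 by n + 1 and so removes the denominator in `logZ`; the index
  -- shift in `N` makes the remaining coefficient the trace of the power n + 1 of θ.
  ∂logZ≈T : ∂ (logZ θᴳ) ≈ T
  ∂logZ≈T zero    = R.sym trace-zero
  ∂logZ≈T (suc n) = R.trans (·-unit-fraction n (N θᴳ n))
    (R.trans (N≈trace θᴳ-support n) (R.sym (trace-suc n)))

  ∂Z≈ : ∂ (Z θᴳ) ≈ Z θᴳ * T
  ∂Z≈ = S.trans (∂-exp (logZ θᴳ) R.refl) (S.*-congˡ {Z θᴳ} ∂logZ≈T)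

  Z-head : Z θᴳ 0 R.≈ R.1#
  Z-head = R.trans (R.+-identityʳ _) (R.trans (R.*-identityʳ _) 1#-homo)
    where open RingMorphisms.IsRingHomomorphism R.isHomomorphism using (1#-homo)

  f-head : ∀ u v → f u v 0 R.≈ R.1#
  f-head u v with does (u ≟ v)
  ... | true  = R.trans (R.+-congˡ (t-*-zero (υ̂ u u))) (R.+-identityʳ R.1#)
  ... | false = R.trans (R.+-congˡ (R.trans (R.-‿cong (*-head-zero (t ^ 2 * υ̂ u v) (υ̂ v u)
    (*-head-zero (t ^ 2) (υ̂ u v) (t-*-zero (t ^ 1))))) RP.-0#≈0#)) (R.+-identityʳ R.1#)

  G-head : G 0 R.≈ R.1#
  G-head = *-head-one fΔ (det (I -ᴹ t ·ᴹ A +ᴹ t ^ 2 ·ᴹ D))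
    (product-head _ λ u → product-head _ λ v → factor u v (does (Φ? u v)))
    (det-head (I -ᴹ t ·ᴹ A +ᴹ t ^ 2 ·ᴹ D) entry)
    where
    factor : ∀ u v b → (if b then f u v else 1ₛ) 0 R.≈ R.1#
    factor u v true  = f-head u v
    factor u v false = R.refl

    entry : ∀ w w′ → (I -ᴹ t ·ᴹ A +ᴹ t ^ 2 ·ᴹ D) w w′ 0 R.≈ F.I w w′
    entry w w′ = R.trans (R.+-cong
      (R.trans (R.+-cong (S.sym (const-if (does (w ≟ w′)) R.1# R.0#) 0)
        (R.trans (R.-‿cong (t-*-zero (A w w′))) RP.-0#≈0#)) (R.+-identityʳ _))
      (*-head-zero (t ^ 2) (D w w′) (t-*-zero (t ^ 1)))) (R.+-identityʳ _)

  Z*G≈1 : Z θᴳ * G ≈ 1ₛ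
  Z*G≈1 = S.trans (∂≈0⇒const (Z θᴳ * G) ∂ZG≈0) (const-cong (*-head-one (Z θᴳ) G Z-head G-head))
    where
    open SetoidReasoning S.setoid

    ∂ZG≈0 : ∂ (Z θᴳ * G) ≈ const R.0#
    ∂ZG≈0 = begin
      ∂ (Z θᴳ * G)                       ≈⟨ ∂-* (Z θᴳ) G ⟩
      ∂ (Z θᴳ) * G + Z θᴳ * ∂ G          ≈⟨ S.+-cong (S.*-congʳ {G} ∂Z≈) (S.*-congˡ {Z θᴳ} ∂G≈) ⟩
      Z θᴳ * T * G + Z θᴳ * (G * - T)
        ≈⟨ solve 3 (λ z t g → z :* t :* g :+ z :* (g :* :- t) := :0) S.refl (Z θᴳ) T G ⟩
      const R.0#                         ∎
      where open IntegerSolver commutativeRing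

  Z⁻¹≈G : Z θᴳ ⁻¹ ≈ G
  Z⁻¹≈G = begin
    Z θᴳ ⁻¹                  ≈⟨ S.*-identityʳ (Z θᴳ ⁻¹) ⟨
    Z θᴳ ⁻¹ * 1ₛ             ≈⟨ S.*-congˡ {Z θᴳ ⁻¹} Z*G≈1 ⟨
    Z θᴳ ⁻¹ * (Z θᴳ * G)     ≈⟨ S.*-assoc (Z θᴳ ⁻¹) (Z θᴳ) G ⟨
    Z θᴳ ⁻¹ * Z θᴳ * G       ≈⟨ S.*-congʳ {G} (S.*-comm (Z θᴳ ⁻¹) (Z θᴳ)) ⟩
    Z θᴳ * Z θᴳ ⁻¹ * G       ≈⟨ S.*-congʳ {G} (Z-inverseʳ θᴳ) ⟩
    1ₛ * G                   ≈⟨ S.*-identityˡ G ⟩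
    G                        ∎
    where open SetoidReasoning S.setoid

mainTheorem1 : ∀ {c ℓ ℓ′} (R : CommutativeℚAlgebra c ℓ) (Δ : Digraph)
    (_≤_ : Rel (Digraph.V Δ) ℓ′) (≤-isTotalOrder : IsTotalOrder _≡_ _≤_)
    (τ υ : Digraph.𝒜 Δ → CommutativeℚAlgebra.Carrier R) →
    let open PowerSeries (CommutativeℚAlgebra.commutativeRing R)
        open Zeta R Δ
        open Weighted R Δ ≤-isTotalOrder τ υ
    in Z θᴳ ⁻¹ ≈ fΔ * det (I -ᴹ t ·ᴹ A +ᴹ t ^ 2 ·ᴹ D)
mainTheorem1 R Δ _≤_ ≤-isTotalOrder τ υ = ZetaDeterminant.Z⁻¹≈G R Δ ≤-isTotalOrder τ υ
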